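{- The integrality gap of the semidefinite program $\mathrm{SDP}_1$ (the Povh–Rendl QAP relaxation specialized to the traveling salesman problem, defined in the context) is unbounded; that is, $$\sup_{D\in\mathcal{D}} \frac{\mathrm{OPT}_{\mathrm{TSP}}(D)}{\mathrm{OPT}_{\mathrm{SDP}_1}(D)}=+\infty .$$
   Context: TSP: an instance on $n$ vertices is a symmetric matrix $D=(d_{ij})\in\mathbb{R}^{n\times n}$ with $d_{ij}\ge 0$, $d_{ii}=0$ and $d_{ij}\le d_{ik}+d_{kj}$ for all $i,j,k$ (distinct vertices may be at distance $0$). $\mathcal{D}$ is the set of all such matrices, over all $n\ge 3$. $\mathrm{OPT}_{\mathrm{TSP}}(D)$ is the minimum total cost of a Hamiltonian cycle in $K_n$ with edge costs $d_{ij}$. Notation: $I_m$, $J_m$ are the $m\times m$ identity and all-ones matrices; $E^{(m)}_{jj}$ is the $m\times m$ matrix with a single $1$ in position $(j,j)$; $\mathbb{S}^{m\times m}$ is the set of real symmetric $m\times m$ matrices; $\otimes$ is the Kronecker product; $Y\ge 0$ is entrywise and $Y\succeq 0$ means positive semidefinite. $C^{(n)}_1$ is the adjacency matrix of the $n$-cycle with edges $\{i,i+1\}$ and $\{n,1\}$. $\mathrm{SDP}_1$: $\mathrm{OPT}_{\mathrm{SDP}_1}(D)$ is the minimum of $\tfrac12\mathrm{trace}\big((D\otimes C^{(n)}_1)Y\big)$ over $Y\in\mathbb{S}^{n^2\times n^2}$ with $Y\ge 0$, $Y\succeq 0$ and (i) $\mathrm{trace}((I_n\otimes E^{(n)}_{jj})Y)=1$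 for $j=1,\dots,n$; (ii) $\mathrm{trace}((E^{(n)}_{jj}\otimes I_n)Y)=1$ for $j=1,\dots,n$; (iii) $\mathrm{trace}\big((I_n\otimes(J_n-I_n)+(J_n-I_n)\otimes I_n)Y\big)=0$; (iv) $\mathrm{trace}(J_{n^2}Y)=n^2$. In the supremum, instances with $\mathrm{OPT}_{\mathrm{TSP}}(D)=0$ are disregarded, and a ratio with positive numerator and zero denominator is read as $+\infty$. -}

module Defs where

open import Algebra.Bundles using (RawMonoid)
import Algebra.Definitions.RawMonoid as RawMonoidDefs
open import Data.Bool.Base using (if_then_else_; _∨_)
open import Data.Fin.Base using (Fin; toℕ; quotient; remainder)
open import Data.Fin.Permutation using (Permutation′; _⟨$⟩ʳ_)
import Data.Fin.Properties as Fin
open import Data.Integer.Base using (+_)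
open import Data.Nat.Base as ℕ using (ℕ; suc)
import Data.Nat.DivMod as ℕ
import Data.Nat.Properties as ℕ
open import Data.Product.Base using (∃; _×_; _,_)
open import Data.Rational.Base as ℚ using (ℚ; 0ℚ; 1ℚ; ½)
import Data.Rational.Properties as ℚ
open import Data.Rational.Solver using (module +-*-Solver)
open import Data.Unit.Base using (⊤)
open import Level using (0ℓ)
open import Relation.Binary.PropositionalEquality
  using (_≡_; refl; sym; trans; cong; cong₂; subst; subst₂)
open import Relation.Nullary.Decidable.Core using (⌊_⌋)
open import Relation.Unary using (Pred; U)

-- The real numbers are Cauchy sequences of rationals, with the setoid
-- equality _≈_ in place of a quotient.

Eventually : Pred ℕ 0ℓ → Set
Eventually P = ∃ λ N → ∀ n → N ℕ.≤ n → P n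

IsCauchy : (ℕ → ℚ) → Set
IsCauchy x = ∀ ε → 0ℚ ℚ.< ε →
  ∃ λ N → ∀ m n → N ℕ.≤ m → N ℕ.≤ n → ℚ.∣ x m ℚ.- x n ∣ ℚ.< ε

-- Without eta, and with operations given by copatterns, x + y and x * y are
-- stuck terms, so that their arguments can be inferred; _≈_, _≤_ and _<_ are
-- records for the same reason.
record ℝ : Set where
  no-eta-equality
  constructor mkℝ
  field
    seq    : ℕ → ℚ
    cauchy : IsCauchy seq
open ℝ public

infix 4 _≈_ _≤_ _<_

record _≈_ (x y : ℝ) : Set where
  constructor mk≈
  field
    close : ∀ ε → 0ℚ ℚ.< ε →
      Eventually λ n → ℚ.∣ seq x n ℚ.- seq y n ∣ ℚ.< ε

record _≤_ (x y : ℝ) : Set where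
  constructor mk≤
  field
    below : ∀ ε → 0ℚ ℚ.< ε → Eventually λ n → seq x n ℚ.< seq y n ℚ.+ ε

record _<_ (x y : ℝ) : Set where
  constructor mk<
  field
    gap       : ℚ
    positive  : 0ℚ ℚ.< gap
    separated : Eventually λ n → seq x n ℚ.+ gap ℚ.< seq y n

private
  half-pos : ∀ {ε} → 0ℚ ℚ.< ε → 0ℚ ℚ.< ½ ℚ.* ε
  half-pos {ε} 0<ε = subst (ℚ._< ½ ℚ.* ε) (ℚ.*-zeroʳ ½)
    (ℚ.*-monoʳ-<-pos ½ {0ℚ} {ε} 0<ε)

  half+half : ∀ ε → ½ ℚ.* ε ℚ.+ ½ ℚ.* ε ≡ ε
  half+half ε = trans (sym (ℚ.*-distribʳ-+ ε ½ ½)) (ℚ.*-identityˡ ε)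

  cauchy-const : ∀ q → IsCauchy (λ _ → q)
  cauchy-const q ε 0<ε = 0 , λ _ _ _ _ →
    subst (λ d → ℚ.∣ d ∣ ℚ.< ε) (sym (ℚ.+-inverseʳ q)) 0<ε

  cauchy-neg : ∀ {x} → IsCauchy x → IsCauchy (λ n → ℚ.- x n)
  cauchy-neg {x} cx ε 0<ε with cx ε 0<ε
  ... | N , close = N , λ m n N≤m N≤n →
    subst (ℚ._< ε) (eq (x m) (x n)) (close m n N≤m N≤n)
    where
    open +-*-Solver
    eq : ∀ a b → ℚ.∣ a ℚ.- b ∣ ≡ ℚ.∣ (ℚ.- a) ℚ.- (ℚ.- b) ∣
    eq a b = trans (sym (ℚ.∣-p∣≡∣p∣ (a ℚ.- b)))
      (cong ℚ.∣_∣ (solve 2 (λ a b → :- (a :- b) := (:- a) :- (:- b)) refl a b))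

  cauchy-+ : ∀ {x y} → IsCauchy x → IsCauchy y → IsCauchy (λ n → x n ℚ.+ y n)
  cauchy-+ {x} {y} cx cy ε 0<ε
    with cx (½ ℚ.* ε) (half-pos 0<ε) | cy (½ ℚ.* ε) (half-pos 0<ε)
  ... | M , closeˣ | N , closeʸ = M ℕ.⊔ N , λ m n p q → begin-strict
    ℚ.∣ (x m ℚ.+ y m) ℚ.- (x n ℚ.+ y n) ∣
      ≡⟨ cong ℚ.∣_∣ (regroup (x m) (y m) (x n) (y n)) ⟩
    ℚ.∣ (x m ℚ.- x n) ℚ.+ (y m ℚ.- y n) ∣
      ≤⟨ ℚ.∣p+q∣≤∣p∣+∣q∣ (x m ℚ.- x n) (y m ℚ.- y n) ⟩
    ℚ.∣ x m ℚ.- x n ∣ ℚ.+ ℚ.∣ y m ℚ.- y n ∣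
      <⟨ ℚ.+-mono-< (closeˣ m n (ℕ.m⊔n≤o⇒m≤o M N p) (ℕ.m⊔n≤o⇒m≤o M N q))
                    (closeʸ m n (ℕ.m⊔n≤o⇒n≤o M N p) (ℕ.m⊔n≤o⇒n≤o M N q)) ⟩
    ½ ℚ.* ε ℚ.+ ½ ℚ.* ε
      ≡⟨ half+half ε ⟩
    ε ∎
    where
    open ℚ.≤-Reasoning
    open +-*-Solver
    regroup : ∀ a b c d →
      (a ℚ.+ b) ℚ.- (c ℚ.+ d) ≡ (a ℚ.- c) ℚ.+ (b ℚ.- d)
    regroup = solve 4 (λ a b c d →
      (a :+ b) :- (c :+ d) := (a :- c) :+ (b :- d)) refl

  cauchy-bounded : ∀ {x} → IsCauchy x →
    ∃ λ B → 0ℚ ℚ.< B × Eventually λ n → ℚ.∣ x n ∣ ℚ.≤ B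
  cauchy-bounded {x} cx with cx 1ℚ (ℚ.positive⁻¹ 1ℚ)
  ... | N , close =
    1ℚ ℚ.+ ℚ.∣ x N ∣ , ℚ.+-mono-<-≤ (ℚ.positive⁻¹ 1ℚ) (ℚ.0≤∣p∣ (x N)) ,
    N , λ n N≤n → begin
      ℚ.∣ x n ∣                          ≡⟨ cong ℚ.∣_∣ (split (x n) (x N)) ⟩
      ℚ.∣ (x n ℚ.- x N) ℚ.+ x N ∣        ≤⟨ ℚ.∣p+q∣≤∣p∣+∣q∣ (x n ℚ.- x N) (x N) ⟩
      ℚ.∣ x n ℚ.- x N ∣ ℚ.+ ℚ.∣ x N ∣    ≤⟨ ℚ.+-monoˡ-≤ ℚ.∣ x N ∣ (ℚ.<⇒≤ (close n N N≤n ℕ.≤-refl)) ⟩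
      1ℚ ℚ.+ ℚ.∣ x N ∣                   ∎
    where
    open ℚ.≤-Reasoning
    open +-*-Solver
    split : ∀ a b → a ≡ (a ℚ.- b) ℚ.+ b
    split = solve 2 (λ a b → a := (a :- b) :+ b) refl

  -- For every bound B and tolerance ε there is δ with B * δ = ε.
  quot : ∀ {B ε} → 0ℚ ℚ.< B → 0ℚ ℚ.< ε →
    ∃ λ δ → 0ℚ ℚ.< δ × B ℚ.* δ ≡ ε
  quot {B} {ε} 0<B 0<ε = δ , 0<δ , Bδ≡ε
    where
    instance
      posB = ℚ.positive 0<B
      nzB  = ℚ.pos⇒nonZero B
    δ = ℚ.1/ B ℚ.* ε
    Bδ≡ε : B ℚ.* δ ≡ ε
    Bδ≡ε = trans (sym (ℚ.*-assoc B (ℚ.1/ B) ε))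
      (trans (cong (ℚ._* ε) (ℚ.*-inverseʳ B)) (ℚ.*-identityˡ ε))
    0<δ : 0ℚ ℚ.< δ
    0<δ = ℚ.*-cancelˡ-<-nonNeg B {{ℚ.pos⇒nonNeg B}}
      (subst₂ ℚ._<_ (sym (ℚ.*-zeroʳ B)) (sym Bδ≡ε) 0<ε)

  *-bound : ∀ B δ a d → ℚ.∣ a ∣ ℚ.≤ B → ℚ.∣ d ∣ ℚ.< δ → 0ℚ ℚ.< B →
    ℚ.∣ a ℚ.* d ∣ ℚ.< B ℚ.* δ
  *-bound B δ a d a≤B d<δ 0<B = begin-strict
    ℚ.∣ a ℚ.* d ∣          ≡⟨ ℚ.∣p*q∣≡∣p∣*∣q∣ a d ⟩
    ℚ.∣ a ∣ ℚ.* ℚ.∣ d ∣    ≤⟨ ℚ.*-monoʳ-≤-nonNeg ℚ.∣ d ∣ {{ℚ.nonNegative (ℚ.0≤∣p∣ d)}} a≤B ⟩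
    B ℚ.* ℚ.∣ d ∣          <⟨ ℚ.*-monoʳ-<-pos B {{ℚ.positive 0<B}} d<δ ⟩
    B ℚ.* δ                ∎
    where open ℚ.≤-Reasoning

  *-close : ∀ {B C δ η ε} a b c d → 0ℚ ℚ.< B → 0ℚ ℚ.< C →
    B ℚ.* η ≡ ½ ℚ.* ε → C ℚ.* δ ≡ ½ ℚ.* ε →
    ℚ.∣ a ∣ ℚ.≤ B → ℚ.∣ d ∣ ℚ.≤ C → ℚ.∣ a ℚ.- c ∣ ℚ.< δ → ℚ.∣ b ℚ.- d ∣ ℚ.< η →
    ℚ.∣ a ℚ.* b ℚ.- c ℚ.* d ∣ ℚ.< ε
  *-close {B} {C} {δ} {η} {ε} a b c d 0<B 0<C Bη≡ Cδ≡ a≤B d≤C ac bd = begin-strict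
    ℚ.∣ a ℚ.* b ℚ.- c ℚ.* d ∣
      ≡⟨ cong ℚ.∣_∣ (regroup a b c d) ⟩
    ℚ.∣ a ℚ.* (b ℚ.- d) ℚ.+ d ℚ.* (a ℚ.- c) ∣
      ≤⟨ ℚ.∣p+q∣≤∣p∣+∣q∣ (a ℚ.* (b ℚ.- d)) (d ℚ.* (a ℚ.- c)) ⟩
    ℚ.∣ a ℚ.* (b ℚ.- d) ∣ ℚ.+ ℚ.∣ d ℚ.* (a ℚ.- c) ∣
      <⟨ ℚ.+-mono-< (*-bound B η a (b ℚ.- d) a≤B bd 0<B)
                    (*-bound C δ d (a ℚ.- c) d≤C ac 0<C) ⟩
    B ℚ.* η ℚ.+ C ℚ.* δ
      ≡⟨ cong₂ ℚ._+_ Bη≡ Cδ≡ ⟩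
    ½ ℚ.* ε ℚ.+ ½ ℚ.* ε
      ≡⟨ half+half ε ⟩
    ε ∎
    where
    open ℚ.≤-Reasoning
    open +-*-Solver
    regroup : ∀ a b c d →
      a ℚ.* b ℚ.- c ℚ.* d ≡ a ℚ.* (b ℚ.- d) ℚ.+ d ℚ.* (a ℚ.- c)
    regroup = solve 4 (λ a b c d →
      a :* b :- c :* d := a :* (b :- d) :+ d :* (a :- c)) refl

  cauchy-* : ∀ {x y} → IsCauchy x → IsCauchy y → IsCauchy (λ n → x n ℚ.* y n)
  cauchy-* {x} {y} cx cy ε 0<ε =
    let B , 0<B , M₁ , bˣ = cauchy-bounded {x} cx
        C , 0<C , M₂ , bʸ = cauchy-bounded {y} cy
        δ , 0<δ , Cδ≡ = quot {C} {½ ℚ.* ε} 0<C (half-pos 0<ε)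
        η , 0<η , Bη≡ = quot {B} {½ ℚ.* ε} 0<B (half-pos 0<ε)
        N₁ , closeˣ = cx δ 0<δ
        N₂ , closeʸ = cy η 0<η
        M = M₁ ℕ.⊔ M₂
        N = N₁ ℕ.⊔ N₂
    in M ℕ.⊔ N , λ m n p q →
      let pᴺ = ℕ.m⊔n≤o⇒n≤o M N p
          qᴺ = ℕ.m⊔n≤o⇒n≤o M N q
      in *-close (x m) (y m) (x n) (y n) 0<B 0<C Bη≡ Cδ≡
           (bˣ m (ℕ.m⊔n≤o⇒m≤o M₁ M₂ (ℕ.m⊔n≤o⇒m≤o M N p)))
           (bʸ n (ℕ.m⊔n≤o⇒n≤o M₁ M₂ (ℕ.m⊔n≤o⇒m≤o M N q)))
           (closeˣ m n (ℕ.m⊔n≤o⇒m≤o N₁ N₂ pᴺ) (ℕ.m⊔n≤o⇒m≤o N₁ N₂ qᴺ))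
           (closeʸ m n (ℕ.m⊔n≤o⇒n≤o N₁ N₂ pᴺ) (ℕ.m⊔n≤o⇒n≤o N₁ N₂ qᴺ))

infixl 6 _+_ _-_
infixl 7 _*_
infix  8 -_

fromℚ : ℚ → ℝ
fromℚ q .seq _  = q
fromℚ q .cauchy = cauchy-const q

fromℕ : ℕ → ℝ
fromℕ n = fromℚ (+ n ℚ./ 1)

0ℝ 1ℝ : ℝ
0ℝ = fromℚ 0ℚ
1ℝ = fromℚ 1ℚ

_+_ : ℝ → ℝ → ℝ
(x + y) .seq n  = seq x n ℚ.+ seq y n
(x + y) .cauchy = cauchy-+ {seq x} {seq y} (cauchy x) (cauchy y)

_*_ : ℝ → ℝ → ℝ
(x * y) .seq n  = seq x n ℚ.* seq y n
(x * y) .cauchy = cauchy-* {seq x} {seq y} (cauchy x) (cauchy y)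

-_ : ℝ → ℝ
(- x) .seq n  = ℚ.- seq x n
(- x) .cauchy = cauchy-neg {seq x} (cauchy x)

_-_ : ℝ → ℝ → ℝ
x - y = x + (- y)

+-rawMonoid : RawMonoid 0ℓ 0ℓ
+-rawMonoid = record { Carrier = ℝ ; _≈_ = _≈_ ; _∙_ = _+_ ; ε = 0ℝ }

open RawMonoidDefs +-rawMonoid public using (sum)

infix 4 _<∞_

data ℝ∞ : Set where
  fin : ℝ → ℝ∞
  +∞  : ℝ∞

_<∞_ : ℝ → ℝ∞ → Set
M <∞ fin r = M < r
M <∞ +∞    = ⊤

SupIs+∞ : Pred ℝ∞ 0ℓ → Set
SupIs+∞ S = ∀ M → ∃ λ r → S r × M <∞ r

-- r = t / s; a positive t over a zero s gives +∞.
IsRatio : ℝ → ℝ → ℝ∞ → Set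
IsRatio t s (fin r) = 0ℝ < s × r * s ≈ t
IsRatio t s +∞      = 0ℝ < t × s ≈ 0ℝ

IsMinimum : {A : Set} → Pred A 0ℓ → (A → ℝ) → ℝ → Set
IsMinimum P f v = (∃ λ a → P a × f a ≈ v) × (∀ a → P a → v ≤ f a)

Matrix : ℕ → Set
Matrix m = Fin m → Fin m → ℝ

Symmetric : ∀ {m} → Matrix m → Set
Symmetric A = ∀ i j → A i j ≈ A j i

EntrywiseNonNegative : ∀ {m} → Matrix m → Set
EntrywiseNonNegative A = ∀ i j → 0ℝ ≤ A i j

-- To be used together with Symmetric.
PositiveSemidefinite : ∀ {m} → Matrix m → Set
PositiveSemidefinite A =
  ∀ (x : Fin _ → ℝ) → 0ℝ ≤ sum λ i → sum λ j → x i * A i j * x j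

infixl 6 _⊞_ _⊟_
infixl 7 _·_ _⊗_

_⊞_ _⊟_ _·_ : ∀ {m} → Matrix m → Matrix m → Matrix m
(A ⊞ B) i j = A i j + B i j
(A ⊟ B) i j = A i j - B i j
(A · B) i j = sum λ k → A i k * B k j

-- Position p of Fin (m * n) is n * quotient p + remainder p, so the blocks
-- are indexed by the left factor.
_⊗_ : ∀ {m n} → Matrix m → Matrix n → Matrix (m ℕ.* n)
_⊗_ {m} {n} A B p q =
  A (quotient n p) (quotient n q) * B (remainder {m} n p) (remainder {m} n q)

trace : ∀ {m} → Matrix m → ℝ
trace A = sum λ i → A i i

I J : ∀ m → Matrix m
I m i j = if ⌊ i Fin.≟ j ⌋ then 1ℝ else 0ℝ
J m i j = 1ℝ

E : ∀ m → Fin m → Matrix m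
E m k i j = I m i k * I m k j

next : ∀ {n} → Fin n → Fin n
next {n} i = ℕ._mod_ (suc (toℕ i)) n {{Fin.nonZeroIndex i}}

-- For n ≤ 2 this is not the adjacency matrix of a simple cycle.
C₁ : ∀ n → Matrix n
C₁ n i j = if ⌊ j Fin.≟ next i ⌋ ∨ ⌊ i Fin.≟ next j ⌋ then 1ℝ else 0ℝ

record IsTSPInstance {n} (D : Matrix n) : Set where
  field
    symmetric   : Symmetric D
    nonNegative : EntrywiseNonNegative D
    zeroDiag    : ∀ i → D i i ≈ 0ℝ
    triangle    : ∀ i j k → D i j ≤ D i k + D k j

-- A permutation π encodes the Hamiltonian cycle π 0, π 1, …, π (n - 1), π 0.
tourCost : ∀ {n} → Matrix n → Permutation′ n → ℝ
tourCost D π = sum λ i → D (π ⟨$⟩ʳ i) (π ⟨$⟩ʳ next i)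

IsOPT-TSP : ∀ {n} → Matrix n → ℝ → Set
IsOPT-TSP D = IsMinimum U (tourCost D)

record Feasible₁ n (Y : Matrix (n ℕ.* n)) : Set where
  field
    symmetric   : Symmetric Y
    nonNegative : EntrywiseNonNegative Y
    psd         : PositiveSemidefinite Y
    trace-I⊗E   : ∀ j → trace ((I n ⊗ E n j) · Y) ≈ 1ℝ
    trace-E⊗I   : ∀ j → trace ((E n j ⊗ I n) · Y) ≈ 1ℝ
    trace-off   : trace ((I n ⊗ (J n ⊟ I n) ⊞ (J n ⊟ I n) ⊗ I n) · Y) ≈ 0ℝ
    trace-J     : trace (J (n ℕ.* n) · Y) ≈ fromℕ (n ℕ.* n)

objective₁ : ∀ {n} → Matrix n → Matrix (n ℕ.* n) → ℝ
objective₁ {n} D Y = fromℚ ½ * trace ((D ⊗ C₁ n) · Y)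

IsOPT-SDP₁ : ∀ {n} → Matrix n → ℝ → Set
IsOPT-SDP₁ {n} D = IsMinimum (Feasible₁ n) (objective₁ D)

{-# OPTIONS --safe #-}
module Submission where

-- Let n = 2h and let D be the cut metric of two clusters of h vertices each, at
-- distance 1 from each other. A tour has to cross between the clusters twice, so
-- OPT_TSP = 2. The optimum of SDP₁ is exactly (n / 2) (1 - cos (2π/n)) = O(1 / n),
-- because the adjacency matrix of the cycle is a combination of the kernels
-- cos (2πj(p - q)/n) with coefficients cos (2πj/n), and a feasible Y restricted to
-- the cut direction u has no component at frequency j = 0, where the coefficient
-- would exceed cos (2π/n). Taking n = 2^(m+2), the cosines are iterated square
-- roots given by the half-angle formulas.

open import Algebra.Bundles using (CommutativeRing)
open import Algebra.Solver.Ring.AlmostCommutativeRing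
  using (fromCommutativeRing; _-Raw-AlmostCommutative⟶_)
open import Data.Bool.Base using (Bool; true; false)
open import Data.Fin.Base
  using (Fin; zero; suc; toℕ; fromℕ<; quotient; remainder; combine; _↑ˡ_; _↑ʳ_)
open import Data.Fin.Permutation as Perm using (_⟨$⟩ʳ_; _⟨$⟩ˡ_)
import Data.Fin.Properties as Fin
open import Data.Integer.Base as ℤ using (+_)
import Data.Integer.Properties as ℤ
import Data.Maybe.Base as Maybe
open import Data.Nat.Base as ℕ using (ℕ; zero; suc)
open import Data.Nat.DivMod as ℕ using (_%_; _/_)
import Data.Nat.Properties as ℕ
open import Data.Product.Base using (∃; Σ-syntax; ∃-syntax; _×_; _,_; proj₁; proj₂)
open import Data.Rational.Base as ℚ using (ℚ; 0ℚ; 1ℚ; ½)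
import Data.Rational.Properties as ℚ
import Data.Rational.Solver as ℚ-Solver
open import Data.Sum.Base using (_⊎_; inj₁; inj₂)
open import Data.Unit.Base using (tt)
open import Defs
open import Function.Base using (_∘_)
open import Level using (0ℓ)
open import Relation.Binary.Definitions using (tri<; tri≈; tri>)
open import Relation.Binary.PropositionalEquality as ≡
  using (_≡_; _≢_; refl; cong; cong₂; subst; subst₂)
open import Relation.Nullary.Decidable using (yes; no; does; dec-true; dec-false; dec⇒maybe)
open import Relation.Nullary.Negation using (contradiction)

-- `IsOPT-SDP₁` asks for a minimum that is attained, so an O(1 / n) upper bound alone would not do:
-- the value needs a closed form, reached by an explicit feasible matrix and matched by a bound for
-- every feasible one. That bound is a duality argument. The cut metric is ½ (`J` - `U`) with `U`
-- the rank-one matrix of the cut vector u, so the objective splits into two pairings with the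
-- cycle. Each is estimated by weighting the frequencies with an affine function of their cosines,
-- which leaves only quantities fixed by the constraints. For `U` the weight at frequency 0 has the
-- wrong sign; the projection orthogonal to the all-ones vector and u, being semidefinite, shows
-- that the component there is at most 0. The explicit matrix follows the same splitting: all-ones
-- goes with frequency 0, u with frequency 1, the rest with the rest. The relative weight n - 2 is
-- the one that makes the forbidden entries vanish.

-- Eventual estimates: equality and order of Cauchy reals

zipEventually : ∀ {P Q R : ℕ → Set} → (∀ n → P n → Q n → R n) →
  Eventually P → Eventually Q → Eventually R
zipEventually f (M , p) (N , q) = M ℕ.⊔ N , λ n le →
  f n (p n (ℕ.m⊔n≤o⇒m≤o M N le)) (q n (ℕ.m⊔n≤o⇒n≤o M N le))

mapEventually : ∀ {P Q : ℕ → Set} → (∀ n → P n → Q n) →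
  Eventually P → Eventually Q
mapEventually f (N , p) = N , λ n le → f n (p n le)

always : ∀ {P : ℕ → Set} → (∀ n → P n) → Eventually P
always p = 0 , λ n _ → p n

half : ∀ ε → 0ℚ ℚ.< ε → ∃ λ δ → 0ℚ ℚ.< δ × δ ℚ.+ δ ≡ ε
half ε 0<ε = ½ ℚ.* ε ,
  subst (ℚ._< ½ ℚ.* ε) (ℚ.*-zeroʳ ½) (ℚ.*-monoʳ-<-pos ½ 0<ε) ,
  ≡.trans (≡.sym (ℚ.*-distribʳ-+ ε ½ ½)) (ℚ.*-identityˡ ε)

divide : ∀ {B} ε → 0ℚ ℚ.< B → 0ℚ ℚ.< ε → ∃ λ δ → 0ℚ ℚ.< δ × B ℚ.* δ ≡ ε
divide {B} ε 0<B 0<ε = δ , 0<δ , Bδ≡ε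
  where
  instance
    _ = ℚ.positive 0<B
    _ = ℚ.pos⇒nonZero B
  δ = ℚ.1/ B ℚ.* ε
  Bδ≡ε = ≡.trans (≡.sym (ℚ.*-assoc B (ℚ.1/ B) ε))
    (≡.trans (cong (ℚ._* ε) (ℚ.*-inverseʳ B)) (ℚ.*-identityˡ ε))
  0<δ = ℚ.*-cancelˡ-<-nonNeg B {{ℚ.pos⇒nonNeg B}}
    (subst₂ ℚ._<_ (≡.sym (ℚ.*-zeroʳ B)) (≡.sym Bδ≡ε) 0<ε)

p≤∣p∣ : ∀ p → p ℚ.≤ ℚ.∣ p ∣
p≤∣p∣ p with ℚ.≤-total 0ℚ p
... | inj₁ 0≤p = ℚ.≤-reflexive (≡.sym (ℚ.0≤p⇒∣p∣≡p 0≤p))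
... | inj₂ p≤0 = ℚ.≤-trans p≤0 (ℚ.0≤∣p∣ p)

module _ where
  open ℚ-Solver.+-*-Solver

  ∣p-q∣≡∣q-p∣ : ∀ p q → ℚ.∣ p ℚ.- q ∣ ≡ ℚ.∣ q ℚ.- p ∣
  ∣p-q∣≡∣q-p∣ p q = ≡.trans (≡.sym (ℚ.∣-p∣≡∣p∣ (p ℚ.- q)))
    (cong ℚ.∣_∣ (solve 2 (λ p q → :- (p :- q) := q :- p) refl p q))

  ∣p∣-triangle : ∀ p q r → ℚ.∣ p ℚ.- r ∣ ℚ.≤ ℚ.∣ p ℚ.- q ∣ ℚ.+ ℚ.∣ q ℚ.- r ∣
  ∣p∣-triangle p q r = subst (λ d → ℚ.∣ d ∣ ℚ.≤ ℚ.∣ p ℚ.- q ∣ ℚ.+ ℚ.∣ q ℚ.- r ∣)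
    (solve 3 (λ p q r → (p :- q) :+ (q :- r) := p :- r) refl p q r)
    (ℚ.∣p+q∣≤∣p∣+∣q∣ (p ℚ.- q) (q ℚ.- r))

  ∣p*q∣<B*δ : ∀ {B δ} p q → 0ℚ ℚ.< B → ℚ.∣ p ∣ ℚ.≤ B → ℚ.∣ q ∣ ℚ.< δ →
    ℚ.∣ p ℚ.* q ∣ ℚ.< B ℚ.* δ
  ∣p*q∣<B*δ {B} {δ} p q 0<B p≤B q<δ = begin-strict
    ℚ.∣ p ℚ.* q ∣          ≡⟨ ℚ.∣p*q∣≡∣p∣*∣q∣ p q ⟩
    ℚ.∣ p ∣ ℚ.* ℚ.∣ q ∣    ≤⟨ ℚ.*-monoʳ-≤-nonNeg ℚ.∣ q ∣ {{ℚ.nonNegative (ℚ.0≤∣p∣ q)}} p≤B ⟩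
    B ℚ.* ℚ.∣ q ∣          <⟨ ℚ.*-monoʳ-<-pos B {{ℚ.positive 0<B}} q<δ ⟩
    B ℚ.* δ                ∎
    where open ℚ.≤-Reasoning

  bounded : ∀ x → ∃ λ B → 0ℚ ℚ.< B × Eventually λ n → ℚ.∣ seq x n ∣ ℚ.≤ B
  bounded x with cauchy x 1ℚ (ℚ.positive⁻¹ 1ℚ)
  ... | N , close =
    1ℚ ℚ.+ ℚ.∣ seq x N ∣ ,
    ℚ.+-mono-<-≤ (ℚ.positive⁻¹ 1ℚ) (ℚ.0≤∣p∣ (seq x N)) ,
    N , λ n N≤n → begin
      ℚ.∣ seq x n ∣                                   ≡⟨ cong ℚ.∣_∣ (ℚ.+-identityʳ (seq x n)) ⟨
      ℚ.∣ seq x n ℚ.- 0ℚ ∣                            ≤⟨ ∣p∣-triangle (seq x n) (seq x N) 0ℚ ⟩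
      ℚ.∣ seq x n ℚ.- seq x N ∣ ℚ.+ ℚ.∣ seq x N ℚ.- 0ℚ ∣
        ≤⟨ ℚ.+-mono-≤ (ℚ.<⇒≤ (close n N N≤n ℕ.≤-refl)) (ℚ.≤-reflexive (cong ℚ.∣_∣ (ℚ.+-identityʳ (seq x N)))) ⟩
      1ℚ ℚ.+ ℚ.∣ seq x N ∣                            ∎
    where open ℚ.≤-Reasoning

  ≗⇒≈ : ∀ {x y} → (∀ n → seq x n ≡ seq y n) → x ≈ y
  ≗⇒≈ {x} {y} eq = mk≈ λ ε 0<ε → always λ n →
    subst (λ d → ℚ.∣ d ∣ ℚ.< ε)
      (≡.sym (≡.trans (cong (ℚ._- seq y n) (eq n)) (ℚ.+-inverseʳ (seq y n)))) 0<ε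

  ≈-refl : ∀ {x} → x ≈ x
  ≈-refl = ≗⇒≈ λ _ → refl

  ≡⇒≈ : ∀ {x y} → x ≡ y → x ≈ y
  ≡⇒≈ refl = ≈-refl

  ≈-sym : ∀ {x y} → x ≈ y → y ≈ x
  ≈-sym {x} {y} (mk≈ p) = mk≈ λ ε 0<ε →
    mapEventually (λ n → subst (ℚ._< ε) (∣p-q∣≡∣q-p∣ (seq x n) (seq y n))) (p ε 0<ε)

  ≈-trans : ∀ {x y z} → x ≈ y → y ≈ z → x ≈ z
  ≈-trans {x} {y} {z} (mk≈ p) (mk≈ q) = mk≈ λ ε 0<ε →
    let δ , 0<δ , δ+δ≡ε = half ε 0<ε in
    zipEventually (λ n a b → ℚ.≤-<-trans (∣p∣-triangle (seq x n) (seq y n) (seq z n))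
      (subst (_ ℚ.<_) δ+δ≡ε (ℚ.+-mono-< a b))) (p δ 0<δ) (q δ 0<δ)

  +-cong : ∀ {x y u v} → x ≈ y → u ≈ v → x + u ≈ y + v
  +-cong {x} {y} {u} {v} (mk≈ p) (mk≈ q) = mk≈ λ ε 0<ε →
    let δ , 0<δ , δ+δ≡ε = half ε 0<ε in
    zipEventually (λ n a b → subst₂ (λ l r → ℚ.∣ l ∣ ℚ.< r)
        (solve 4 (λ x y u v → (x :- y) :+ (u :- v) := (x :+ u) :- (y :+ v)) refl
          (seq x n) (seq y n) (seq u n) (seq v n))
        δ+δ≡ε
        (ℚ.≤-<-trans (ℚ.∣p+q∣≤∣p∣+∣q∣ (seq x n ℚ.- seq y n) (seq u n ℚ.- seq v n))
          (ℚ.+-mono-< a b)))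
      (p δ 0<δ) (q δ 0<δ)

  -- A Cauchy sequence is bounded, so it suffices to bring `y` and `z` within ε divided by a bound
  -- for `x`.
  *-congˡ : ∀ {x y z} → y ≈ z → x * y ≈ x * z
  *-congˡ {x} {y} {z} (mk≈ p) = mk≈ λ ε 0<ε →
    let B , 0<B , x≤B = bounded x
        δ , 0<δ , Bδ≡ε = divide ε 0<B 0<ε in
    zipEventually (λ n a b → subst₂ (λ l r → ℚ.∣ l ∣ ℚ.< r)
        (solve 3 (λ x y z → x :* (y :- z) := x :* y :- x :* z) refl
          (seq x n) (seq y n) (seq z n))
        Bδ≡ε
        (∣p*q∣<B*δ (seq x n) (seq y n ℚ.- seq z n) 0<B a b))
      x≤B (p δ 0<δ)

  *-comm : ∀ x y → x * y ≈ y * x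
  *-comm x y = ≗⇒≈ λ n → ℚ.*-comm (seq x n) (seq y n)

  *-cong : ∀ {x y u v} → x ≈ y → u ≈ v → x * u ≈ y * v
  *-cong {x} {y} {u} {v} p q = ≈-trans (*-congˡ q)
    (≈-trans (*-comm x v) (≈-trans (*-congˡ p) (*-comm v y)))

  -‿cong : ∀ {x y} → x ≈ y → - x ≈ - y
  -‿cong {x} {y} (mk≈ p) = mk≈ λ ε 0<ε → mapEventually (λ n → subst (ℚ._< ε)
      (≡.trans (∣p-q∣≡∣q-p∣ (seq x n) (seq y n)) (cong ℚ.∣_∣
        (solve 2 (λ x y → y :- x := (:- x) :- (:- y)) refl (seq x n) (seq y n)))))
    (p ε 0<ε)

  ≈⇒≤ : ∀ {x y} → x ≈ y → x ≤ y
  ≈⇒≤ {x} {y} (mk≈ p) = mk≤ λ ε 0<ε → mapEventually (λ n a → subst₂ ℚ._<_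
      (solve 2 (λ x y → (x :- y) :+ y := x) refl (seq x n) (seq y n))
      (ℚ.+-comm ε (seq y n))
      (ℚ.+-monoˡ-< (seq y n) (ℚ.≤-<-trans (p≤∣p∣ (seq x n ℚ.- seq y n)) a))) (p ε 0<ε)

  ≤-pointwise : ∀ {x y} → (∀ n → seq x n ℚ.≤ seq y n) → x ≤ y
  ≤-pointwise {x} {y} p = mk≤ λ ε 0<ε → always λ n →
    subst (ℚ._< seq y n ℚ.+ ε) (ℚ.+-identityʳ (seq x n)) (ℚ.+-mono-≤-< (p n) 0<ε)

  ≤-trans : ∀ {x y z} → x ≤ y → y ≤ z → x ≤ z
  ≤-trans {x} {y} {z} (mk≤ p) (mk≤ q) = mk≤ λ ε 0<ε →
    let δ , 0<δ , δ+δ≡ε = half ε 0<ε in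
    zipEventually (λ n a b → ℚ.<-trans a (subst (seq y n ℚ.+ δ ℚ.<_)
      (≡.trans (ℚ.+-assoc (seq z n) δ δ) (cong (seq z n ℚ.+_) δ+δ≡ε))
      (ℚ.+-monoˡ-< δ b))) (p δ 0<δ) (q δ 0<δ)

  ≤-antisym : ∀ {x y} → x ≤ y → y ≤ x → x ≈ y
  ≤-antisym {x} {y} (mk≤ p) (mk≤ q) = mk≈ λ ε 0<ε →
    zipEventually (λ n a b → close (seq x n) (seq y n) a b) (p ε 0<ε) (q ε 0<ε)
    where
    less : ∀ {ε} p q → p ℚ.< q ℚ.+ ε → p ℚ.- q ℚ.< ε
    less {ε} p q lt = subst (p ℚ.- q ℚ.<_) (solve 2 (λ q e → (q :+ e) :- q := e) refl q ε)
      (ℚ.+-monoˡ-< (ℚ.- q) lt)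
    close : ∀ {ε} p q → p ℚ.< q ℚ.+ ε → q ℚ.< p ℚ.+ ε → ℚ.∣ p ℚ.- q ∣ ℚ.< ε
    close {ε} p q a b with ℚ.∣p∣≡p∨∣p∣≡-p (p ℚ.- q)
    ... | inj₁ eq = subst (ℚ._< ε) (≡.sym eq) (less p q a)
    ... | inj₂ eq = subst (ℚ._< ε)
      (≡.trans (solve 2 (λ p q → q :- p := con 0ℚ :- (p :- q)) refl p q)
        (≡.trans (ℚ.+-identityˡ _) (≡.sym eq))) (less q p b)

  +-mono-≤ : ∀ {x y u v} → x ≤ y → u ≤ v → x + u ≤ y + v
  +-mono-≤ {x} {y} {u} {v} (mk≤ p) (mk≤ q) = mk≤ λ ε 0<ε →
    let δ , 0<δ , δ+δ≡ε = half ε 0<ε in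
    zipEventually (λ n a b → subst (seq x n ℚ.+ seq u n ℚ.<_)
      (≡.trans (solve 3 (λ y v d → (y :+ d) :+ (v :+ d) := (y :+ v) :+ (d :+ d)) refl
        (seq y n) (seq v n) δ) (cong (seq y n ℚ.+ seq v n ℚ.+_) δ+δ≡ε))
      (ℚ.+-mono-< a b)) (p δ 0<δ) (q δ 0<δ)

-- The Archimedean property and geometric decay

-- Normalised fractions do not compute on an open numerator, so the identity is checked on
-- unnormalised rationals.
ℕ/1-suc : ∀ n → + suc n ℚ./ 1 ≡ 1ℚ ℚ.+ + n ℚ./ 1
ℕ/1-suc n = ℚ.toℚᵘ-injective (toℚᵘ-suc n)
  where
  open import Data.Rational.Unnormalised.Base as ℚᵘ using (mkℚᵘ; *≡*)
  import Data.Rational.Unnormalised.Properties as ℚᵘ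
  toℚᵘ-suc : ∀ n → ℚ.toℚᵘ (+ suc n ℚ./ 1) ℚᵘ.≃ ℚ.toℚᵘ (1ℚ ℚ.+ + n ℚ./ 1)
  toℚᵘ-suc n = ℚᵘ.≃-trans (ℚ.toℚᵘ-fromℚᵘ (mkℚᵘ (+ suc n) 0)) (ℚᵘ.≃-sym (ℚᵘ.≃-trans
    (ℚ.toℚᵘ-homo-+ 1ℚ (+ n ℚ./ 1))
    (ℚᵘ.≃-trans (ℚᵘ.+-congʳ (ℚ.toℚᵘ 1ℚ) (ℚ.toℚᵘ-fromℚᵘ (mkℚᵘ (+ n) 0)))
      (*≡* (≡.trans (ℤ.*-identityʳ _)
        (≡.trans (cong (ℤ._+_ (+ 1)) (ℤ.*-identityʳ (+ n))) (≡.sym (ℤ.*-identityʳ (+ suc n)))))))))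

-- The numerator is a bound because the denominator is at least 1; a negative rational is bounded by
-- 0.
archimedean : ∀ p → ∃ λ k → p ℚ.≤ + k ℚ./ 1
archimedean (ℚ.mkℚ (+ k) d _) = k , ℚ.toℚᵘ-cancel-≤
  (ℚᵘ.≤-respʳ-≃ (ℚᵘ.≃-sym (ℚ.toℚᵘ-fromℚᵘ (ℚᵘ.mkℚᵘ (+ k) 0)))
    (ℚᵘ.*≤* (subst₂ ℤ._≤_ (ℤ.pos-* k 1) (ℤ.pos-* k (suc d))
      (ℤ.+≤+ (ℕ.*-monoʳ-≤ k {1} {suc d} (ℕ.s≤s ℕ.z≤n))))))
  where
  import Data.Rational.Unnormalised.Base as ℚᵘ
  import Data.Rational.Unnormalised.Properties as ℚᵘ
archimedean p@(ℚ.mkℚ (ℤ.-[1+ _ ]) _ _) = 0 , ℚ.<⇒≤ (ℚ.negative⁻¹ p)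

module _ where
  open ℚ-Solver.+-*-Solver

  ℚ-0≤p*q : ∀ {p q} → 0ℚ ℚ.≤ p → 0ℚ ℚ.≤ q → 0ℚ ℚ.≤ p ℚ.* q
  ℚ-0≤p*q {p} {q} 0≤p 0≤q = subst (ℚ._≤ p ℚ.* q) (ℚ.*-zeroʳ p)
    (ℚ.*-monoˡ-≤-nonNeg p {{ℚ.nonNegative 0≤p}} 0≤q)

  ℚ-0≤p+q : ∀ {p q} → 0ℚ ℚ.≤ p → 0ℚ ℚ.≤ q → 0ℚ ℚ.≤ p ℚ.+ q
  ℚ-0≤p+q {p} {q} 0≤p 0≤q = subst (ℚ._≤ p ℚ.+ q) (ℚ.+-identityˡ 0ℚ) (ℚ.+-mono-≤ 0≤p 0≤q)

  ℚ-0≤q-p : ∀ {p q} → p ℚ.≤ q → 0ℚ ℚ.≤ q ℚ.- p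
  ℚ-0≤q-p {p} {q} p≤q = subst (ℚ._≤ q ℚ.- p) (ℚ.+-inverseʳ p) (ℚ.+-monoˡ-≤ (ℚ.- p) p≤q)

  ℚ-p≤q : ∀ {p q} → 0ℚ ℚ.≤ q ℚ.- p → p ℚ.≤ q
  ℚ-p≤q {p} {q} le = subst₂ ℚ._≤_ (ℚ.+-identityˡ p)
    (solve 2 (λ p q → (q :- p) :+ p := q) refl p q) (ℚ.+-monoˡ-≤ p le)

  0≤½ℚ : 0ℚ ℚ.≤ ½
  0≤½ℚ = ℚ.nonNegative⁻¹ ½

  ½^_ : ℕ → ℚ
  ½^ zero  = 1ℚ
  ½^ suc k = ½ ℚ.* ½^ k

  -- (1 + k) ½^(1 + k) is the mean of ½^k and k ½^k, which is why the bound ½^k ≤ 1 is carried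
  -- through the induction.
  k*½^k≤1 : ∀ k → 0ℚ ℚ.≤ ½^ k × ½^ k ℚ.≤ 1ℚ × (+ k ℚ./ 1) ℚ.* ½^ k ℚ.≤ 1ℚ
  k*½^k≤1 zero    = ℚ.nonNegative⁻¹ 1ℚ , ℚ.≤-refl , ℚ.nonNegative⁻¹ 1ℚ
  k*½^k≤1 (suc k) = let 0≤a , a≤1 , ka≤1 = k*½^k≤1 k ; a = ½^ k ; κ = + k ℚ./ 1 in
    ℚ-0≤p*q 0≤½ℚ 0≤a ,
    ℚ-p≤q (subst (0ℚ ℚ.≤_)
      (solve 1 (λ a → con ½ :* (con 1ℚ :- a) :+ con ½ := con 1ℚ :- con ½ :* a) refl a)
      (ℚ-0≤p+q (ℚ-0≤p*q 0≤½ℚ (ℚ-0≤q-p a≤1)) 0≤½ℚ)) ,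
    ℚ-p≤q (subst (0ℚ ℚ.≤_)
      (≡.trans
        (solve 2 (λ a κ → con ½ :* (con 1ℚ :- a) :+ con ½ :* (con 1ℚ :- κ :* a) :=
          con 1ℚ :- (con 1ℚ :+ κ) :* (con ½ :* a)) refl a κ)
        (cong (λ r → 1ℚ ℚ.- r ℚ.* (½ ℚ.* a)) (≡.sym (ℕ/1-suc k))))
      (ℚ-0≤p+q (ℚ-0≤p*q 0≤½ℚ (ℚ-0≤q-p a≤1)) (ℚ-0≤p*q 0≤½ℚ (ℚ-0≤q-p ka≤1))))

  ½^k<ε : ∀ ε → 0ℚ ℚ.< ε → ∃ λ k → ½^ k ℚ.< ε
  ½^k<ε ε 0<ε = k , ℚ.*-cancelˡ-<-nonNeg κ {{ℚ.nonNegative (ℚ.<⇒≤ 0<κ)}}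
    (ℚ.≤-<-trans (proj₂ (proj₂ (k*½^k≤1 k)))
      (subst (ℚ._< κ ℚ.* ε) (≡.trans (ℚ.*-comm δ ε) εδ≡1) (ℚ.*-monoˡ-<-pos ε {{ℚ.positive 0<ε}} δ<κ)))
    where
    D = divide 1ℚ 0<ε (ℚ.positive⁻¹ 1ℚ)
    δ = proj₁ D
    0<δ = proj₁ (proj₂ D)
    εδ≡1 = proj₂ (proj₂ D)
    A = archimedean δ
    -- `δ` is 1 / ε; the successor makes `κ` strictly larger.
    k = suc (proj₁ A)
    κ = + k ℚ./ 1
    δ<κ : δ ℚ.< κ
    δ<κ = ℚ.≤-<-trans (proj₂ A) (subst₂ ℚ._<_ (ℚ.+-identityˡ _) (≡.sym (ℕ/1-suc (proj₁ A)))
      (ℚ.+-monoˡ-< (+ proj₁ A ℚ./ 1) (ℚ.positive⁻¹ 1ℚ)))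
    0<κ = ℚ.<-trans 0<δ δ<κ

  -- Square roots and quotients as limits of contractions

  -- The error bound evolves by e ↦ ½ e + ½ δ, whose fixed point is δ, so k steps from a gap of at
  -- most 1 leave at most ½^k + δ. The term ½ δ absorbs the drift of the data, which at stage n are
  -- themselves only approximations.
  contraction⇒cauchy : ∀ (z : ℕ → ℚ) → (∀ m n → ℚ.∣ z m ℚ.- z n ∣ ℚ.≤ 1ℚ) →
    (∀ δ → 0ℚ ℚ.< δ → ∃ λ N → ∀ m n → N ℕ.≤ m → N ℕ.≤ n →
      ℚ.∣ z (suc m) ℚ.- z (suc n) ∣ ℚ.≤ ½ ℚ.* ℚ.∣ z m ℚ.- z n ∣ ℚ.+ ½ ℚ.* δ) →
    IsCauchy z
  contraction⇒cauchy z bound contract ε 0<ε =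
    let δ , 0<δ , δ+δ≡ε = half ε 0<ε
        k , a<δ = ½^k<ε δ 0<δ
        N , step = contract δ 0<δ
        iterate = λ k m n → go δ N step k m n (ℚ.<⇒≤ 0<δ)
    in k ℕ.+ N , λ m n p q → subst₂ (λ i j → ℚ.∣ z i ℚ.- z j ∣ ℚ.< ε)
      (ℕ.m+[n∸m]≡n (ℕ.≤-trans (ℕ.m≤m+n k N) p)) (ℕ.m+[n∸m]≡n (ℕ.≤-trans (ℕ.m≤m+n k N) q))
      (ℚ.≤-<-trans (iterate k (m ℕ.∸ k) (n ℕ.∸ k) (ℕ.m+n≤o⇒m≤o∸n N (subst (ℕ._≤ m) (ℕ.+-comm k N) p))
          (ℕ.m+n≤o⇒m≤o∸n N (subst (ℕ._≤ n) (ℕ.+-comm k N) q)))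
        (subst (½^ k ℚ.+ δ ℚ.<_) δ+δ≡ε (ℚ.+-monoˡ-< δ a<δ)))
    where
    go : ∀ δ N → (∀ m n → N ℕ.≤ m → N ℕ.≤ n →
        ℚ.∣ z (suc m) ℚ.- z (suc n) ∣ ℚ.≤ ½ ℚ.* ℚ.∣ z m ℚ.- z n ∣ ℚ.+ ½ ℚ.* δ) →
      ∀ k m n → 0ℚ ℚ.≤ δ → N ℕ.≤ m → N ℕ.≤ n → ℚ.∣ z (k ℕ.+ m) ℚ.- z (k ℕ.+ n) ∣ ℚ.≤ ½^ k ℚ.+ δ
    go δ N step zero    m n 0≤δ p q = ℚ.≤-trans (bound m n)
      (subst (ℚ._≤ 1ℚ ℚ.+ δ) (ℚ.+-identityʳ 1ℚ) (ℚ.+-monoʳ-≤ 1ℚ 0≤δ))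
    go δ N step (suc k) m n 0≤δ p q = ℚ.≤-trans
      (step (k ℕ.+ m) (k ℕ.+ n) (ℕ.≤-trans p (ℕ.m≤n+m m k)) (ℕ.≤-trans q (ℕ.m≤n+m n k)))
      (subst (½ ℚ.* ℚ.∣ z (k ℕ.+ m) ℚ.- z (k ℕ.+ n) ∣ ℚ.+ ½ ℚ.* δ ℚ.≤_)
        (solve 2 (λ a d → con ½ :* (a :+ d) :+ con ½ :* d := con ½ :* a :+ d) refl (½^ k) δ)
        (ℚ.+-monoˡ-≤ (½ ℚ.* δ) (ℚ.*-monoˡ-≤-nonNeg ½ (go δ N step k m n 0≤δ p q))))

  -- The bound is on every term of the sequence, not on the real that it represents: the iterations
  -- below compute termwise and need it at each step.
  InUnitInterval : (ℕ → ℚ) → Set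
  InUnitInterval x = ∀ n → 0ℚ ℚ.≤ x n × x n ℚ.≤ 1ℚ

  unitInterval-bounded : ∀ {x} → InUnitInterval x → ∀ m n → ℚ.∣ x m ℚ.- x n ∣ ℚ.≤ 1ℚ
  unitInterval-bounded {x} b m n with ℚ.∣p∣≡p∨∣p∣≡-p (x m ℚ.- x n)
  ... | inj₁ eq = subst (ℚ._≤ 1ℚ) (≡.sym eq) (ℚ-p≤q (subst (0ℚ ℚ.≤_)
    (solve 2 (λ p q → (con 1ℚ :- p) :+ q := con 1ℚ :- (p :- q)) refl (x m) (x n))
    (ℚ-0≤p+q (ℚ-0≤q-p (proj₂ (b m))) (proj₁ (b n)))))
  ... | inj₂ eq = subst (ℚ._≤ 1ℚ) (≡.sym eq) (ℚ-p≤q (subst (0ℚ ℚ.≤_)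
    (solve 2 (λ p q → (con 1ℚ :- q) :+ p := con 1ℚ :- (:- (p :- q))) refl (x m) (x n))
    (ℚ-0≤p+q (ℚ-0≤q-p (proj₂ (b n))) (proj₁ (b m)))))

  -- A limit of z (1 + n) = z n + ½ (x n - y n) solves x ≈ y.
  residual⇒≈ : ∀ {x y} (z : ℝ) →
    (∀ n → seq z (suc n) ≡ seq z n ℚ.+ ½ ℚ.* (seq x n ℚ.- seq y n)) → x ≈ y
  residual⇒≈ {x} {y} z eq = mk≈ λ ε 0<ε →
    let δ , 0<δ , δ+δ≡ε = half ε 0<ε
        N , close = cauchy z δ 0<δ
    in N , λ n N≤n → subst₂ (λ l r → ℚ.∣ l ∣ ℚ.< r)
      (≡.trans (cong (λ w → (w ℚ.- seq z n) ℚ.+ (w ℚ.- seq z n)) (eq n))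
        (solve 2 (λ z d → ((z :+ con ½ :* d) :- z) :+ ((z :+ con ½ :* d) :- z) := d) refl
          (seq z n) (seq x n ℚ.- seq y n)))
      δ+δ≡ε
      (ℚ.≤-<-trans (ℚ.∣p+q∣≤∣p∣+∣q∣ (seq z (suc n) ℚ.- seq z n) (seq z (suc n) ℚ.- seq z n))
        (ℚ.+-mono-< (close (suc n) n (ℕ.m≤n⇒m≤1+n N≤n) N≤n) (close (suc n) n (ℕ.m≤n⇒m≤1+n N≤n) N≤n)))

  ∣p*q∣≤½*∣p∣ : ∀ p q → 0ℚ ℚ.≤ q → q ℚ.≤ ½ → ℚ.∣ p ℚ.* q ∣ ℚ.≤ ½ ℚ.* ℚ.∣ p ∣
  ∣p*q∣≤½*∣p∣ p q 0≤q q≤½ = subst₂ ℚ._≤_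
    (≡.trans (cong (ℚ.∣ p ∣ ℚ.*_) (≡.sym (ℚ.0≤p⇒∣p∣≡p 0≤q))) (≡.sym (ℚ.∣p*q∣≡∣p∣*∣q∣ p q)))
    (ℚ.*-comm ℚ.∣ p ∣ ½)
    (ℚ.*-monoˡ-≤-nonNeg ℚ.∣ p ∣ {{ℚ.nonNegative (ℚ.0≤∣p∣ p)}} q≤½)

  module SquareRoot (x : ℝ) (½≤x : ∀ n → ½ ℚ.≤ seq x n) (x≤1 : ∀ n → seq x n ℚ.≤ 1ℚ) where

    -- On [½, 1] the map y ↦ y + ½ (x - y²) has derivative 1 - y between 0 and ½, so it contracts
    -- without any division. Stage n reads the nth approximation of `x`.
    approx : ℕ → ℚ
    approx zero    = 1ℚ
    approx (suc n) = approx n ℚ.+ ½ ℚ.* (seq x n ℚ.- approx n ℚ.* approx n)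

    -- Each slack is written as a sum of products of slacks already known to be nonnegative; the
    -- lower one leaves a spare constant 1/8.
    approx-bounds : ∀ n → ½ ℚ.≤ approx n × approx n ℚ.≤ 1ℚ
    approx-bounds zero    = ℚ-p≤q 0≤½ℚ , ℚ.≤-refl
    approx-bounds (suc n) = let ½≤y , y≤1 = approx-bounds n in
      ℚ-p≤q (subst (0ℚ ℚ.≤_)
        (solve 2 (λ x y → (con ½ :* (x :- con ½) :+ con ½ :* ((y :- con ½) :* ((con 1ℚ :- y) :+ con ½))) :+ con (½ ℚ.* (½ ℚ.* ½))
            := (y :+ con ½ :* (x :- y :* y)) :- con ½) refl (seq x n) (approx n))
        (ℚ-0≤p+q (ℚ-0≤p+q (ℚ-0≤p*q 0≤½ℚ (ℚ-0≤q-p (½≤x n)))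
          (ℚ-0≤p*q 0≤½ℚ (ℚ-0≤p*q (ℚ-0≤q-p ½≤y) (ℚ-0≤p+q (ℚ-0≤q-p y≤1) 0≤½ℚ))))
          (ℚ.nonNegative⁻¹ (½ ℚ.* (½ ℚ.* ½))))) ,
      ℚ-p≤q (subst (0ℚ ℚ.≤_)
        (solve 2 (λ x y → con ½ :* ((con 1ℚ :- y) :* (con 1ℚ :- y)) :+ con ½ :* (con 1ℚ :- x)
            := con 1ℚ :- (y :+ con ½ :* (x :- y :* y))) refl (seq x n) (approx n))
        (ℚ-0≤p+q (ℚ-0≤p*q 0≤½ℚ (ℚ-0≤p*q (ℚ-0≤q-p y≤1) (ℚ-0≤q-p y≤1)))
          (ℚ-0≤p*q 0≤½ℚ (ℚ-0≤q-p (x≤1 n)))))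

    approx-unitInterval : InUnitInterval approx
    approx-unitInterval n = ℚ.≤-trans 0≤½ℚ (proj₁ (approx-bounds n)) , proj₂ (approx-bounds n)

    -- Two successors differ by (y - w) (1 - ½ (y + w)) plus half the difference of the data, and
    -- `approx-bounds` puts the factor 1 - ½ (y + w) between 0 and ½.
    contract : ∀ δ → 0ℚ ℚ.< δ → ∃ λ N → ∀ m n → N ℕ.≤ m → N ℕ.≤ n →
      ℚ.∣ approx (suc m) ℚ.- approx (suc n) ∣ ℚ.≤ ½ ℚ.* ℚ.∣ approx m ℚ.- approx n ∣ ℚ.+ ½ ℚ.* δ
    contract δ 0<δ = let N , close = cauchy x δ 0<δ in N , λ m n p q →
      let y = approx m ; w = approx n ; ½≤y , y≤1 = approx-bounds m ; ½≤w , w≤1 = approx-bounds n in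
      ℚ.≤-trans (subst (λ d
          → ℚ.∣ d ∣ ℚ.≤ ℚ.∣ (y ℚ.- w) ℚ.* (1ℚ ℚ.- ½ ℚ.* (y ℚ.+ w)) ∣ ℚ.+ ℚ.∣ ½ ℚ.* (seq x m ℚ.- seq x n) ∣)
        (solve 4 (λ y w a b → (y :- w) :* (con 1ℚ :- con ½ :* (y :+ w)) :+ con ½ :* (a :- b) :=
          (y :+ con ½ :* (a :- y :* y)) :- (w :+ con ½ :* (b :- w :* w))) refl y w (seq x m) (seq x n))
        (ℚ.∣p+q∣≤∣p∣+∣q∣ ((y ℚ.- w) ℚ.* (1ℚ ℚ.- ½ ℚ.* (y ℚ.+ w))) (½ ℚ.* (seq x m ℚ.- seq x n))))
      (ℚ.+-mono-≤
        (∣p*q∣≤½*∣p∣ (y ℚ.- w) _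
          (subst (0ℚ ℚ.≤_) (solve 2 (λ y w → con ½ :* (con 1ℚ :- y) :+ con ½ :* (con 1ℚ :- w) :=
              con 1ℚ :- con ½ :* (y :+ w)) refl y w)
            (ℚ-0≤p+q (ℚ-0≤p*q 0≤½ℚ (ℚ-0≤q-p y≤1)) (ℚ-0≤p*q 0≤½ℚ (ℚ-0≤q-p w≤1))))
          (ℚ-p≤q (subst (0ℚ ℚ.≤_) (solve 2 (λ y w → con ½ :* (y :- con ½) :+ con ½ :* (w :- con ½) :=
              con ½ :- (con 1ℚ :- con ½ :* (y :+ w))) refl y w)
            (ℚ-0≤p+q (ℚ-0≤p*q 0≤½ℚ (ℚ-0≤q-p ½≤y)) (ℚ-0≤p*q 0≤½ℚ (ℚ-0≤q-p ½≤w))))))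
        (ℚ.≤-trans (ℚ.≤-reflexive (ℚ.∣p*q∣≡∣p∣*∣q∣ ½ (seq x m ℚ.- seq x n)))
          (ℚ.*-monoˡ-≤-nonNeg ½ (ℚ.<⇒≤ (close m n p q)))))

    √x : ℝ
    √x .seq    = approx
    √x .cauchy = contraction⇒cauchy approx (unitInterval-bounded {approx} approx-unitInterval) contract

    √x-square : √x * √x ≈ x
    √x-square = ≈-sym (residual⇒≈ √x λ _ → refl)

  module HalfQuotient (y s : ℝ) (½≤y : ∀ n → ½ ℚ.≤ seq y n) (y≤1 : ∀ n → seq y n ℚ.≤ 1ℚ)
    (s-bounds : InUnitInterval (seq s)) where

    -- Solves 2 y w = s without dividing: the step is w ↦ (1 - y) w + ½ s, which contracts by 1 - y
    -- ≤ ½ and, since s ≤ 1, keeps w in the unit interval.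
    approx : ℕ → ℚ
    approx zero    = 0ℚ
    approx (suc n) = approx n ℚ.+ ½ ℚ.* (seq s n ℚ.- (seq y n ℚ.* approx n ℚ.+ seq y n ℚ.* approx n))

    1-y≤½ : ∀ n → 1ℚ ℚ.- seq y n ℚ.≤ ½
    1-y≤½ n = ℚ-p≤q (subst (0ℚ ℚ.≤_)
      (solve 1 (λ y → y :- con ½ := con ½ :- (con 1ℚ :- y)) refl (seq y n)) (ℚ-0≤q-p (½≤y n)))

    approx-unitInterval : InUnitInterval approx
    approx-unitInterval zero    = ℚ.≤-refl , ℚ.nonNegative⁻¹ 1ℚ
    approx-unitInterval (suc n) = let 0≤w , w≤1 = approx-unitInterval n ; 0≤s , s≤1 = s-bounds n in
      subst (0ℚ ℚ.≤_)
        (solve 3 (λ y s w → w :* (con 1ℚ :- y) :+ con ½ :* s := w :+ con ½ :* (s :- (y :* w :+ y :* w))) refl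
          (seq y n) (seq s n) (approx n))
        (ℚ-0≤p+q (ℚ-0≤p*q 0≤w (ℚ-0≤q-p (y≤1 n))) (ℚ-0≤p*q 0≤½ℚ 0≤s)) ,
      ℚ-p≤q (subst (0ℚ ℚ.≤_)
        (solve 3 (λ y s w → ((con 1ℚ :- w) :* (con 1ℚ :- y) :+ con ½ :* (con 1ℚ :- s)) :+ (y :- con ½)
          := con 1ℚ :- (w :+ con ½ :* (s :- (y :* w :+ y :* w)))) refl (seq y n) (seq s n) (approx n))
        (ℚ-0≤p+q (ℚ-0≤p+q (ℚ-0≤p*q (ℚ-0≤q-p w≤1) (ℚ-0≤q-p (y≤1 n))) (ℚ-0≤p*q 0≤½ℚ (ℚ-0≤q-p s≤1)))
          (ℚ-0≤q-p (½≤y n))))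

    contract : ∀ δ → 0ℚ ℚ.< δ → ∃ λ N → ∀ m n → N ℕ.≤ m → N ℕ.≤ n →
      ℚ.∣ approx (suc m) ℚ.- approx (suc n) ∣ ℚ.≤ ½ ℚ.* ℚ.∣ approx m ℚ.- approx n ∣ ℚ.+ ½ ℚ.* δ
    contract δ 0<δ =
      -- `η` = δ / 2 serves `s` and `θ` = δ / 4 serves `y`: the two errors enter with weights ½ and
      -- at most 1, and ½ η + θ = ½ δ.
      let η , 0<η , η+η≡δ = half δ 0<δ
          θ , 0<θ , θ+θ≡η = half η 0<η
          M , closeˢ = cauchy s η 0<η
          N , closeʸ = cauchy y θ 0<θ
      in M ℕ.⊔ N , λ m n p q →
      let v = approx m ; w = approx n ; a = seq y m ; b = seq y n ; e = seq s m ; f = seq s n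
          0≤w , w≤1 = approx-unitInterval n
          cs = closeˢ m n (ℕ.m⊔n≤o⇒m≤o M N p) (ℕ.m⊔n≤o⇒m≤o M N q)
          cy = closeʸ m n (ℕ.m⊔n≤o⇒n≤o M N p) (ℕ.m⊔n≤o⇒n≤o M N q) in
      begin
      ℚ.∣ approx (suc m) ℚ.- approx (suc n) ∣
        ≡⟨ cong ℚ.∣_∣ (solve 6 (λ v w a b e f →
           (v :+ con ½ :* (e :- (a :* v :+ a :* v))) :- (w :+ con ½ :* (f :- (b :* w :+ b :* w))) :=
           (v :- w) :* (con 1ℚ :- a) :+ (con ½ :* (e :- f) :+ w :* (b :- a))) refl v w a b e f) ⟩
      ℚ.∣ (v ℚ.- w) ℚ.* (1ℚ ℚ.- a) ℚ.+ (½ ℚ.* (e ℚ.- f) ℚ.+ w ℚ.* (b ℚ.- a)) ∣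
        ≤⟨ ℚ.∣p+q∣≤∣p∣+∣q∣ ((v ℚ.- w) ℚ.* (1ℚ ℚ.- a)) (½ ℚ.* (e ℚ.- f) ℚ.+ w ℚ.* (b ℚ.- a)) ⟩
      ℚ.∣ (v ℚ.- w) ℚ.* (1ℚ ℚ.- a) ∣ ℚ.+ ℚ.∣ ½ ℚ.* (e ℚ.- f) ℚ.+ w ℚ.* (b ℚ.- a) ∣
        ≤⟨ ℚ.+-mono-≤ (∣p*q∣≤½*∣p∣ (v ℚ.- w) (1ℚ ℚ.- a) (ℚ-0≤q-p (y≤1 m)) (1-y≤½ m))
          (ℚ.∣p+q∣≤∣p∣+∣q∣ (½ ℚ.* (e ℚ.- f)) (w ℚ.* (b ℚ.- a))) ⟩
      ½ ℚ.* ℚ.∣ v ℚ.- w ∣ ℚ.+ (ℚ.∣ ½ ℚ.* (e ℚ.- f) ∣ ℚ.+ ℚ.∣ w ℚ.* (b ℚ.- a) ∣)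
        ≤⟨ ℚ.+-monoʳ-≤ (½ ℚ.* ℚ.∣ v ℚ.- w ∣) (ℚ.<⇒≤ (ℚ.+-mono-<
          (∣p*q∣<B*δ ½ (e ℚ.- f) (ℚ.positive⁻¹ ½) ℚ.≤-refl cs)
          (∣p*q∣<B*δ w (b ℚ.- a) (ℚ.positive⁻¹ 1ℚ) (subst (ℚ._≤ 1ℚ) (≡.sym (ℚ.0≤p⇒∣p∣≡p 0≤w)) w≤1)
            (subst (ℚ._< θ) (∣p-q∣≡∣q-p∣ a b) cy)))) ⟩
      ½ ℚ.* ℚ.∣ v ℚ.- w ∣ ℚ.+ (½ ℚ.* η ℚ.+ 1ℚ ℚ.* θ)
        ≡⟨ cong (½ ℚ.* ℚ.∣ v ℚ.- w ∣ ℚ.+_) (≡.trans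
          (cong (λ η → ½ ℚ.* η ℚ.+ 1ℚ ℚ.* θ) (≡.sym θ+θ≡η))
          (≡.trans (solve 1 (λ θ → con ½ :* (θ :+ θ) :+ con 1ℚ :* θ := con ½ :* ((θ :+ θ) :+ (θ :+ θ))) refl θ)
          (cong (½ ℚ.*_) (≡.trans (cong₂ ℚ._+_ θ+θ≡η θ+θ≡η) η+η≡δ)))) ⟩
      ½ ℚ.* ℚ.∣ v ℚ.- w ∣ ℚ.+ ½ ℚ.* δ ∎
      where open ℚ.≤-Reasoning

    s/2y : ℝ
    s/2y .seq    = approx
    s/2y .cauchy = contraction⇒cauchy approx (unitInterval-bounded {approx} approx-unitInterval) contract

    s/2y-double : y * s/2y + y * s/2y ≈ s
    s/2y-double = ≈-sym (residual⇒≈ s/2y λ _ → refl)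

-- The ordered ring of reals

ℝ-commutativeRing : CommutativeRing 0ℓ 0ℓ
ℝ-commutativeRing = record
  { Carrier = ℝ ; _≈_ = _≈_ ; _+_ = _+_ ; _*_ = _*_ ; -_ = -_ ; 0# = 0ℝ ; 1# = 1ℝ
  ; isCommutativeRing = record
    { isRing = record
      { +-isAbelianGroup = record
        { isGroup = record
          { isMonoid = record
            { isSemigroup = record
              { isMagma = record
                { isEquivalence = record { refl = ≈-refl ; sym = ≈-sym ; trans = ≈-trans }
                ; ∙-cong = +-cong }
              ; assoc = λ x y z → ≗⇒≈ λ n → ℚ.+-assoc (seq x n) (seq y n) (seq z n) }
            ; identity = (λ x → ≗⇒≈ λ n → ℚ.+-identityˡ (seq x n))
                       , (λ x → ≗⇒≈ λ n → ℚ.+-identityʳ (seq x n)) }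
          ; inverse = (λ x → ≗⇒≈ λ n → ℚ.+-inverseˡ (seq x n))
                    , (λ x → ≗⇒≈ λ n → ℚ.+-inverseʳ (seq x n))
          ; ⁻¹-cong = -‿cong }
        ; comm = λ x y → ≗⇒≈ λ n → ℚ.+-comm (seq x n) (seq y n) }
      ; *-cong = *-cong
      ; *-assoc = λ x y z → ≗⇒≈ λ n → ℚ.*-assoc (seq x n) (seq y n) (seq z n)
      ; *-identity = (λ x → ≗⇒≈ λ n → ℚ.*-identityˡ (seq x n))
                   , (λ x → ≗⇒≈ λ n → ℚ.*-identityʳ (seq x n))
      ; distrib = (λ x y z → ≗⇒≈ λ n → ℚ.*-distribˡ-+ (seq x n) (seq y n) (seq z n))
                , (λ x y z → ≗⇒≈ λ n → ℚ.*-distribʳ-+ (seq x n) (seq y n) (seq z n)) }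
    ; *-comm = *-comm }
  }

open CommutativeRing ℝ-commutativeRing
  using (setoid; +-congˡ; +-congʳ; *-congʳ; +-identityˡ; +-identityʳ; *-identityˡ;
    *-identityʳ; +-comm; zeroˡ; zeroʳ; semiring)

fromℚ-homo : ℚ.+-*-rawRing -Raw-AlmostCommutative⟶ fromCommutativeRing ℝ-commutativeRing
fromℚ-homo = record
  { ⟦_⟧    = fromℚ
  ; +-homo = λ _ _ → ≗⇒≈ λ _ → refl
  ; *-homo = λ _ _ → ≗⇒≈ λ _ → refl
  ; -‿homo = λ _ → ≗⇒≈ λ _ → refl
  ; 0-homo = ≈-refl
  ; 1-homo = ≈-refl
  }

fromℚ-coeff : ∀ p q → Maybe.Maybe (fromℚ p ≈ fromℚ q)
fromℚ-coeff p q = Maybe.map (λ p≡q → ≗⇒≈ λ _ → p≡q) (dec⇒maybe (p ℚ.≟ q))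

open import Algebra.Solver.Ring ℚ.+-*-rawRing (fromCommutativeRing ℝ-commutativeRing)
  fromℚ-homo fromℚ-coeff
  using (solve; _:=_; _:+_; _:*_; _:-_; :-_; con)

open import Algebra.Properties.Semiring.Sum semiring
  using (sum-cong-≋; sum-replicate-zero; ∑-distrib-+; ∑-comm; *-distribˡ-sum; *-distribʳ-sum)

open import Relation.Binary.Reasoning.Setoid setoid

≤-respˡ-≈ : ∀ {x y z} → x ≈ y → x ≤ z → y ≤ z
≤-respˡ-≈ x≈y x≤z = ≤-trans (≈⇒≤ (≈-sym x≈y)) x≤z

≤-respʳ-≈ : ∀ {x y z} → y ≈ z → x ≤ y → x ≤ z
≤-respʳ-≈ y≈z x≤y = ≤-trans x≤y (≈⇒≤ y≈z)

0≤y-x⇒x≤y : ∀ {x y} → 0ℝ ≤ y - x → x ≤ y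
0≤y-x⇒x≤y {x} {y} p = ≤-respˡ-≈ (+-identityˡ x) (≤-respʳ-≈
  (solve 2 (λ x y → (y :- x) :+ x := y) ≈-refl x y) (+-mono-≤ p (≈⇒≤ ≈-refl)))

x≤y⇒0≤y-x : ∀ {x y} → x ≤ y → 0ℝ ≤ y - x
x≤y⇒0≤y-x {x} {y} p = ≤-respˡ-≈ (solve 1 (λ x → x :- x := con 0ℚ) ≈-refl x)
  (+-mono-≤ p (≈⇒≤ ≈-refl))

0≤x+y : ∀ {x y} → 0ℝ ≤ x → 0ℝ ≤ y → 0ℝ ≤ x + y
0≤x+y p q = ≤-respˡ-≈ (+-identityˡ 0ℝ) (+-mono-≤ p q)

-- The terms of a nonnegative real may be slightly negative, so the product need not be termwise
-- nonnegative. A negative term is tiny, however, and a bound on the other factor then makes the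
-- product small in absolute value.
0≤x*y : ∀ {x y} → 0ℝ ≤ x → 0ℝ ≤ y → 0ℝ ≤ x * y
0≤x*y {x} {y} (mk≤ p) (mk≤ q) = mk≤ λ ε 0<ε →
  let B , 0<B , x≤B = bounded x
      C , 0<C , y≤C = bounded y
      δ , 0<δ , Bδ≡ε = divide ε 0<B 0<ε
      η , 0<η , Cη≡ε = divide ε 0<C 0<ε in
  zipEventually (λ n (a , a′) (b , b′) → step Bδ≡ε Cη≡ε 0<B 0<C 0<ε (seq x n) (seq y n) a a′ b b′)
    (zipEventually (λ _ → _,_) (p η 0<η) x≤B) (zipEventually (λ _ → _,_) (q δ 0<δ) y≤C)
  where
  neg : ∀ {p ε} → p ℚ.≤ 0ℚ → 0ℚ ℚ.< p ℚ.+ ε → ℚ.∣ p ∣ ℚ.< ε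
  neg {p} {ε} p≤0 0<p+ε = subst₂ ℚ._<_
    (≡.trans (ℚ.+-identityʳ _) (≡.trans (≡.sym (ℚ.0≤p⇒∣p∣≡p (ℚ.neg-antimono-≤ p≤0))) (ℚ.∣-p∣≡∣p∣ p)))
    (ℚ-solve 2 (λ p e → (:-ℚ p) +ℚ (p +ℚ e) =ℚ e) refl p ε)
    (ℚ.+-monoʳ-< (ℚ.- p) 0<p+ε)
    where open ℚ-Solver.+-*-Solver renaming (solve to ℚ-solve; _:+_ to _+ℚ_; :-_ to :-ℚ_; _:=_ to _=ℚ_)
  pos : ∀ {p ε} → ℚ.∣ p ∣ ℚ.< ε → 0ℚ ℚ.< p ℚ.+ ε
  pos {p} {ε} lt = subst (ℚ._< p ℚ.+ ε) (ℚ.+-inverseʳ p) (ℚ.+-monoʳ-< p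
    (ℚ.≤-<-trans (p≤∣p∣ (ℚ.- p)) (subst (ℚ._< ε) (≡.sym (ℚ.∣-p∣≡∣p∣ p)) lt)))
  step : ∀ {B C δ η ε} → B ℚ.* δ ≡ ε → C ℚ.* η ≡ ε → 0ℚ ℚ.< B → 0ℚ ℚ.< C → 0ℚ ℚ.< ε → ∀ a b →
    0ℚ ℚ.< a ℚ.+ η → ℚ.∣ a ∣ ℚ.≤ B → 0ℚ ℚ.< b ℚ.+ δ → ℚ.∣ b ∣ ℚ.≤ C →
    0ℚ ℚ.< a ℚ.* b ℚ.+ ε
  step Bδ Cη 0<B 0<C 0<ε a b ha a≤B hb b≤C with ℚ.≤-total 0ℚ a | ℚ.≤-total 0ℚ b
  ... | inj₁ 0≤a | inj₁ 0≤b = ℚ.+-mono-≤-<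
    (subst (ℚ._≤ a ℚ.* b) (ℚ.*-zeroʳ a) (ℚ.*-monoˡ-≤-nonNeg a {{ℚ.nonNegative 0≤a}} 0≤b)) 0<ε
  ... | _        | inj₂ b≤0 = pos (subst (_ ℚ.<_) Bδ (∣p*q∣<B*δ a b 0<B a≤B (neg b≤0 hb)))
  ... | inj₂ a≤0 | _        = pos (subst₂ ℚ._<_ (cong ℚ.∣_∣ (ℚ.*-comm b a)) Cη
    (∣p*q∣<B*δ b a 0<C b≤C (neg a≤0 ha)))

0≤x*x : ∀ x → 0ℝ ≤ x * x
0≤x*x x = ≤-pointwise λ n → square (seq x n)
  where
  square : ∀ p → 0ℚ ℚ.≤ p ℚ.* p
  square p = subst (0ℚ ℚ.≤_)
    (≡.trans (≡.sym (ℚ.∣p*q∣≡∣p∣*∣q∣ p p)) (lemma p))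
    (ℚ.≤-trans (ℚ.≤-reflexive (≡.sym (ℚ.*-zeroʳ ℚ.∣ p ∣)))
      (ℚ.*-monoˡ-≤-nonNeg ℚ.∣ p ∣ {{ℚ.nonNegative (ℚ.0≤∣p∣ p)}} (ℚ.0≤∣p∣ p)))
    where
    lemma : ∀ p → ℚ.∣ p ℚ.* p ∣ ≡ p ℚ.* p
    lemma p with ℚ.≤-total 0ℚ p
    ... | inj₁ 0≤p = ℚ.0≤p⇒∣p∣≡p (ℚ.≤-trans (ℚ.≤-reflexive (≡.sym (ℚ.*-zeroʳ p)))
      (ℚ.*-monoˡ-≤-nonNeg p {{ℚ.nonNegative 0≤p}} 0≤p))
    ... | inj₂ p≤0 = ℚ.0≤p⇒∣p∣≡p (ℚ.≤-trans (ℚ.≤-reflexive (≡.sym (ℚ.*-zeroʳ p)))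
      (ℚ.*-monoˡ-≤-nonPos p {{ℚ.nonPositive p≤0}} p≤0))

0≤fromℚ : ∀ {p} → 0ℚ ℚ.≤ p → 0ℝ ≤ fromℚ p
0≤fromℚ 0≤p = ≤-pointwise λ _ → 0≤p

0≤½ : 0ℝ ≤ fromℚ ½
0≤½ = 0≤fromℚ (ℚ.nonNegative⁻¹ ½)

0<⇒0≤ : ∀ {x} → 0ℝ < x → 0ℝ ≤ x
0<⇒0≤ {x} (mk< g 0<g sep) = mk≤ λ ε 0<ε → mapEventually (λ n lt →
  ℚ.<-trans (ℚ.<-trans 0<g (subst (ℚ._< seq x n) (ℚ.+-identityˡ g) lt))
    (subst (ℚ._< seq x n ℚ.+ ε) (ℚ.+-identityʳ (seq x n)) (ℚ.+-monoʳ-< (seq x n) 0<ε))) sep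

ℚ-+-cancelʳ-< : ∀ {p q} r → p ℚ.+ r ℚ.< q ℚ.+ r → p ℚ.< q
ℚ-+-cancelʳ-< {p} {q} r lt = subst₂ ℚ._<_ (cancel p) (cancel q) (ℚ.+-monoˡ-< (ℚ.- r) lt)
  where
  cancel : ∀ p → p ℚ.+ r ℚ.- r ≡ p
  cancel p = ≡.trans (ℚ.+-assoc p r (ℚ.- r))
    (≡.trans (cong (p ℚ.+_) (ℚ.+-inverseʳ r)) (ℚ.+-identityʳ p))

0<x≤y⇒0<y : ∀ {x y} → 0ℝ < x → x ≤ y → 0ℝ < y
0<x≤y⇒0<y {x} {y} (mk< g 0<g sep) (mk≤ p) =
  let δ , 0<δ , δ+δ≡g = half g 0<g in
  mk< δ 0<δ (zipEventually (λ n a b → ℚ-+-cancelʳ-< δ (subst (ℚ._< seq y n ℚ.+ δ)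
    (≡.trans (cong (0ℚ ℚ.+_) (≡.sym δ+δ≡g)) (≡.sym (ℚ.+-assoc 0ℚ δ δ))) (ℚ.<-trans a b))) sep (p δ 0<δ))

0<x*y : ∀ {x y} → 0ℝ < x → 0ℝ < y → 0ℝ < x * y
0<x*y {x} {y} (mk< g 0<g sep) (mk< h 0<h sep′) =
  mk< (g ℚ.* h) (subst (ℚ._< g ℚ.* h) (ℚ.*-zeroʳ g) (ℚ.*-monoʳ-<-pos g {{ℚ.positive 0<g}} 0<h))
    (zipEventually (λ n a b → subst (ℚ._< seq x n ℚ.* seq y n) (≡.sym (ℚ.+-identityˡ (g ℚ.* h)))
      (ℚ.<-trans
        (ℚ.*-monoʳ-<-pos g {{ℚ.positive 0<g}} (subst (ℚ._< seq y n) (ℚ.+-identityˡ h) b))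
        (ℚ.*-monoˡ-<-pos (seq y n)
          {{ℚ.positive (ℚ.<-trans 0<h (subst (ℚ._< seq y n) (ℚ.+-identityˡ h) b))}}
          (subst (ℚ._< seq x n) (ℚ.+-identityˡ g) a)))) sep sep′)

0<fromℚ : ∀ {p} → 0ℚ ℚ.< p → 0ℝ < fromℚ p
0<fromℚ {p} 0<p = let δ , 0<δ , δ+δ≡p = half p 0<p in mk< δ 0<δ
  (always λ _ → subst (0ℚ ℚ.+ δ ℚ.<_) δ+δ≡p (ℚ.+-monoˡ-< δ 0<δ))

-- The gap `g` keeps the terms of `x` away from 0, so tolerance g ε on the product becomes tolerance
-- ε on `y`.
0≤x*y⇒0≤y : ∀ {x y} → 0ℝ < x → 0ℝ ≤ x * y → 0ℝ ≤ y
0≤x*y⇒0≤y {x} {y} (mk< g 0<g sep) (mk≤ p) = mk≤ λ ε 0<ε →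
  zipEventually (λ n a b → step (seq x n) (seq y n) 0<ε (subst (ℚ._< seq x n) (ℚ.+-identityˡ g) a) b)
    sep (p (g ℚ.* ε) (subst (ℚ._< g ℚ.* ε) (ℚ.*-zeroʳ g) (ℚ.*-monoʳ-<-pos g {{ℚ.positive 0<g}} 0<ε)))
  where
  step : ∀ {ε} a b → 0ℚ ℚ.< ε → g ℚ.< a → 0ℚ ℚ.< a ℚ.* b ℚ.+ g ℚ.* ε → 0ℚ ℚ.< b ℚ.+ ε
  step {ε} a b 0<ε g<a lt = ℚ.*-cancelˡ-<-nonNeg a
    {{ℚ.nonNegative (ℚ.<⇒≤ (ℚ.<-trans 0<g g<a))}}
    (subst₂ ℚ._<_ (≡.sym (ℚ.*-zeroʳ a)) (≡.sym (ℚ.*-distribˡ-+ a b ε))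
      (ℚ.<-trans lt (ℚ.+-monoʳ-< (a ℚ.* b) (ℚ.*-monoˡ-<-pos ε {{ℚ.positive 0<ε}} g<a))))

-- Cancellation without inverses: `0≤x*y⇒0≤y` applies to `y` and to its negative.
x*y≈0⇒y≈0 : ∀ {x y} → 0ℝ < x → x * y ≈ 0ℝ → y ≈ 0ℝ
x*y≈0⇒y≈0 {x} {y} 0<x eq = ≤-antisym
  (0≤y-x⇒x≤y (0≤x*y⇒0≤y 0<x (≈⇒≤ (begin
    0ℝ               ≈⟨ solve 0 (con 0ℚ := :- con 0ℚ) ≈-refl ⟩
    - 0ℝ             ≈⟨ -‿cong eq ⟨
    - (x * y)        ≈⟨ solve 2 (λ x y → :- (x :* y) := x :* (con 0ℚ :- y)) ≈-refl x y ⟩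
    x * (0ℝ - y)     ∎))))
  (0≤x*y⇒0≤y 0<x (≈⇒≤ (≈-sym eq)))

x-y≈0⇒x≈y : ∀ {x y} → x - y ≈ 0ℝ → x ≈ y
x-y≈0⇒x≈y {x} {y} eq = begin
  x            ≈⟨ solve 2 (λ x y → x := (x :- y) :+ y) ≈-refl x y ⟩
  (x - y) + y  ≈⟨ +-congʳ eq ⟩
  0ℝ + y       ≈⟨ +-identityˡ y ⟩
  y            ∎

x*y≈x*z⇒y≈z : ∀ {x y z} → 0ℝ < x → x * y ≈ x * z → y ≈ z
x*y≈x*z⇒y≈z {x} {y} {z} 0<x eq = x-y≈0⇒x≈y (x*y≈0⇒y≈0 0<x (begin
  x * (y - z)      ≈⟨ solve 3 (λ x y z → x :* (y :- z) := x :* y :- x :* z) ≈-refl x y z ⟩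
  x * y - x * z    ≈⟨ +-congʳ eq ⟩
  x * z - x * z    ≈⟨ solve 1 (λ a → a :- a := con 0ℚ) ≈-refl (x * z) ⟩
  0ℝ               ∎))

-- Finite sums and embedded naturals

sum-cong : ∀ {n} {f g : Fin n → ℝ} → (∀ i → f i ≈ g i) → sum f ≈ sum g
sum-cong = sum-cong-≋

sum-zero : ∀ {n} {f : Fin n → ℝ} → (∀ i → f i ≈ 0ℝ) → sum f ≈ 0ℝ
sum-zero {n} p = ≈-trans (sum-cong p) (sum-replicate-zero n)

0≤sum : ∀ {n} {f : Fin n → ℝ} → (∀ i → 0ℝ ≤ f i) → 0ℝ ≤ sum f
0≤sum {zero}  p = ≈⇒≤ ≈-refl
0≤sum {suc n} p = 0≤x+y (p zero) (0≤sum (λ i → p (suc i)))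

fromℕ-suc : ∀ n → fromℕ (suc n) ≈ 1ℝ + fromℕ n
fromℕ-suc n = ≗⇒≈ λ _ → ℕ/1-suc n

sum-const : ∀ n x → sum {n} (λ _ → x) ≈ fromℕ n * x
sum-const zero    x = ≈-sym (≈-trans (*-congʳ (≗⇒≈ λ _ → refl)) (zeroˡ x))
sum-const (suc n) x = begin
  x + sum {n} (λ _ → x)  ≈⟨ +-congˡ (sum-const n x) ⟩
  x + fromℕ n * x        ≈⟨ solve 2 (λ x m → x :+ m :* x := (con 1ℚ :+ m) :* x) ≈-refl x (fromℕ n) ⟩
  (1ℝ + fromℕ n) * x     ≈⟨ *-congʳ (fromℕ-suc n) ⟨
  fromℕ (suc n) * x      ∎

-- Roots of unity by bisection of angles

module Powers (c s : ℝ) where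

  -- Real and imaginary part of (c + i s)^k: the argument counts multiples of a fixed angle, which
  -- itself never appears.
  cos sin : ℕ → ℝ
  cos zero    = 1ℝ
  cos (suc k) = c * cos k - s * sin k
  sin zero    = 0ℝ
  sin (suc k) = s * cos k + c * sin k

  cos-+ : ∀ j k → cos (j ℕ.+ k) ≈ cos j * cos k - sin j * sin k
  sin-+ : ∀ j k → sin (j ℕ.+ k) ≈ sin j * cos k + cos j * sin k
  cos-+ zero    k = solve 2 (λ C S → C := con 1ℚ :* C :- con 0ℚ :* S) ≈-refl (cos k) (sin k)
  cos-+ (suc j) k = begin
    c * cos (j ℕ.+ k) - s * sin (j ℕ.+ k)
      ≈⟨ +-cong (*-congˡ (cos-+ j k)) (-‿cong (*-congˡ (sin-+ j k))) ⟩
    c * (cos j * cos k - sin j * sin k) - s * (sin j * cos k + cos j * sin k)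
      ≈⟨ solve 6 (λ c s a b x y → c :* (a :* x :- b :* y) :- s :* (b :* x :+ a :* y) :=
           (c :* a :- s :* b) :* x :- (s :* a :+ c :* b) :* y) ≈-refl
         c s (cos j) (sin j) (cos k) (sin k) ⟩
    cos (suc j) * cos k - sin (suc j) * sin k ∎
  sin-+ zero    k = solve 2 (λ C S → S := con 0ℚ :* C :+ con 1ℚ :* S) ≈-refl (cos k) (sin k)
  sin-+ (suc j) k = begin
    s * cos (j ℕ.+ k) + c * sin (j ℕ.+ k)
      ≈⟨ +-cong (*-congˡ (cos-+ j k)) (*-congˡ (sin-+ j k)) ⟩
    s * (cos j * cos k - sin j * sin k) + c * (sin j * cos k + cos j * sin k)
      ≈⟨ solve 6 (λ c s a b x y → s :* (a :* x :- b :* y) :+ c :* (b :* x :+ a :* y) :=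
           (s :* a :+ c :* b) :* x :+ (c :* a :- s :* b) :* y) ≈-refl
         c s (cos j) (sin j) (cos k) (sin k) ⟩
    sin (suc j) * cos k + cos (suc j) * sin k ∎

  cos-1 : cos 1 ≈ c
  cos-1 = solve 2 (λ c s → c :* con 1ℚ :- s :* con 0ℚ := c) ≈-refl c s

  module _ (unit : c * c + s * s ≈ 1ℝ) where

    cos²+sin² : ∀ k → cos k * cos k + sin k * sin k ≈ 1ℝ
    cos²+sin² zero    = solve 0 (con 1ℚ :* con 1ℚ :+ con 0ℚ :* con 0ℚ := con 1ℚ) ≈-refl
    cos²+sin² (suc k) = begin
      cos (suc k) * cos (suc k) + sin (suc k) * sin (suc k)
        ≈⟨ solve 4 (λ c s x y
            → (c :* x :- s :* y) :* (c :* x :- s :* y) :+ (s :* x :+ c :* y) :* (s :* x :+ c :* y) :=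
             (c :* c :+ s :* s) :* (x :* x :+ y :* y)) ≈-refl c s (cos k) (sin k) ⟩
      (c * c + s * s) * (cos k * cos k + sin k * sin k)
        ≈⟨ *-cong unit (cos²+sin² k) ⟩
      1ℝ * 1ℝ
        ≈⟨ *-identityˡ 1ℝ ⟩
      1ℝ ∎

    cos-diff : ∀ j k → cos j * cos (j ℕ.+ k) + sin j * sin (j ℕ.+ k) ≈ cos k
    cos-diff j k = begin
      cos j * cos (j ℕ.+ k) + sin j * sin (j ℕ.+ k)
        ≈⟨ +-cong (*-congˡ (cos-+ j k)) (*-congˡ (sin-+ j k)) ⟩
      cos j * (cos j * cos k - sin j * sin k) + sin j * (sin j * cos k + cos j * sin k)
        ≈⟨ solve 4 (λ a b x y → a :* (a :* x :- b :* y) :+ b :* (b :* x :+ a :* y) :=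
             (a :* a :+ b :* b) :* x) ≈-refl (cos j) (sin j) (cos k) (sin k) ⟩
      (cos j * cos j + sin j * sin j) * cos k
        ≈⟨ *-congʳ (cos²+sin² j) ⟩
      1ℝ * cos k
        ≈⟨ *-identityˡ (cos k) ⟩
      cos k ∎

-- The angle π / h.
record HalfTurn (h : ℕ) : Set where
  field
    c s      : ℝ
    -- Termwise, because `halve` takes the square root of ½ (1 + c) and needs every term of that in
    -- [½, 1].
    c-bounds : InUnitInterval (seq c)
    s-bounds : InUnitInterval (seq s)
    unit     : c * c + s * s ≈ 1ℝ
    c<1      : 0ℝ < 1ℝ - c
  open Powers c s public
  field
    cos-h    : cos h ≈ - 1ℝ
    sin-h    : sin h ≈ 0ℝ
    0≤sin    : ∀ k → k ℕ.≤ h → 0ℝ ≤ sin k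

rightAngle : HalfTurn 2
rightAngle = record
  { c = 0ℝ ; s = 1ℝ
  ; c-bounds = λ _ → ℚ.≤-refl , ℚ.nonNegative⁻¹ 1ℚ
  ; s-bounds = λ _ → ℚ.nonNegative⁻¹ 1ℚ , ℚ.≤-refl
  ; unit = ≗⇒≈ λ _ → refl
  ; c<1 = 0<x≤y⇒0<y (0<fromℚ (ℚ.positive⁻¹ 1ℚ)) (≈⇒≤ (≗⇒≈ λ _ → refl))
  ; cos-h = ≗⇒≈ λ _ → refl
  ; sin-h = ≗⇒≈ λ _ → refl
  ; 0≤sin = λ
    { 0 _ → ≈⇒≤ ≈-refl
    ; 1 _ → ≤-respʳ-≈ (≗⇒≈ λ _ → refl) (0≤fromℚ (ℚ.nonNegative⁻¹ 1ℚ))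
    ; 2 _ → ≈⇒≤ (≗⇒≈ λ _ → refl)
    ; (suc (suc (suc _))) (ℕ.s≤s (ℕ.s≤s ())) }
  }

parity : ∀ k → ∃ λ j → k ≡ j ℕ.+ j ⊎ k ≡ suc (j ℕ.+ j)
parity zero    = 0 , inj₁ refl
parity (suc k) with parity k
... | j , inj₁ eq = j , inj₂ (cong suc eq)
... | j , inj₂ eq = suc j , inj₁ (≡.trans (cong suc eq) (cong suc (≡.sym (ℕ.+-suc j j))))

j+j≤h+h⇒j≤h : ∀ {j h} → j ℕ.+ j ℕ.≤ h ℕ.+ h → j ℕ.≤ h
j+j≤h+h⇒j≤h {j} {h} le with j ℕ.≤? h
... | yes p = p
... | no ¬p = contradiction le (ℕ.<⇒≱ (ℕ.+-mono-< (ℕ.≰⇒> ¬p) (ℕ.≰⇒> ¬p)))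

-- The half-angle formulas. The sine is the quotient sin θ / (2 cos (θ/2)) and not the root of ½ (1
-- - cos θ), because the latter is at most ½ here while `SquareRoot` asks for a radicand of at least
-- ½.
record Half {h : ℕ} (A : HalfTurn h) : Set where
  private module A = HalfTurn A
  field
    c s      : ℝ
    c²≈      : c * c ≈ fromℚ ½ * (1ℝ + A.c)
    cs+cs≈   : c * s + c * s ≈ A.s
    ½≤c≤1    : ∀ n → ½ ℚ.≤ seq c n × seq c n ℚ.≤ 1ℚ
    s-bounds : InUnitInterval (seq s)

halve : ∀ {h} (A : HalfTurn h) → Half A
halve A = record
  { c = √x ; s = s/2y ; c²≈ = √x-square ; cs+cs≈ = s/2y-double
  ; ½≤c≤1 = ½≤√x≤1 ; s-bounds = approx-unitInterval }
  where
  open HalfTurn A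
  open SquareRoot (fromℚ ½ * (1ℝ + c))
    (λ n → ℚ.*-monoˡ-≤-nonNeg ½ (ℚ.+-monoʳ-≤ 1ℚ (proj₁ (c-bounds n))))
    (λ n → ℚ.*-monoˡ-≤-nonNeg ½ (ℚ.+-monoʳ-≤ 1ℚ (proj₂ (c-bounds n))))
    using (√x; √x-square) renaming (approx-bounds to ½≤√x≤1)
  open HalfQuotient √x s (λ n → proj₁ (½≤√x≤1 n)) (λ n → proj₂ (½≤√x≤1 n)) s-bounds
    using (s/2y; s/2y-double; approx-unitInterval)

module Bisection {h : ℕ} (A : HalfTurn h) (H : Half A) where
  private module A = HalfTurn A
  open Half H public
  open Powers c s public

  ½[1+c] : ℝ
  ½[1+c] = fromℚ ½ * (1ℝ + A.c)

  0<c : 0ℝ < c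
  0<c = 0<x≤y⇒0<y (0<fromℚ (ℚ.positive⁻¹ ½)) (≤-pointwise λ n → proj₁ (½≤c≤1 n))

  -- Multiplied by c², the claim reads ¼ ((1 + A.c)² + A.s²) = ½ (1 + A.c), which is the unit
  -- relation of the given angle; the positive factor c² is then cancelled.
  unit : c * c + s * s ≈ 1ℝ
  unit = x*y≈x*z⇒y≈z (0<x*y 0<c 0<c) (begin
    (c * c) * (c * c + s * s)
      ≈⟨ solve 2 (λ c s → (c :* c) :* (c :* c :+ s :* s) :=
           (c :* c) :* (c :* c) :+ (con ½ :* con ½) :* ((c :* s :+ c :* s) :* (c :* s :+ c :* s))) ≈-refl c s ⟩
    (c * c) * (c * c) + (fromℚ ½ * fromℚ ½) * ((c * s + c * s) * (c * s + c * s))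
      ≈⟨ +-cong (*-cong c²≈ c²≈) (*-congˡ (*-cong cs+cs≈ cs+cs≈)) ⟩
    ½[1+c] * ½[1+c] + (fromℚ ½ * fromℚ ½) * (A.s * A.s)
      ≈⟨ solve 2 (λ c s → (con ½ :* (con 1ℚ :+ c)) :* (con ½ :* (con 1ℚ :+ c)) :+ (con ½ :* con ½) :* (s :* s) :=
           (con ½ :* con ½) :* (con 1ℚ :+ (c :+ c) :+ (c :* c :+ s :* s))) ≈-refl A.c A.s ⟩
    (fromℚ ½ * fromℚ ½) * (1ℝ + (A.c + A.c) + (A.c * A.c + A.s * A.s))
      ≈⟨ *-congˡ (+-congˡ A.unit) ⟩
    (fromℚ ½ * fromℚ ½) * (1ℝ + (A.c + A.c) + 1ℝ)
      ≈⟨ solve 1 (λ c → (con ½ :* con ½) :* (con 1ℚ :+ (c :+ c) :+ con 1ℚ) := con ½ :* (con 1ℚ :+ c) :* con 1ℚ)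
          ≈-refl A.c ⟩
    ½[1+c] * 1ℝ
      ≈⟨ *-congʳ c²≈ ⟨
    (c * c) * 1ℝ ∎)

  c²-s²≈ : c * c - s * s ≈ A.c
  c²-s²≈ = begin
    c * c - s * s
      ≈⟨ solve 2 (λ c s → c :* c :- s :* s := (c :* c :+ c :* c) :- (c :* c :+ s :* s)) ≈-refl c s ⟩
    (c * c + c * c) - (c * c + s * s)
      ≈⟨ +-cong (+-cong c²≈ c²≈) (-‿cong unit) ⟩
    (½[1+c] + ½[1+c]) - 1ℝ
      ≈⟨ solve 1 (λ c → (con ½ :* (con 1ℚ :+ c) :+ con ½ :* (con 1ℚ :+ c)) :- con 1ℚ := c) ≈-refl A.c ⟩
    A.c ∎

  cos-2+ : ∀ k → cos (2 ℕ.+ k) ≈ A.c * cos k - A.s * sin k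
  cos-2+ k = begin
    cos (2 ℕ.+ k)
      ≈⟨ solve 4 (λ c s x y → c :* (c :* x :- s :* y) :- s :* (s :* x :+ c :* y) :=
           (c :* c :- s :* s) :* x :- (c :* s :+ c :* s) :* y) ≈-refl c s (cos k) (sin k) ⟩
    (c * c - s * s) * cos k - (c * s + c * s) * sin k
      ≈⟨ +-cong (*-congʳ c²-s²≈) (-‿cong (*-congʳ cs+cs≈)) ⟩
    A.c * cos k - A.s * sin k ∎

  sin-2+ : ∀ k → sin (2 ℕ.+ k) ≈ A.s * cos k + A.c * sin k
  sin-2+ k = begin
    sin (2 ℕ.+ k)
      ≈⟨ solve 4 (λ c s x y → s :* (c :* x :- s :* y) :+ c :* (s :* x :+ c :* y) :=
           (c :* s :+ c :* s) :* x :+ (c :* c :- s :* s) :* y) ≈-refl c s (cos k) (sin k) ⟩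
    (c * s + c * s) * cos k + (c * c - s * s) * sin k
      ≈⟨ +-cong (*-congʳ cs+cs≈) (*-congʳ c²-s²≈) ⟩
    A.s * cos k + A.c * sin k ∎

  -- Two steps of the halved angle make one step of the given angle, by `cos-2+` and `sin-2+`; each
  -- induction uses the other.
  cos-double : ∀ k → cos (k ℕ.+ k) ≈ A.cos k
  sin-double : ∀ k → sin (k ℕ.+ k) ≈ A.sin k
  cos-double zero    = ≈-refl
  cos-double (suc k) rewrite ℕ.+-suc k k = ≈-trans (cos-2+ (k ℕ.+ k))
    (+-cong (*-congˡ (cos-double k)) (-‿cong (*-congˡ (sin-double k))))
  sin-double zero    = ≈-refl
  sin-double (suc k) rewrite ℕ.+-suc k k = ≈-trans (sin-2+ (k ℕ.+ k))
    (+-cong (*-congˡ (cos-double k)) (*-congˡ (sin-double k)))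

  -- sin is nonnegative at odd multiples since 2 cos θ sin (1 + k) θ = sin k θ + sin (2 + k) θ.
  0≤sin : ∀ k → k ℕ.≤ h ℕ.+ h → 0ℝ ≤ sin k
  0≤sin k k≤ with parity k
  ... | j , inj₁ refl = ≤-respʳ-≈ (≈-sym (sin-double j)) (A.0≤sin j (j+j≤h+h⇒j≤h k≤))
  ... | j , inj₂ refl = 0≤x*y⇒0≤y 0<c (≤-respʳ-≈ (begin
    fromℚ ½ * (sin (j ℕ.+ j) + sin (2 ℕ.+ (j ℕ.+ j)))
      ≈⟨ solve 4 (λ c s x y → con ½ :* (y :+ (s :* (c :* x :- s :* y) :+ c :* (s :* x :+ c :* y))) :=
           c :* (s :* x :+ c :* y) :+ con ½ :* ((con 1ℚ :- (c :* c :+ s :* s)) :* y)) ≈-refl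
           c s (cos (j ℕ.+ j)) (sin (j ℕ.+ j)) ⟩
    c * sin (suc (j ℕ.+ j)) + fromℚ ½ * ((1ℝ - (c * c + s * s)) * sin (j ℕ.+ j))
      ≈⟨ +-congˡ (*-congˡ (*-congʳ (+-congˡ (-‿cong unit)))) ⟩
    c * sin (suc (j ℕ.+ j)) + fromℚ ½ * ((1ℝ - 1ℝ) * sin (j ℕ.+ j))
      ≈⟨ solve 2 (λ a y → a :+ con ½ :* ((con 1ℚ :- con 1ℚ) :* y) := a)
          ≈-refl (c * sin (suc (j ℕ.+ j))) (sin (j ℕ.+ j)) ⟩
    c * sin (suc (j ℕ.+ j)) ∎)
    (0≤x*y 0≤½ (0≤x+y
      (≤-respʳ-≈ (≈-sym (sin-double j)) (A.0≤sin j (ℕ.<⇒≤ j<h)))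
      (≤-respʳ-≈ (≈-sym (≈-trans (≡⇒≈ (cong sin (cong suc (≡.sym (ℕ.+-suc j j))))) (sin-double (suc j))))
          (A.0≤sin (suc j) j<h)))))
    where
    j<h : j ℕ.< h
    j<h with j ℕ.<? h
    ... | yes p = p
    ... | no ¬p = contradiction k≤ (ℕ.<⇒≱ (ℕ.s≤s (ℕ.+-mono-≤ (ℕ.≮⇒≥ ¬p) (ℕ.≮⇒≥ ¬p))))

  -- 1 - cos 2θ = 2 (1 - cos θ) (1 + cos θ) ≤ 4 (1 - cos θ).
  c<1 : 0ℝ < 1ℝ - c
  c<1 = 0<x≤y⇒0<y (0<x*y (0<fromℚ (ℚ.positive⁻¹ (½ ℚ.* ½))) A.c<1) (0≤y-x⇒x≤y (≤-respʳ-≈ (begin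
    fromℚ ½ * ((1ℝ - c) * (1ℝ - c))
      ≈⟨ solve 2 (λ c s → con ½ :* ((con 1ℚ :- c) :* (con 1ℚ :- c)) := (con ½ :+ con ½ :* (c :* c)) :- c) ≈-refl c s ⟩
    (fromℚ ½ + fromℚ ½ * (c * c)) - c
      ≈⟨ +-congʳ (+-congˡ (*-congˡ c²≈)) ⟩
    (fromℚ ½ + fromℚ ½ * ½[1+c]) - c
      ≈⟨ solve 2 (λ a c → (con ½ :+ con ½ :* (con ½ :* (con 1ℚ :+ a))) :- c :=
          (con 1ℚ :- c) :- con (½ ℚ.* ½) :* (con 1ℚ :- a)) ≈-refl A.c c ⟩
    (1ℝ - c) - fromℚ (½ ℚ.* ½) * (1ℝ - A.c) ∎)
    (0≤x*y 0≤½ (0≤x*x (1ℝ - c)))))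

  halfTurn : HalfTurn (h ℕ.+ h)
  halfTurn = record
    { c = c ; s = s
    ; c-bounds = λ n → ℚ.≤-trans 0≤½ℚ (proj₁ (½≤c≤1 n)) , proj₂ (½≤c≤1 n)
    ; s-bounds = s-bounds ; unit = unit ; c<1 = c<1
    ; cos-h = ≈-trans (cos-double h) A.cos-h
    ; sin-h = ≈-trans (sin-double h) A.sin-h
    ; 0≤sin = 0≤sin }

-- Cosines at the nth roots of unity

-- All that the Fourier analysis uses of ω = exp (2πi/n). The cycle has the eigenvalues 2 `cos` k,
-- so `cos≤cos-1` identifies the second largest of them and `cos-1<1` is the spectral gap.
record RootOfUnity (n : ℕ) : Set where
  field
    cos sin   : ℕ → ℝ
    cos-0     : cos 0 ≈ 1ℝ
    cos-+     : ∀ j k → cos (j ℕ.+ k) ≈ cos j * cos k - sin j * sin k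
    sin-+     : ∀ j k → sin (j ℕ.+ k) ≈ sin j * cos k + cos j * sin k
    cos²+sin² : ∀ k → cos k * cos k + sin k * sin k ≈ 1ℝ
    cos-diff  : ∀ j k → cos j * cos (j ℕ.+ k) + sin j * sin (j ℕ.+ k) ≈ cos k
    cos-n     : cos n ≈ 1ℝ
    sin-n     : sin n ≈ 0ℝ
    cos≤cos-1 : ∀ k → 1 ℕ.≤ k → k ℕ.< n → cos k ≤ cos 1
    cos-1<1   : 0ℝ < 1ℝ - cos 1

module _ {h : ℕ} (A : HalfTurn h) (H : Half A) where
  open HalfTurn A
  private module B = Bisection A H

  -- In units of π / h, cos k - cos (1 + k) = 2 sin ½ sin (k + ½).
  cos-decreasing : ∀ k → k ℕ.< h → cos (suc k) ≤ cos k
  cos-decreasing k k<h = 0≤y-x⇒x≤y (≤-respʳ-≈ (begin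
    (B.s + B.s) * B.sin (suc (k ℕ.+ k))
      ≈⟨ solve 4 (λ c s x y → (s :+ s) :* (s :* x :+ c :* y) :=
          (((c :* c :+ s :* s) :- (c :* c :- s :* s)) :* x :+ (c :* s :+ c :* s) :* y)) ≈-refl
          B.c B.s (B.cos (k ℕ.+ k)) (B.sin (k ℕ.+ k)) ⟩
    ((B.c * B.c + B.s * B.s) - (B.c * B.c - B.s * B.s)) * B.cos (k ℕ.+ k) + (B.c * B.s + B.c * B.s) * B.sin (k ℕ.+ k)
      ≈⟨ +-cong (*-cong (+-cong B.unit (-‿cong B.c²-s²≈)) (B.cos-double k)) (*-cong B.cs+cs≈ (B.sin-double k)) ⟩
    (1ℝ - c) * cos k + s * sin k
      ≈⟨ solve 4 (λ c s x y → (con 1ℚ :- c) :* x :+ s :* y := x :- (c :* x :- s :* y)) ≈-refl c s (cos k) (sin k) ⟩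
    cos k - cos (suc k) ∎)
    (0≤x*y (0≤x+y 0≤s 0≤s) (B.0≤sin (suc (k ℕ.+ k))
      (ℕ.≤-trans (ℕ.+-mono-≤ k<h ℕ.≤-refl) (ℕ.+-monoʳ-≤ h (ℕ.<⇒≤ k<h))))))
    where
    0≤s : 0ℝ ≤ B.s
    0≤s = ≤-pointwise λ n → proj₁ (B.s-bounds n)

  cos≤cos-1-below : ∀ k → suc k ℕ.≤ h → cos (suc k) ≤ cos 1
  cos≤cos-1-below zero    _  = ≈⇒≤ ≈-refl
  cos≤cos-1-below (suc k) le = ≤-trans (cos-decreasing (suc k) le) (cos≤cos-1-below k (ℕ.<⇒≤ le))

  cos-2h : cos (h ℕ.+ h) ≈ 1ℝ
  cos-2h = begin
    cos (h ℕ.+ h)                        ≈⟨ cos-+ h h ⟩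
    cos h * cos h - sin h * sin h        ≈⟨ +-cong (*-cong cos-h cos-h) (-‿cong (*-cong sin-h sin-h)) ⟩
    - 1ℝ * - 1ℝ - 0ℝ * 0ℝ                ≈⟨ ≗⇒≈ (λ _ → refl) ⟩
    1ℝ ∎

  sin-2h : sin (h ℕ.+ h) ≈ 0ℝ
  sin-2h = begin
    sin (h ℕ.+ h)                        ≈⟨ sin-+ h h ⟩
    sin h * cos h + cos h * sin h        ≈⟨ +-cong (*-cong sin-h cos-h) (*-cong cos-h sin-h) ⟩
    0ℝ * - 1ℝ + - 1ℝ * 0ℝ                ≈⟨ ≗⇒≈ (λ _ → refl) ⟩
    0ℝ ∎

  cos-reflect : ∀ k l → k ℕ.+ l ≡ h ℕ.+ h → cos k ≈ cos l
  cos-reflect k l eq = begin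
    cos k                                        ≈⟨ solve 2 (λ x y → x := x :* con 1ℚ :+ y :* con 0ℚ)
        ≈-refl (cos k) (sin k) ⟩
    cos k * 1ℝ + sin k * 0ℝ                      ≈⟨ +-cong (*-congˡ cos-2h) (*-congˡ sin-2h) ⟨
    cos k * cos (h ℕ.+ h) + sin k * sin (h ℕ.+ h)
      ≡⟨ cong (λ n → cos k * cos n + sin k * sin n) eq ⟨
    cos k * cos (k ℕ.+ l) + sin k * sin (k ℕ.+ l) ≈⟨ cos-diff unit k l ⟩
    cos l ∎

  rootOfUnity : RootOfUnity (h ℕ.+ h)
  rootOfUnity = record
    { cos = cos ; sin = sin
    ; cos-0 = ≈-refl ; cos-+ = cos-+ ; sin-+ = sin-+
    ; cos²+sin² = cos²+sin² unit
    ; cos-diff = cos-diff unit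
    ; cos-n = cos-2h ; sin-n = sin-2h
    ; cos≤cos-1 = below
    ; cos-1<1 = 0<x≤y⇒0<y c<1 (≈⇒≤ (+-congˡ (-‿cong (≈-sym cos-1))))
    }
    where
    below : ∀ k → 1 ℕ.≤ k → k ℕ.< h ℕ.+ h → cos k ≤ cos 1
    below (suc k) _ k<n with suc k ℕ.≤? h
    ... | yes le = cos≤cos-1-below k le
    -- Beyond the half turn the cosine equals the one at the reflected index n - (1 + k), which lies
    -- between 1 and h.
    ... | no ¬le with h ℕ.+ h ℕ.∸ suc k in eq
    ...   | zero  = contradiction (ℕ.m∸n≡0⇒m≤n eq) (ℕ.<⇒≱ k<n)
    ...   | suc l = ≤-respˡ-≈ (≈-sym (cos-reflect (suc k) (suc l)
          (≡.trans (cong (suc k ℕ.+_) (≡.sym eq)) (ℕ.m+[n∸m]≡n (ℕ.<⇒≤ k<n)))))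
        (cos≤cos-1-below l (subst (ℕ._≤ h) eq (ℕ.≤-trans (ℕ.∸-monoʳ-≤ (h ℕ.+ h) (ℕ.<⇒≤ (ℕ.≰⇒> ¬le)))
          (ℕ.≤-reflexive (ℕ.m+n∸n≡m h h)))))

-- Traces and positive semidefinite matrices

I-diag : ∀ {n} (i : Fin n) → I n i i ≈ 1ℝ
I-diag i with i Fin.≟ i
... | yes _  = ≈-refl
... | no i≢i = contradiction refl i≢i

I-off : ∀ {n} {i j : Fin n} → i ≢ j → I n i j ≈ 0ℝ
I-off {i = i} {j} i≢j with i Fin.≟ j
... | yes i≡j = contradiction i≡j i≢j
... | no _    = ≈-refl

I-sym : ∀ {n} (i j : Fin n) → I n i j ≈ I n j i
I-sym i j with i Fin.≟ j | j Fin.≟ i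
... | yes _   | yes _   = ≈-refl
... | no _    | no _    = ≈-refl
... | yes i≡j | no j≢i  = contradiction (≡.sym i≡j) j≢i
... | no i≢j  | yes j≡i = contradiction (≡.sym j≡i) i≢j

0≤I : ∀ {n} (i j : Fin n) → 0ℝ ≤ I n i j
0≤I i j with i Fin.≟ j
... | yes _ = 0≤fromℚ (ℚ.nonNegative⁻¹ 1ℚ)
... | no _  = ≈⇒≤ ≈-refl

0≤J-I : ∀ {n} (i j : Fin n) → 0ℝ ≤ (J n ⊟ I n) i j
0≤J-I i j with i Fin.≟ j
... | yes _ = ≈⇒≤ (≗⇒≈ λ _ → refl)
... | no _  = ≤-respʳ-≈ (≗⇒≈ λ _ → refl) (0≤fromℚ (ℚ.nonNegative⁻¹ 1ℚ))

sum-single : ∀ {n} (i : Fin n) (f : Fin n → ℝ) → (∀ k → k ≢ i → f k ≈ 0ℝ) → sum f ≈ f i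
sum-single zero    f off = ≈-trans (+-congˡ (sum-zero λ k → off (suc k) λ ())) (+-identityʳ (f zero))
sum-single (suc i) f off = ≈-trans (+-cong (off zero λ ())
    (sum-single i (λ k → f (suc k)) λ k k≢i → off (suc k) λ eq → k≢i (Fin.suc-injective eq)))
  (+-identityˡ (f (suc i)))

sum-I* : ∀ {n} (i : Fin n) (f : Fin n → ℝ) → sum (λ k → I n i k * f k) ≈ f i
sum-I* i f = ≈-trans
  (sum-single i _ λ k k≢i → ≈-trans (*-congʳ (I-off λ i≡k → k≢i (≡.sym i≡k))) (zeroˡ (f k)))
  (≈-trans (*-congʳ (I-diag i)) (*-identityˡ (f i)))

sum-++ : ∀ m n (f : Fin (m ℕ.+ n) → ℝ) →
  sum f ≈ sum (λ i → f (i ↑ˡ n)) + sum (λ j → f (m ↑ʳ j))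
sum-++ zero    n f = ≈-sym (+-identityˡ (sum f))
sum-++ (suc m) n f = begin
  f zero + sum (λ i → f (suc i))
    ≈⟨ +-congˡ (sum-++ m n (λ i → f (suc i))) ⟩
  f zero + (sum (λ i → f (suc (i ↑ˡ n))) + sum (λ j → f (suc (m ↑ʳ j))))
    ≈⟨ solve 3 (λ a b c → a :+ (b :+ c) := (a :+ b) :+ c) ≈-refl (f zero) _ _ ⟩
  (f zero + sum (λ i → f (suc (i ↑ˡ n)))) + sum (λ j → f (suc (m ↑ʳ j))) ∎

sum-combine : ∀ m n (f : Fin (m ℕ.* n) → ℝ) →
  sum f ≈ sum λ i → sum λ j → f (combine {m} i j)
sum-combine zero    n f = ≈-refl
sum-combine (suc m) n f = ≈-trans (sum-++ n (m ℕ.* n) f)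
  (+-congˡ (sum-combine m n (λ k → f (n ↑ʳ k))))

sum-*-sum : ∀ {m n} (f : Fin m → ℝ) (g : Fin n → ℝ) →
  (sum λ i → sum λ j → f i * g j) ≈ sum f * sum g
sum-*-sum f g = ≈-trans (sum-cong λ i → ≈-sym (*-distribˡ-sum (f i) g))
  (≈-sym (*-distribʳ-sum (sum g) f))

sum-⊗ : ∀ {m n} (f : Fin m → ℝ) (g : Fin n → ℝ) →
  sum {m ℕ.* n} (λ p → f (quotient n p) * g (remainder {m} n p)) ≈ sum f * sum g
sum-⊗ {m} {n} f g = begin
  sum {m ℕ.* n} (λ p → f (quotient n p) * g (remainder {m} n p))
    ≈⟨ sum-combine m n _ ⟩
  (sum λ i → sum λ j → f (quotient n (combine {m} i j)) * g (remainder {m} n (combine {m} i j)))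
    ≈⟨ (sum-cong λ i → sum-cong λ j → ≡⇒≈ (cong (λ (k , l) → f k * g l) (Fin.remQuot-combine {m} i j))) ⟩
  (sum λ i → sum λ j → f i * g j)
    ≈⟨ sum-*-sum f g ⟩
  sum f * sum g ∎

scale : ∀ {m} → ℝ → Matrix m → Matrix m
scale x A i j = x * A i j

rankOne : ∀ {m} → (Fin m → ℝ) → Matrix m
rankOne v i j = v i * v j

sumMatrix : ∀ {m k} → (Fin k → Matrix m) → Matrix m
sumMatrix A i j = sum λ r → A r i j

infix 4 _≋_

_≋_ : ∀ {m} → Matrix m → Matrix m → Set
A ≋ B = ∀ i j → A i j ≈ B i j

module _ {m : ℕ} where

  trace-comm : (A B : Matrix m) → trace (A · B) ≈ trace (B · A)
  trace-comm A B = ≈-trans (∑-comm λ i k → A i k * B k i)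
    (sum-cong λ k → sum-cong λ i → *-comm (A i k) (B k i))

  trace-cong : {A B Y : Matrix m} → A ≋ B → trace (A · Y) ≈ trace (B · Y)
  trace-cong p = sum-cong λ i → sum-cong λ k → *-congʳ (p i k)

  trace-⊞ : (A B Y : Matrix m) → trace ((A ⊞ B) · Y) ≈ trace (A · Y) + trace (B · Y)
  trace-⊞ A B Y = begin
    trace ((A ⊞ B) · Y)
      ≈⟨ (sum-cong λ i → sum-cong λ k → solve 3 (λ a b y → (a :+ b) :* y := a :* y :+ b :* y)
          ≈-refl (A i k) (B i k) (Y k i)) ⟩
    (sum λ i → sum λ k → A i k * Y k i + B i k * Y k i)
      ≈⟨ (sum-cong λ i → ∑-distrib-+ (λ k → A i k * Y k i) (λ k → B i k * Y k i)) ⟩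
    (sum λ i → (A · Y) i i + (B · Y) i i)
      ≈⟨ ∑-distrib-+ (λ i → (A · Y) i i) (λ i → (B · Y) i i) ⟩
    trace (A · Y) + trace (B · Y) ∎

  trace-scale : (x : ℝ) (A Y : Matrix m) → trace (scale x A · Y) ≈ x * trace (A · Y)
  trace-scale x A Y = begin
    trace (scale x A · Y)
      ≈⟨ (sum-cong λ i → sum-cong λ k → solve 3 (λ x a y → x :* a :* y := x :* (a :* y)) ≈-refl x (A i k) (Y k i)) ⟩
    (sum λ i → sum λ k → x * (A i k * Y k i))
      ≈⟨ (sum-cong λ i → ≈-sym (*-distribˡ-sum x (λ k → A i k * Y k i))) ⟩
    (sum λ i → x * (A · Y) i i)
      ≈⟨ *-distribˡ-sum x (λ i → (A · Y) i i) ⟨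
    x * trace (A · Y) ∎

  trace-⊟ : (A B Y : Matrix m) → trace ((A ⊟ B) · Y) ≈ trace (A · Y) - trace (B · Y)
  trace-⊟ A B Y = begin
    trace ((A ⊟ B) · Y)
      ≈⟨ trace-cong (λ i j → solve 2 (λ a b → a :- b := a :+ con (ℚ.- 1ℚ) :* b) ≈-refl (A i j) (B i j)) ⟩
    trace ((A ⊞ scale (fromℚ (ℚ.- 1ℚ)) B) · Y)
      ≈⟨ ≈-trans (trace-⊞ A _ Y) (+-congˡ (trace-scale _ B Y)) ⟩
    trace (A · Y) + fromℚ (ℚ.- 1ℚ) * trace (B · Y)
      ≈⟨ solve 2 (λ a b → a :+ con (ℚ.- 1ℚ) :* b := a :- b) ≈-refl _ _ ⟩
    trace (A · Y) - trace (B · Y) ∎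

  trace-sum : ∀ {k} (A : Fin k → Matrix m) (Y : Matrix m) →
    trace (sumMatrix A · Y) ≈ sum λ r → trace (A r · Y)
  trace-sum A Y = begin
    trace (sumMatrix A · Y)
      ≈⟨ (sum-cong λ i → sum-cong λ k → *-distribʳ-sum (Y k i) (λ r → A r i k)) ⟩
    (sum λ i → sum λ k → sum λ r → A r i k * Y k i)
      ≈⟨ (sum-cong λ i → ∑-comm (λ k r → A r i k * Y k i)) ⟩
    (sum λ i → sum λ r → (A r · Y) i i)
      ≈⟨ ∑-comm (λ i r → (A r · Y) i i) ⟩
    (sum λ r → trace (A r · Y)) ∎

  trace-I· : (A : Matrix m) → trace (I m · A) ≈ trace A
  trace-I· A = sum-cong λ i → sum-I* i (λ k → A k i)

  trace-E· : ∀ k (A : Matrix m) → trace (E m k · A) ≈ A k k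
  trace-E· k A = begin
    (sum λ i → sum λ j → I m i k * I m k j * A j i)
      ≈⟨ (sum-cong λ i → sum-cong λ j → solve 3 (λ a b c → a :* b :* c := b :* (c :* a))
          ≈-refl (I m i k) (I m k j) (A j i)) ⟩
    (sum λ i → sum λ j → I m k j * (A j i * I m i k))
      ≈⟨ (sum-cong λ i → sum-I* k (λ j → A j i * I m i k)) ⟩
    (sum λ i → A k i * I m i k)
      ≈⟨ (sum-cong λ i → ≈-trans (*-comm (A k i) (I m i k)) (*-congʳ (I-sym i k))) ⟩
    (sum λ i → I m k i * A k i)
      ≈⟨ sum-I* k (A k) ⟩
    A k k ∎

  0≤trace : {A Y : Matrix m} → EntrywiseNonNegative A → EntrywiseNonNegative Y → 0ℝ ≤ trace (A · Y)
  0≤trace p q = 0≤sum λ i → 0≤sum λ k → 0≤x*y (p i k) (q k i)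

  -- The trace of v vᵀ `Y` is the quadratic form of `Y` at `v`.
  0≤trace-rankOne : (v : Fin m → ℝ) {Y : Matrix m} → PositiveSemidefinite Y → 0ℝ ≤ trace (rankOne v · Y)
  0≤trace-rankOne v {Y} psd = ≤-respʳ-≈ (begin
    (sum λ i → sum λ j → v i * Y i j * v j)
      ≈⟨ (sum-cong λ i → sum-cong λ j → solve 3 (λ a y b → a :* y :* b := b :* a :* y) ≈-refl (v i) (Y i j) (v j)) ⟩
    (sum λ i → sum λ j → v j * v i * Y i j)
      ≈⟨ ∑-comm (λ i j → v j * v i * Y i j) ⟩
    trace (rankOne v · Y) ∎) (psd v)

  psd-cong : {A B : Matrix m} → A ≋ B → PositiveSemidefinite A → PositiveSemidefinite B
  psd-cong p psd x = ≤-respʳ-≈ (sum-cong λ i → sum-cong λ j → *-congʳ (*-congˡ (p i j))) (psd x)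

  psd-rankOne : (v : Fin m → ℝ) → PositiveSemidefinite (rankOne v)
  psd-rankOne v x = ≤-respʳ-≈ (begin
    sum (λ i → x i * v i) * sum (λ i → x i * v i)
      ≈⟨ sum-*-sum (λ i → x i * v i) (λ j → x j * v j) ⟨
    (sum λ i → sum λ j → (x i * v i) * (x j * v j))
      ≈⟨ (sum-cong λ i → sum-cong λ j → solve 4 (λ a b c d → (a :* b) :* (c :* d) := a :* (b :* d) :* c)
          ≈-refl (x i) (v i) (x j) (v j)) ⟩
    (sum λ i → sum λ j → x i * rankOne v i j * x j) ∎) (0≤x*x _)

  psd-scale : ∀ {x} {A : Matrix m} → 0ℝ ≤ x → PositiveSemidefinite A → PositiveSemidefinite (scale x A)
  psd-scale {x} {A} 0≤x psd y = ≤-respʳ-≈ (begin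
    x * (sum λ i → sum λ j → y i * A i j * y j)
      ≈⟨ *-distribˡ-sum x (λ i → sum λ j → y i * A i j * y j) ⟩
    (sum λ i → x * (sum λ j → y i * A i j * y j))
      ≈⟨ (sum-cong λ i → *-distribˡ-sum x (λ j → y i * A i j * y j)) ⟩
    (sum λ i → sum λ j → x * (y i * A i j * y j))
      ≈⟨ (sum-cong λ i → sum-cong λ j → solve 4 (λ x y a z → x :* (y :* a :* z) := y :* (x :* a) :* z)
          ≈-refl x (y i) (A i j) (y j)) ⟩
    (sum λ i → sum λ j → y i * scale x A i j * y j) ∎) (0≤x*y 0≤x (psd y))

  psd-⊞ : {A B : Matrix m} → PositiveSemidefinite A → PositiveSemidefinite B → PositiveSemidefinite (A ⊞ B)
  psd-⊞ {A} {B} psdA psdB y = ≤-respʳ-≈ (begin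
    (sum λ i → sum λ j → y i * A i j * y j) + (sum λ i → sum λ j → y i * B i j * y j)
      ≈⟨ ∑-distrib-+ (λ i → sum λ j → y i * A i j * y j) (λ i → sum λ j → y i * B i j * y j) ⟨
    (sum λ i → (sum λ j → y i * A i j * y j) + (sum λ j → y i * B i j * y j))
      ≈⟨ (sum-cong λ i → ∑-distrib-+ (λ j → y i * A i j * y j) (λ j → y i * B i j * y j)) ⟨
    (sum λ i → sum λ j → y i * A i j * y j + y i * B i j * y j)
      ≈⟨ (sum-cong λ i → sum-cong λ j → solve 4 (λ y a b z → y :* a :* z :+ y :* b :* z := y :* (a :+ b) :* z)
          ≈-refl (y i) (A i j) (B i j) (y j)) ⟩
    (sum λ i → sum λ j → y i * (A ⊞ B) i j * y j) ∎) (0≤x+y (psdA y) (psdB y))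

  psd-sum : ∀ {k} {A : Fin k → Matrix m} → (∀ r → PositiveSemidefinite (A r)) → PositiveSemidefinite (sumMatrix A)
  psd-sum {zero}  psd x = ≤-respʳ-≈ (≈-sym (sum-zero λ i → sum-zero λ j →
    solve 2 (λ a b → a :* con 0ℚ :* b := con 0ℚ) ≈-refl (x i) (x j))) (≈⇒≤ ≈-refl)
  psd-sum {suc k} psd = psd-⊞ (psd zero) (psd-sum (λ r → psd (suc r)))

-- The mixed-product rule. It reduces each constraint on a combination of Kronecker products to
-- traces of n by n matrices.
trace-⊗·⊗ : ∀ {m n} (A X : Matrix m) (B Z : Matrix n) →
  trace ((A ⊗ B) · (X ⊗ Z)) ≈ trace (A · X) * trace (B · Z)
trace-⊗·⊗ {m} {n} A X B Z = begin
  (sum λ p → sum λ q → A (P p) (P q) * B (R p) (R q) * (X (P q) (P p) * Z (R q) (R p)))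
    ≈⟨ (sum-cong λ p → sum-cong λ q → solve 4 (λ a b x z → a :* b :* (x :* z) := (a :* x) :* (b :* z)) ≈-refl
         (A (P p) (P q)) (B (R p) (R q)) (X (P q) (P p)) (Z (R q) (R p))) ⟩
  (sum λ p → sum λ q → (A (P p) (P q) * X (P q) (P p)) * (B (R p) (R q) * Z (R q) (R p)))
    ≈⟨ (sum-cong λ p → sum-⊗ (λ j → A (P p) j * X j (P p)) (λ l → B (R p) l * Z l (R p))) ⟩
  (sum λ p → (A · X) (P p) (P p) * (B · Z) (R p) (R p))
    ≈⟨ sum-⊗ (λ i → (A · X) i i) (λ k → (B · Z) k k) ⟩
  trace (A · X) * trace (B · Z) ∎
  where
  P : Fin (m ℕ.* n) → Fin m
  P = quotient n
  R : Fin (m ℕ.* n) → Fin n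
  R = remainder {m} n

fromℕ-+ : ∀ m n → fromℕ (m ℕ.+ n) ≈ fromℕ m + fromℕ n
fromℕ-+ zero    n = ≗⇒≈ λ _ → ≡.sym (ℚ.+-identityˡ _)
fromℕ-+ (suc m) n = begin
  fromℕ (suc (m ℕ.+ n))       ≈⟨ ≈-trans (fromℕ-suc (m ℕ.+ n)) (+-congˡ (fromℕ-+ m n)) ⟩
  1ℝ + (fromℕ m + fromℕ n)    ≈⟨ solve 2 (λ a b → con 1ℚ :+ (a :+ b) := (con 1ℚ :+ a) :+ b)
      ≈-refl (fromℕ m) (fromℕ n) ⟩
  (1ℝ + fromℕ m) + fromℕ n    ≈⟨ +-congʳ (fromℕ-suc m) ⟨
  fromℕ (suc m) + fromℕ n     ∎

fromℕ-* : ∀ m n → fromℕ (m ℕ.* n) ≈ fromℕ m * fromℕ n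
fromℕ-* zero    n = ≗⇒≈ λ _ → ≡.sym (ℚ.*-zeroˡ (+ n ℚ./ 1))
fromℕ-* (suc m) n = begin
  fromℕ (n ℕ.+ m ℕ.* n)       ≈⟨ ≈-trans (fromℕ-+ n (m ℕ.* n)) (+-congˡ (fromℕ-* m n)) ⟩
  fromℕ n + fromℕ m * fromℕ n ≈⟨ solve 2 (λ a b → b :+ a :* b := (con 1ℚ :+ a) :* b) ≈-refl (fromℕ m) (fromℕ n) ⟩
  (1ℝ + fromℕ m) * fromℕ n    ≈⟨ *-congʳ (fromℕ-suc m) ⟨
  fromℕ (suc m) * fromℕ n     ∎

0≤fromℕ : ∀ n → 0ℝ ≤ fromℕ n
0≤fromℕ zero    = ≈⇒≤ (≗⇒≈ λ _ → refl)
0≤fromℕ (suc n) = ≤-respʳ-≈ (≈-sym (fromℕ-suc n)) (0≤x+y (0≤fromℚ (ℚ.nonNegative⁻¹ 1ℚ)) (0≤fromℕ n))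

1≤fromℕ : ∀ n .{{_ : ℕ.NonZero n}} → 1ℝ ≤ fromℕ n
1≤fromℕ (suc n) = ≤-respʳ-≈ (≈-sym (fromℕ-suc n)) (≤-respˡ-≈ (+-identityʳ 1ℝ) (+-mono-≤ (≈⇒≤ ≈-refl) (0≤fromℕ n)))

0<fromℕ : ∀ n .{{_ : ℕ.NonZero n}} → 0ℝ < fromℕ n
0<fromℕ n = 0<x≤y⇒0<y (0<fromℚ (ℚ.positive⁻¹ 1ℚ)) (1≤fromℕ n)

reciprocal : ∀ n .{{_ : ℕ.NonZero n}} → ∃ λ x → 0ℝ ≤ x × x * fromℕ n ≈ 1ℝ
reciprocal (suc n) = fromℚ (proj₁ D) , 0≤fromℚ (ℚ.<⇒≤ (proj₁ (proj₂ D))) ,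
  ≗⇒≈ λ _ → ≡.trans (ℚ.*-comm (proj₁ D) _) (proj₂ (proj₂ D))
  where D = divide 1ℚ (ℚ.positive⁻¹ (+ suc n ℚ./ 1) {{ℚ.normalize-pos (suc n) 1}}) (ℚ.positive⁻¹ 1ℚ)

-- Discrete Fourier analysis of the cycle

-- Both sides add up `f 0`, ..., `f n`.
sum-shift : ∀ n (f : ℕ → ℝ) →
  sum {n} (λ i → f (suc (toℕ i))) + f 0 ≈ sum {n} (λ i → f (toℕ i)) + f n
sum-shift zero    f = ≈-refl
sum-shift (suc n) f = begin
  (f 1 + sum {n} (λ i → f (suc (suc (toℕ i))))) + f 0
    ≈⟨ solve 3 (λ a b c → (a :+ b) :+ c := c :+ (b :+ a)) ≈-refl (f 1) (sum {n} (λ i → f (suc (suc (toℕ i))))) (f 0) ⟩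
  f 0 + (sum {n} (λ i → f (suc (suc (toℕ i)))) + f 1)
    ≈⟨ +-congˡ (sum-shift n (λ i → f (suc i))) ⟩
  f 0 + (sum {n} (λ i → f (suc (toℕ i))) + f (suc n))
    ≈⟨ solve 3 (λ a b c → a :+ (b :+ c) := (a :+ b) :+ c) ≈-refl (f 0) (sum {n} (λ i → f (suc (toℕ i)))) (f (suc n)) ⟩
  (f 0 + sum {n} (λ i → f (suc (toℕ i)))) + f (suc n) ∎

sum-cyclic : ∀ n (f : ℕ → ℝ) → f n ≈ f 0 → sum {n} (λ i → f (suc (toℕ i))) ≈ sum {n} (λ i → f (toℕ i))
sum-cyclic n f eq = begin
  a            ≈⟨ solve 2 (λ a z → a := (a :+ z) :- z) ≈-refl a (f 0) ⟩
  (a + f 0) - f 0  ≈⟨ +-congʳ (≈-trans (sum-shift n f) (+-congˡ eq)) ⟩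
  (b + f 0) - f 0  ≈⟨ solve 2 (λ a z → (a :+ z) :- z := a) ≈-refl b (f 0) ⟩
  b            ∎
  where
  a = sum {n} (λ i → f (suc (toℕ i)))
  b = sum {n} (λ i → f (toℕ i))

-- Going twice around by one wraps at the first step, at the second, or not at all, and either wrap
-- would force n = 2.
[1+[1+a]%n]%n≢a : ∀ {a} n .{{_ : ℕ.NonZero n}} → 3 ℕ.≤ n → a ℕ.< n → suc (suc a % n) % n ≢ a
[1+[1+a]%n]%n≢a {a} n 3≤n a<n eq with ℕ.m≤n⇒m<n∨m≡n a<n
... | inj₂ 1+a≡n = contradiction 3≤n (ℕ.<⇒≱ (subst (ℕ._< 3) 2≡n (ℕ.n<1+n 2)))
  where
  1≡a : 1 ≡ a
  1≡a = ≡.trans (≡.sym (≡.trans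
    (cong (λ r → suc r % n) (≡.trans (cong (_% n) 1+a≡n) (ℕ.n%n≡0 n)))
    (ℕ.m<n⇒m%n≡m (ℕ.<-≤-trans (ℕ.s≤s (ℕ.s≤s ℕ.z≤n)) 3≤n)))) eq
  2≡n : 2 ≡ n
  2≡n = ≡.trans (cong suc 1≡a) 1+a≡n
... | inj₁ 1+a<n with ℕ.m≤n⇒m<n∨m≡n 1+a<n
...   | inj₁ 2+a<n = contradiction (≡.trans (≡.sym [2+a]%n) eq) (ℕ.>⇒≢ (ℕ.m<n⇒m<1+n (ℕ.n<1+n a)))
  where
  [2+a]%n : suc (suc a % n) % n ≡ suc (suc a)
  [2+a]%n = ≡.trans (cong (λ r → suc r % n) (ℕ.m<n⇒m%n≡m 1+a<n)) (ℕ.m<n⇒m%n≡m 2+a<n)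
...   | inj₂ 2+a≡n = contradiction 3≤n (ℕ.<⇒≱ (subst (ℕ._< 3) 2≡n (ℕ.n<1+n 2)))
  where
  0≡a : 0 ≡ a
  0≡a = ≡.trans (≡.sym (≡.trans (cong (λ r → suc r % n) (ℕ.m<n⇒m%n≡m 1+a<n))
    (≡.trans (cong (_% n) 2+a≡n) (ℕ.n%n≡0 n)))) eq
  2≡n : 2 ≡ n
  2≡n = ≡.trans (cong (λ a → suc (suc a)) 0≡a) 2+a≡n

module _ {n : ℕ} .{{_ : ℕ.NonZero n}} where

  toℕ-next : (p : Fin n) → toℕ (next p) ≡ suc (toℕ p) % n
  toℕ-next p = Fin.toℕ-fromℕ< (ℕ.m%n<n (suc (toℕ p)) n {{Fin.nonZeroIndex p}})

  next-next≢ : 3 ℕ.≤ n → (p : Fin n) → next (next p) ≢ p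
  next-next≢ 3≤n p eq = [1+[1+a]%n]%n≢a n 3≤n (Fin.toℕ<n p) (≡.trans
    (≡.sym (≡.trans (toℕ-next (next p)) (cong (λ a → suc a % n) (toℕ-next p)))) (cong toℕ eq))

  -- By `next-next≢` at most one alternative of the disjunction holds, so it is a sum: the cycle is
  -- the cyclic shift plus its transpose.
  C₁≈I+I : 3 ℕ.≤ n → (p q : Fin n) → C₁ n p q ≈ I n q (next p) + I n p (next q)
  C₁≈I+I 3≤n p q with q Fin.≟ next p | p Fin.≟ next q
  ... | yes q≡  | yes p≡ = contradiction (≡.sym (≡.trans p≡ (cong next q≡))) (next-next≢ 3≤n p)
  ... | yes _   | no _   = ≈-sym (+-identityʳ 1ℝ)
  ... | no _    | yes _  = ≈-sym (+-identityˡ 1ℝ)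
  ... | no _    | no _   = ≈-sym (+-identityˡ 0ℝ)

module Fourier {n : ℕ} .{{_ : ℕ.NonZero n}} (3≤n : 3 ℕ.≤ n) (root : RootOfUnity n) where
  open RootOfUnity root

  1<n : 1 ℕ.< n
  1<n = ℕ.≤-trans (ℕ.s≤s (ℕ.s≤s ℕ.z≤n)) 3≤n

  N : ℝ
  N = fromℕ n

  0<N : 0ℝ < N
  0<N = 0<fromℕ n

  -- Real part of ω ^ (j * p) times the conjugate of ω ^ (j * q).
  kernel : ℕ → ℕ → ℕ → ℝ
  kernel j p q = cos (j ℕ.* p) * cos (j ℕ.* q) + sin (j ℕ.* p) * sin (j ℕ.* q)

  kernel-sym : ∀ j p q → kernel j p q ≈ kernel j q p
  kernel-sym j p q = +-cong (*-comm _ _) (*-comm _ _)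

  kernel-diff : ∀ j p d → kernel j p (p ℕ.+ d) ≈ cos (j ℕ.* d)
  kernel-diff j p d rewrite ℕ.*-distribˡ-+ j p d = cos-diff (j ℕ.* p) (j ℕ.* d)

  cos-periodic : ∀ x t → cos (x ℕ.+ t ℕ.* n) ≈ cos x
  sin-periodic : ∀ x t → sin (x ℕ.+ t ℕ.* n) ≈ sin x
  cos-n+ : ∀ x → cos (n ℕ.+ x) ≈ cos x
  cos-n+ x = begin
    cos (n ℕ.+ x)                       ≈⟨ cos-+ n x ⟩
    cos n * cos x - sin n * sin x       ≈⟨ +-cong (*-congʳ cos-n) (-‿cong (*-congʳ sin-n)) ⟩
    1ℝ * cos x - 0ℝ * sin x             ≈⟨ solve 2 (λ c s → con 1ℚ :* c :- con 0ℚ :* s := c) ≈-refl (cos x) (sin x) ⟩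
    cos x ∎
  sin-n+ : ∀ x → sin (n ℕ.+ x) ≈ sin x
  sin-n+ x = begin
    sin (n ℕ.+ x)                       ≈⟨ sin-+ n x ⟩
    sin n * cos x + cos n * sin x       ≈⟨ +-cong (*-congʳ sin-n) (*-congʳ cos-n) ⟩
    0ℝ * cos x + 1ℝ * sin x             ≈⟨ solve 2 (λ c s → con 0ℚ :* c :+ con 1ℚ :* s := s) ≈-refl (cos x) (sin x) ⟩
    sin x ∎
  x+[n+y]≡n+[x+y] : ∀ x y → x ℕ.+ (n ℕ.+ y) ≡ n ℕ.+ (x ℕ.+ y)
  x+[n+y]≡n+[x+y] x y = ≡.trans (≡.sym (ℕ.+-assoc x n y))
    (≡.trans (cong (ℕ._+ y) (ℕ.+-comm x n)) (ℕ.+-assoc n x y))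
  cos-periodic x zero    = ≡⇒≈ (cong cos (ℕ.+-identityʳ x))
  cos-periodic x (suc t) = ≈-trans (≡⇒≈ (cong cos (x+[n+y]≡n+[x+y] x (t ℕ.* n))))
    (≈-trans (cos-n+ (x ℕ.+ t ℕ.* n)) (cos-periodic x t))
  sin-periodic x zero    = ≡⇒≈ (cong sin (ℕ.+-identityʳ x))
  sin-periodic x (suc t) = ≈-trans (≡⇒≈ (cong sin (x+[n+y]≡n+[x+y] x (t ℕ.* n))))
    (≈-trans (sin-n+ (x ℕ.+ t ℕ.* n)) (sin-periodic x t))

  j*m≡j*[m%n]+[j*[m/n]]*n : ∀ j m → j ℕ.* m ≡ j ℕ.* (m % n) ℕ.+ (j ℕ.* (m / n)) ℕ.* n
  j*m≡j*[m%n]+[j*[m/n]]*n j m = ≡.trans (cong (j ℕ.*_) (ℕ.m≡m%n+[m/n]*n m n))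
    (≡.trans (ℕ.*-distribˡ-+ j (m % n) (m / n ℕ.* n))
      (cong (j ℕ.* (m % n) ℕ.+_) (≡.sym (ℕ.*-assoc j (m / n) n))))

  kernel-% : ∀ j p q → kernel j p q ≈ kernel j (p % n) q
  kernel-% j p q = +-cong
    (*-congʳ (≈-trans (≡⇒≈ (cong cos (j*m≡j*[m%n]+[j*[m/n]]*n j p))) (cos-periodic (j ℕ.* (p % n)) (j ℕ.* (p / n)))))
    (*-congʳ (≈-trans (≡⇒≈ (cong sin (j*m≡j*[m%n]+[j*[m/n]]*n j p))) (sin-periodic (j ℕ.* (p % n)) (j ℕ.* (p / n)))))

  module _ (d : ℕ) (1≤d : 1 ℕ.≤ d) (d<n : d ℕ.< n) where
    private
      Σcos = sum {n} λ j → cos (toℕ j ℕ.* d)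
      Σsin = sum {n} λ j → sin (toℕ j ℕ.* d)

    cos-n*d : cos (n ℕ.* d) ≈ cos 0
    cos-n*d = ≈-trans (≡⇒≈ (cong cos (ℕ.*-comm n d))) (cos-periodic 0 d)

    sin-n*d : sin (n ℕ.* d) ≈ sin 0
    sin-n*d = ≈-trans (≡⇒≈ (cong sin (ℕ.*-comm n d))) (sin-periodic 0 d)

    -- Multiplying the geometric sum of the ω^(j d) by ω^d shifts its index cyclically; this is the
    -- real part, `Σsin-rotate` the imaginary part.
    Σcos-rotate : Σcos ≈ cos d * Σcos - sin d * Σsin
    Σcos-rotate = begin
      Σcos
        ≈⟨ sum-cyclic n (λ j → cos (j ℕ.* d)) cos-n*d ⟨
      (sum {n} λ j → cos (d ℕ.+ toℕ j ℕ.* d))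
        ≈⟨ (sum-cong λ (j : Fin n) → ≈-trans (cos-+ d (toℕ j ℕ.* d)) (+-congˡ (solve 2 (λ a b → :- (a :* b) :=
            (:- a) :* b) ≈-refl (sin d) (sin (toℕ j ℕ.* d))))) ⟩
      (sum {n} λ j → cos d * cos (toℕ j ℕ.* d) + (- sin d) * sin (toℕ j ℕ.* d))
        ≈⟨ ∑-distrib-+ {n} (λ j → cos d * cos (toℕ j ℕ.* d)) (λ j → (- sin d) * sin (toℕ j ℕ.* d)) ⟩
      (sum {n} λ j → cos d * cos (toℕ j ℕ.* d)) + (sum {n} λ j → (- sin d) * sin (toℕ j ℕ.* d))
        ≈⟨ +-cong (*-distribˡ-sum {n} (cos d) (λ j → cos (toℕ j ℕ.* d)))
            (*-distribˡ-sum {n} (- sin d) (λ j → sin (toℕ j ℕ.* d))) ⟨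
      cos d * Σcos + (- sin d) * Σsin
        ≈⟨ solve 4 (λ c s a b → c :* a :+ (:- s) :* b := c :* a :- s :* b) ≈-refl (cos d) (sin d) Σcos Σsin ⟩
      cos d * Σcos - sin d * Σsin ∎

    Σsin-rotate : Σsin ≈ sin d * Σcos + cos d * Σsin
    Σsin-rotate = begin
      Σsin
        ≈⟨ sum-cyclic n (λ j → sin (j ℕ.* d)) sin-n*d ⟨
      (sum {n} λ j → sin (d ℕ.+ toℕ j ℕ.* d))
        ≈⟨ (sum-cong λ (j : Fin n) → sin-+ d (toℕ j ℕ.* d)) ⟩
      (sum {n} λ j → sin d * cos (toℕ j ℕ.* d) + cos d * sin (toℕ j ℕ.* d))
        ≈⟨ ∑-distrib-+ {n} (λ j → sin d * cos (toℕ j ℕ.* d)) (λ j → cos d * sin (toℕ j ℕ.* d)) ⟩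
      (sum {n} λ j → sin d * cos (toℕ j ℕ.* d)) + (sum {n} λ j → cos d * sin (toℕ j ℕ.* d))
        ≈⟨ +-cong (*-distribˡ-sum {n} (sin d) (λ j → cos (toℕ j ℕ.* d)))
            (*-distribˡ-sum {n} (cos d) (λ j → sin (toℕ j ℕ.* d))) ⟨
      sin d * Σcos + cos d * Σsin ∎

    0<∣1-ω∣² : 0ℝ < (1ℝ - cos d) * (1ℝ - cos d) + sin d * sin d
    0<∣1-ω∣² = 0<x≤y⇒0<y (0<x*y 0<1-cos 0<1-cos)
      (0≤y-x⇒x≤y (≤-respʳ-≈ (solve 2 (λ c s → s :* s :=
          ((con 1ℚ :- c) :* (con 1ℚ :- c) :+ s :* s) :- (con 1ℚ :- c) :* (con 1ℚ :- c))
              ≈-refl (cos d) (sin d)) (0≤x*x (sin d))))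
      where
      0<1-cos : 0ℝ < 1ℝ - cos d
      0<1-cos = 0<x≤y⇒0<y cos-1<1 (0≤y-x⇒x≤y (≤-respʳ-≈
        (solve 2 (λ a b → b :- a := (con 1ℚ :- a) :- (con 1ℚ :- b)) ≈-refl (cos d) (cos 1))
        (x≤y⇒0≤y-x (cos≤cos-1 d 1≤d d<n))))

    -- The two rotations say that 1 - ω^d annihilates the geometric sum. Multiplying by the
    -- conjugate of 1 - ω^d gives real equations with the positive factor |1 - ω^d|².
    Σcos≈0 : Σcos ≈ 0ℝ
    Σcos≈0 = x*y≈0⇒y≈0 0<∣1-ω∣² (begin
      ((1ℝ - cos d) * (1ℝ - cos d) + sin d * sin d) * Σcos
        ≈⟨ solve 4 (λ c s a b → ((con 1ℚ :- c) :* (con 1ℚ :- c) :+ s :* s) :* a :=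
             (con 1ℚ :- c) :* (a :- (c :* a :- s :* b)) :- s :* (b :- (s :* a :+ c :* b)))
                 ≈-refl (cos d) (sin d) Σcos Σsin ⟩
      (1ℝ - cos d) * (Σcos - (cos d * Σcos - sin d * Σsin)) - sin d * (Σsin - (sin d * Σcos + cos d * Σsin))
        ≈⟨ +-cong (*-congˡ (+-congˡ (-‿cong (≈-sym Σcos-rotate))))
            (-‿cong (*-congˡ (+-congˡ (-‿cong (≈-sym Σsin-rotate))))) ⟩
      (1ℝ - cos d) * (Σcos - Σcos) - sin d * (Σsin - Σsin)
        ≈⟨ solve 4 (λ c s a b → (con 1ℚ :- c) :* (a :- a) :- s :* (b :- b) := con 0ℚ)
            ≈-refl (cos d) (sin d) Σcos Σsin ⟩
      0ℝ ∎)

    Σsin≈0 : Σsin ≈ 0ℝ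
    Σsin≈0 = x*y≈0⇒y≈0 0<∣1-ω∣² (begin
      ((1ℝ - cos d) * (1ℝ - cos d) + sin d * sin d) * Σsin
        ≈⟨ solve 4 (λ c s a b → ((con 1ℚ :- c) :* (con 1ℚ :- c) :+ s :* s) :* b :=
             (con 1ℚ :- c) :* (b :- (s :* a :+ c :* b)) :+ s :* (a :- (c :* a :- s :* b)))
                 ≈-refl (cos d) (sin d) Σcos Σsin ⟩
      (1ℝ - cos d) * (Σsin - (sin d * Σcos + cos d * Σsin)) + sin d * (Σcos - (cos d * Σcos - sin d * Σsin))
        ≈⟨ +-cong (*-congˡ (+-congˡ (-‿cong (≈-sym Σsin-rotate)))) (*-congˡ (+-congˡ (-‿cong (≈-sym Σcos-rotate)))) ⟩
      (1ℝ - cos d) * (Σsin - Σsin) + sin d * (Σcos - Σcos)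
        ≈⟨ solve 4 (λ c s a b → (con 1ℚ :- c) :* (b :- b) :+ s :* (a :- a) := con 0ℚ)
            ≈-refl (cos d) (sin d) Σcos Σsin ⟩
      0ℝ ∎)

  C S : Fin n → Fin n → ℝ
  C j p = cos (toℕ j ℕ.* toℕ p)
  S j p = sin (toℕ j ℕ.* toℕ p)

  -- Its entries are cos (2πj(p - q)/n), and as a sum of two rank-one matrices it is semidefinite.
  -- Indices j and n - j give the same matrix; keeping both makes the sums over j uniform.
  F : Fin n → Matrix n
  F j = rankOne (C j) ⊞ rankOne (S j)

  F-diag : ∀ j p → F j p p ≈ 1ℝ
  F-diag j p = cos²+sin² (toℕ j ℕ.* toℕ p)

  i₀ i₁ : Fin n
  i₀ = fromℕ< (ℕ.≤-trans (ℕ.s≤s ℕ.z≤n) 3≤n)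
  i₁ = fromℕ< 1<n

  toℕ-i₀ : toℕ i₀ ≡ 0
  toℕ-i₀ = Fin.toℕ-fromℕ< _

  toℕ-i₁ : toℕ i₁ ≡ 1
  toℕ-i₁ = Fin.toℕ-fromℕ< _

  F-i₀ : F i₀ ≋ J n
  F-i₀ p q = begin
    kernel (toℕ i₀) (toℕ p) (toℕ q)  ≡⟨ cong (λ j → kernel j (toℕ p) (toℕ q)) toℕ-i₀ ⟩
    kernel 0 (toℕ p) (toℕ q)         ≈⟨ cos²+sin² 0 ⟩
    1ℝ ∎

  ∑F-below : ∀ (p q : Fin n) → toℕ p ℕ.< toℕ q → (sum λ j → F j p q) ≈ 0ℝ
  ∑F-below p q p<q = ≈-trans
    (sum-cong λ (j : Fin n) → ≈-trans
      (≡⇒≈ (cong (kernel (toℕ j) (toℕ p)) (≡.sym (ℕ.m+[n∸m]≡n (ℕ.<⇒≤ p<q)))))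
      (kernel-diff (toℕ j) (toℕ p) (toℕ q ℕ.∸ toℕ p)))
    (Σcos≈0 (toℕ q ℕ.∸ toℕ p) (ℕ.m<n⇒0<n∸m p<q) (ℕ.≤-<-trans (ℕ.m∸n≤m (toℕ q) (toℕ p)) (Fin.toℕ<n q)))

  -- Orthogonality of characters: off the diagonal the entry is the vanishing geometric sum at the
  -- distance of p and q.
  ∑F : sumMatrix F ≋ scale N (I n)
  ∑F p q with ℕ.<-cmp (toℕ p) (toℕ q)
  ... | tri< p<q p≢q _ = ≈-trans (∑F-below p q p<q)
    (≈-sym (≈-trans (*-congˡ (I-off (p≢q ∘ cong toℕ))) (zeroʳ N)))
  ... | tri> _ p≢q q<p = ≈-trans (sum-cong λ (j : Fin n) → kernel-sym (toℕ j) (toℕ p) (toℕ q))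
    (≈-trans (∑F-below q p q<p) (≈-sym (≈-trans (*-congˡ (I-off (p≢q ∘ cong toℕ))) (zeroʳ N))))
  ... | tri≈ _ p≡q _ with refl ← Fin.toℕ-injective p≡q =
    ≈-trans (sum-cong λ (j : Fin n) → F-diag j p) (≈-trans (sum-const n 1ℝ) (*-congˡ (≈-sym (I-diag p))))

  -- The product-to-sum formula: the right side averages the kernel at the differences p - q + 1 and
  -- p - q - 1. Hence `F j` belongs to the eigenvalue 2 `cos` j of the cycle.
  cos*kernel : ∀ j p q → cos j * kernel j p q ≈ fromℚ ½ * (kernel j (suc p) q + kernel j p (suc q))
  cos*kernel j p q = ≈-sym (begin
    fromℚ ½ * (kernel j (suc p) q + kernel j p (suc q))
      ≈⟨ *-congˡ (+-cong (+-cong (*-congʳ (cos-suc p)) (*-congʳ (sin-suc p)))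
          (+-cong (*-congˡ (cos-suc q)) (*-congˡ (sin-suc q)))) ⟩
    fromℚ ½ * (((c * x - s * y) * z + (s * x + c * y) * w) + (x * (c * z - s * w) + y * (s * z + c * w)))
      ≈⟨ solve 6 (λ c s x y z w
          → con ½ :* (((c :* x :- s :* y) :* z :+ (s :* x :+ c :* y) :* w) :+ (x :* (c :* z :- s :* w) :+ y :* (s :* z :+ c :* w))) :=
           c :* (x :* z :+ y :* w)) ≈-refl c s x y z w ⟩
    cos j * kernel j p q ∎)
    where
    c = cos j
    s = sin j
    x = cos (j ℕ.* p)
    y = sin (j ℕ.* p)
    z = cos (j ℕ.* q)
    w = sin (j ℕ.* q)
    cos-suc : ∀ p → cos (j ℕ.* suc p) ≈ cos j * cos (j ℕ.* p) - sin j * sin (j ℕ.* p)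
    cos-suc p = ≈-trans (≡⇒≈ (cong cos (ℕ.*-suc j p))) (cos-+ j (j ℕ.* p))
    sin-suc : ∀ p → sin (j ℕ.* suc p) ≈ sin j * cos (j ℕ.* p) + cos j * sin (j ℕ.* p)
    sin-suc p = ≈-trans (≡⇒≈ (cong sin (ℕ.*-suc j p))) (sin-+ j (j ℕ.* p))

  kernel-next : ∀ j (p q : Fin n) → kernel (toℕ j) (suc (toℕ p)) (toℕ q) ≈ F j (next p) q
  kernel-next j p q = ≈-trans (kernel-% (toℕ j) (suc (toℕ p)) (toℕ q))
    (≡⇒≈ (cong (λ r → kernel (toℕ j) r (toℕ q)) (≡.sym (toℕ-next p))))

  F-sym : ∀ j p q → F j p q ≈ F j q p
  F-sym j p q = kernel-sym (toℕ j) (toℕ p) (toℕ q)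

  -- The spectral decomposition of the cycle: after `cos*kernel`, `∑F` turns each shifted kernel
  -- into a shifted identity.
  ∑cos*F : (sumMatrix λ j → scale (cos (toℕ j)) (F j)) ≋ scale (fromℚ ½ * N) (C₁ n)
  ∑cos*F p q = begin
    (sum λ j → cos (toℕ j) * F j p q)
      ≈⟨ (sum-cong λ (j : Fin n) → ≈-trans (cos*kernel (toℕ j) (toℕ p) (toℕ q)) (*-congˡ (+-cong (kernel-next j p q)
           (≈-trans (kernel-sym (toℕ j) (toℕ p) (suc (toℕ q)))
               (≈-trans (kernel-next j q p) (F-sym j (next q) p)))))) ⟩
    (sum λ j → fromℚ ½ * (F j (next p) q + F j p (next q)))
      ≈⟨ *-distribˡ-sum (fromℚ ½) (λ j → F j (next p) q + F j p (next q)) ⟨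
    fromℚ ½ * (sum λ j → F j (next p) q + F j p (next q))
      ≈⟨ *-congˡ (∑-distrib-+ (λ j → F j (next p) q) (λ j → F j p (next q))) ⟩
    fromℚ ½ * ((sum λ j → F j (next p) q) + (sum λ j → F j p (next q)))
      ≈⟨ *-congˡ (+-cong (≈-trans (∑F (next p) q) (*-congˡ (I-sym (next p) q))) (∑F p (next q))) ⟩
    fromℚ ½ * (N * I n q (next p) + N * I n p (next q))
      ≈⟨ solve 3 (λ m a b → con ½ :* (m :* a :+ m :* b) := (con ½ :* m) :* (a :+ b))
          ≈-refl N (I n q (next p)) (I n p (next q)) ⟩
    (fromℚ ½ * N) * (I n q (next p) + I n p (next q))
      ≈⟨ *-congˡ (C₁≈I+I 3≤n p q) ⟨
    (fromℚ ½ * N) * C₁ n p q ∎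

  -- Frequency 1, with the largest eigenvalue apart from the trivial one. The optimal matrix couples
  -- the cut direction to it.
  Γ : Matrix n
  Γ = F i₁

  Γ-next : ∀ p → Γ p (next p) ≈ cos 1
  Γ-next p = begin
    F i₁ p (next p)                             ≈⟨ F-sym i₁ p (next p) ⟩
    F i₁ (next p) p                             ≈⟨ kernel-next i₁ p p ⟨
    kernel (toℕ i₁) (suc (toℕ p)) (toℕ p)       ≈⟨ kernel-sym (toℕ i₁) (suc (toℕ p)) (toℕ p) ⟩
    kernel (toℕ i₁) (toℕ p) (suc (toℕ p))       ≡⟨ cong₂ (λ j q → kernel j (toℕ p) q) toℕ-i₁ (ℕ.+-comm 1 (toℕ p)) ⟩
    kernel 1 (toℕ p) (toℕ p ℕ.+ 1)              ≈⟨ kernel-diff 1 (toℕ p) 1 ⟩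
    cos 1 ∎

  ∑Γ : trace (J n · Γ) ≈ 0ℝ
  ∑Γ = sum-zero λ p → begin
    (sum λ q → 1ℝ * (C i₁ q * C i₁ p + S i₁ q * S i₁ p))
      ≈⟨ (sum-cong λ (q : Fin n) → solve 4 (λ a b c d → con 1ℚ :* (a :* b :+ c :* d) := b :* a :+ d :* c)
          ≈-refl (C i₁ q) (C i₁ p) (S i₁ q) (S i₁ p)) ⟩
    (sum λ q → C i₁ p * C i₁ q + S i₁ p * S i₁ q)
      ≈⟨ ∑-distrib-+ (λ q → C i₁ p * C i₁ q) (λ q → S i₁ p * S i₁ q) ⟩
    (sum λ q → C i₁ p * C i₁ q) + (sum λ q → S i₁ p * S i₁ q)
      ≈⟨ +-cong (*-distribˡ-sum (C i₁ p) (C i₁)) (*-distribˡ-sum (S i₁ p) (S i₁)) ⟨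
    C i₁ p * sum (C i₁) + S i₁ p * sum (S i₁)
      ≈⟨ +-cong (*-congˡ (≈-trans (sum-cong λ (q : Fin n) → ≡⇒≈ (cong cos (i₁*q≡q*1 q))) (Σcos≈0 1 ℕ.≤-refl 1<n)))
                (*-congˡ (≈-trans (sum-cong λ (q : Fin n) → ≡⇒≈ (cong sin (i₁*q≡q*1 q))) (Σsin≈0 1 ℕ.≤-refl 1<n))) ⟩
    C i₁ p * 0ℝ + S i₁ p * 0ℝ
      ≈⟨ solve 2 (λ a b → a :* con 0ℚ :+ b :* con 0ℚ := con 0ℚ) ≈-refl (C i₁ p) (S i₁ p) ⟩
    0ℝ ∎
    where
    i₁*q≡q*1 : ∀ (q : Fin n) → toℕ i₁ ℕ.* toℕ q ≡ toℕ q ℕ.* 1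
    i₁*q≡q*1 q = ≡.trans (cong (ℕ._* toℕ q) toℕ-i₁) (ℕ.*-comm 1 (toℕ q))

-- The cut metric and the optimum of SDP₁

x+y≈0⇒x≈0 : ∀ {x y} → 0ℝ ≤ x → 0ℝ ≤ y → x + y ≈ 0ℝ → x ≈ 0ℝ
x+y≈0⇒x≈0 {x} {y} 0≤x 0≤y eq = ≤-antisym
  (≤-respˡ-≈ (+-identityʳ x) (≤-respʳ-≈ eq (+-mono-≤ (≈⇒≤ ≈-refl) 0≤y))) 0≤x

term≤sum : ∀ {n} (i : Fin n) (f : Fin n → ℝ) → (∀ j → j ≢ i → 0ℝ ≤ f j) → f i ≤ sum f
term≤sum zero    f p = ≤-respˡ-≈ (+-identityʳ (f zero))
  (+-mono-≤ (≈⇒≤ ≈-refl) (0≤sum λ j → p (suc j) λ ()))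
term≤sum (suc i) f p = ≤-respˡ-≈ (+-identityˡ (f (suc i)))
  (+-mono-≤ (p zero λ ()) (term≤sum i (λ j → f (suc j)) λ j j≢i → p (suc j) (j≢i ∘ Fin.suc-injective)))

-- To be taken at `U` on the vertex side and at `Γ` on the tour side: what n times the identity has
-- left besides the constant direction and `X`.
complement : ∀ {n} → Matrix n → Matrix n
complement {n} X = scale (fromℕ n) (I n) ⊟ J n ⊟ X

module Cut {n : ℕ} (u : Fin n → ℝ) (u²≈1 : ∀ i → u i * u i ≈ 1ℝ) (∑u≈0 : sum u ≈ 0ℝ) where

  U : Matrix n
  U = rankOne u

  -- For signs `u` this is 0 within a cluster and 1 across. As ½ (`J` - `U`) it splits the objective
  -- into a pairing with `J` and one with `U`.
  cutMetric : Matrix n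
  cutMetric i j = fromℚ ½ * (1ℝ - u i * u j)

  -- No sign has to be decided: 1 + u i u j is half the square of u i + u j.
  0≤1+u*u : ∀ i j → 0ℝ ≤ 1ℝ + u i * u j
  0≤1+u*u i j = ≤-respʳ-≈ (begin
    fromℚ ½ * ((u i + u j) * (u i + u j))
      ≈⟨ solve 2 (λ a b → con ½ :* ((a :+ b) :* (a :+ b)) := con ½ :* (a :* a :+ b :* b) :+ a :* b)
          ≈-refl (u i) (u j) ⟩
    fromℚ ½ * (u i * u i + u j * u j) + u i * u j
      ≈⟨ +-congʳ (*-congˡ (+-cong (u²≈1 i) (u²≈1 j))) ⟩
    fromℚ ½ * (1ℝ + 1ℝ) + u i * u j
      ≈⟨ +-congʳ (≗⇒≈ λ _ → refl) ⟩
    1ℝ + u i * u j ∎) (0≤x*y 0≤½ (0≤x*x _))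

  0≤1-u*u : ∀ i j → 0ℝ ≤ 1ℝ - u i * u j
  0≤1-u*u i j = ≤-respʳ-≈ (begin
    fromℚ ½ * ((u i - u j) * (u i - u j))
      ≈⟨ solve 2 (λ a b → con ½ :* ((a :- b) :* (a :- b)) := con ½ :* (a :* a :+ b :* b) :- a :* b)
          ≈-refl (u i) (u j) ⟩
    fromℚ ½ * (u i * u i + u j * u j) - u i * u j
      ≈⟨ +-congʳ (*-congˡ (+-cong (u²≈1 i) (u²≈1 j))) ⟩
    fromℚ ½ * (1ℝ + 1ℝ) - u i * u j
      ≈⟨ +-congʳ (≗⇒≈ λ _ → refl) ⟩
    1ℝ - u i * u j ∎) (0≤x*y 0≤½ (0≤x*x _))

  0≤cutMetric : EntrywiseNonNegative cutMetric
  0≤cutMetric i j = 0≤x*y 0≤½ (0≤1-u*u i j)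

  cutMetric-diag : ∀ i → cutMetric i i ≈ 0ℝ
  cutMetric-diag i = begin
    fromℚ ½ * (1ℝ - u i * u i)  ≈⟨ *-congˡ (+-congˡ (-‿cong (u²≈1 i))) ⟩
    fromℚ ½ * (1ℝ - 1ℝ)         ≈⟨ ≗⇒≈ (λ _ → refl) ⟩
    0ℝ ∎

  cutMetric≤J-I : ∀ i j → cutMetric i j ≤ (J n ⊟ I n) i j
  cutMetric≤J-I i j with i Fin.≟ j
  ... | yes refl = ≈⇒≤ (≈-trans (cutMetric-diag i) (≗⇒≈ λ _ → refl))
  ... | no _     = 0≤y-x⇒x≤y (≤-respʳ-≈
    (solve 1 (λ w → con ½ :* (con 1ℚ :+ w) := (con 1ℚ :- con 0ℚ) :- con ½ :* (con 1ℚ :- w)) ≈-refl (u i * u j))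
    (0≤x*y 0≤½ (0≤1+u*u i j)))

  -- complement U is n times an orthogonal projection, so it is the sum of its
  -- columns' rank-one matrices up to the factor n.
  complement-square : (sumMatrix λ k → rankOne (λ i → complement U i k)) ≋ scale (fromℕ n) (complement U)
  complement-square i j = begin
    (sum λ k → (N * I n i k - 1ℝ - u i * u k) * (N * I n j k - 1ℝ - u j * u k))
      -- Grouped so that the terms with an identity factor collapse under `sum-I*` and the term
      -- linear in `u k` vanishes with `∑u≈0`.
      ≈⟨ (sum-cong λ k → ≈-trans (solve 6 (λ m a b x y z
          → (m :* a :- con 1ℚ :- x :* z) :* (m :* b :- con 1ℚ :- y :* z) :=
           ((a :* (m :* m :* b :- m :- m :* y :* z) :+ b :* (:- m :- m :* x :* z)) :+ (con 1ℚ :+ x :* y :* (z :* z))) :+ (x :+ y) :* z)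
           ≈-refl N (I n i k) (I n j k) (u i) (u j) (u k)) (+-congʳ (+-congˡ (+-congˡ (*-congˡ (u²≈1 k)))))) ⟩
    (sum λ k → ((I n i k * f k + I n j k * g k) + (1ℝ + u i * u j * 1ℝ)) + (u i + u j) * u k)
      ≈⟨ ≈-trans (∑-distrib-+ (λ k → (I n i k * f k + I n j k * g k) + (1ℝ + u i * u j * 1ℝ))
          (λ k → (u i + u j) * u k))
           (+-cong (≈-trans (∑-distrib-+ (λ k → I n i k * f k + I n j k * g k) (λ _ → 1ℝ + u i * u j * 1ℝ))
             (+-cong (∑-distrib-+ (λ k → I n i k * f k) (λ k → I n j k * g k)) (sum-const n _)))
             (≈-trans (≈-sym (*-distribˡ-sum (u i + u j) u)) (*-congˡ ∑u≈0))) ⟩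
    ((sum λ k → I n i k * f k) + (sum λ k → I n j k * g k)) + N * (1ℝ + u i * u j * 1ℝ) + (u i + u j) * 0ℝ
      ≈⟨ +-congʳ (+-congʳ (+-cong (sum-I* i f) (sum-I* j g))) ⟩
    (f i + g j) + N * (1ℝ + u i * u j * 1ℝ) + (u i + u j) * 0ℝ
      ≈⟨ +-congʳ (+-congʳ (+-congʳ (+-congʳ (+-congʳ (*-congˡ (I-sym j i)))))) ⟩
    ((N * N * I n i j - N - N * u j * u i) + g j) + N * (1ℝ + u i * u j * 1ℝ) + (u i + u j) * 0ℝ
      ≈⟨ solve 4 (λ m a x y
          → ((m :* m :* a :- m :- m :* y :* x) :+ (:- m :- m :* x :* y)) :+ m :* (con 1ℚ :+ x :* y :* con 1ℚ) :+ (x :+ y) :* con 0ℚ :=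
           m :* (m :* a :- con 1ℚ :- x :* y)) ≈-refl N (I n i j) (u i) (u j) ⟩
    N * (N * I n i j - 1ℝ - u i * u j) ∎
    where
    N : ℝ
    N = fromℕ n
    f g : Fin n → ℝ
    f k = N * N * I n j k - N - N * u j * u k
    g k = - N - N * u i * u k

-- Lower bound: the dual argument for an arbitrary feasible matrix

module LowerBound {n : ℕ} .{{_ : ℕ.NonZero n}} (3≤n : 3 ℕ.≤ n) (root : RootOfUnity n)
  (u : Fin n → ℝ) (u²≈1 : ∀ i → u i * u i ≈ 1ℝ) (∑u≈0 : sum u ≈ 0ℝ)
  (Y : Matrix (n ℕ.* n)) (feasible : Feasible₁ n Y) where
  open RootOfUnity root
  open Fourier 3≤n root
  open Cut u u²≈1 ∑u≈0
  open Feasible₁ feasible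

  private
    -- Bilinear, and nonnegative on two entrywise nonnegative matrices (`0≤pair`) as well as on two
    -- rank-one squares (`0≤pair-rankOne`): positivity of `Y` enters in these two ways only.
    pair : Matrix n → Matrix n → ℝ
    pair A B = trace ((A ⊗ B) · Y)

    P : Fin (n ℕ.* n) → Fin n
    P = quotient n
    R : Fin (n ℕ.* n) → Fin n
    R = remainder {n} n

  0≤pair : ∀ {A B} → EntrywiseNonNegative A → EntrywiseNonNegative B → 0ℝ ≤ pair A B
  0≤pair p q = 0≤trace (λ i j → 0≤x*y (p (P i) (P j)) (q (R i) (R j))) nonNegative

  pair-congˡ : ∀ {A A′} B → A ≋ A′ → pair A B ≈ pair A′ B
  pair-congˡ B p = trace-cong λ i j → *-congʳ (p (P i) (P j))

  pair-congʳ : ∀ A {B B′} → B ≋ B′ → pair A B ≈ pair A B′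
  pair-congʳ A p = trace-cong λ i j → *-congˡ (p (R i) (R j))

  pair-⊟ˡ : ∀ A A′ B → pair (A ⊟ A′) B ≈ pair A B - pair A′ B
  pair-⊟ˡ A A′ B = ≈-trans (trace-cong λ i j →
      solve 3 (λ a b c → (a :- b) :* c := a :* c :- b :* c) ≈-refl (A (P i) (P j)) (A′ (P i) (P j)) (B (R i) (R j)))
    (trace-⊟ (A ⊗ B) (A′ ⊗ B) Y)

  pair-⊟ʳ : ∀ A B B′ → pair A (B ⊟ B′) ≈ pair A B - pair A B′
  pair-⊟ʳ A B B′ = ≈-trans (trace-cong λ i j →
      solve 3 (λ a b c → a :* (b :- c) := a :* b :- a :* c) ≈-refl (A (P i) (P j)) (B (R i) (R j)) (B′ (R i) (R j)))
    (trace-⊟ (A ⊗ B) (A ⊗ B′) Y)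

  pair-scaleˡ : ∀ x A B → pair (scale x A) B ≈ x * pair A B
  pair-scaleˡ x A B = ≈-trans (trace-cong λ i j →
      solve 3 (λ x a b → (x :* a) :* b := x :* (a :* b)) ≈-refl x (A (P i) (P j)) (B (R i) (R j)))
    (trace-scale x (A ⊗ B) Y)

  pair-scaleʳ : ∀ x A B → pair A (scale x B) ≈ x * pair A B
  pair-scaleʳ x A B = ≈-trans (trace-cong λ i j →
      solve 3 (λ x a b → a :* (x :* b) := x :* (a :* b)) ≈-refl x (A (P i) (P j)) (B (R i) (R j)))
    (trace-scale x (A ⊗ B) Y)

  pair-sumˡ : ∀ {k} (A : Fin k → Matrix n) B → pair (sumMatrix A) B ≈ sum λ r → pair (A r) B
  pair-sumˡ A B = ≈-trans (trace-cong λ i j → *-distribʳ-sum (B (R i) (R j)) (λ r → A r (P i) (P j)))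
    (trace-sum (λ r → A r ⊗ B) Y)

  pair-sumʳ : ∀ {k} A (B : Fin k → Matrix n) → pair A (sumMatrix B) ≈ sum λ r → pair A (B r)
  pair-sumʳ A B = ≈-trans (trace-cong λ i j → *-distribˡ-sum (A (P i) (P j)) (λ r → B r (R i) (R j)))
    (trace-sum (λ r → A ⊗ B r) Y)

  0≤pair-rankOne : ∀ v w → 0ℝ ≤ pair (rankOne v) (rankOne w)
  0≤pair-rankOne v w = ≤-respʳ-≈
    (trace-cong λ i j → solve 4 (λ a b c d → (a :* b) :* (c :* d) := (a :* c) :* (b :* d)) ≈-refl
      (v (P i)) (w (R i)) (v (P j)) (w (R j)))
    (0≤trace-rankOne (λ i → v (P i) * w (R i)) psd)

  0≤pair-F : ∀ v j → 0ℝ ≤ pair (rankOne v) (F j)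
  0≤pair-F v j = ≤-respʳ-≈
    (≈-sym (≈-trans
      (trace-cong λ p q → solve 3 (λ a b c → a :* (b :+ c) := a :* b :+ a :* c) ≈-refl
        (rankOne v (P p) (P q)) (rankOne (C j) (R p) (R q)) (rankOne (S j) (R p) (R q)))
      (trace-⊞ (rankOne v ⊗ rankOne (C j)) (rankOne v ⊗ rankOne (S j)) Y)))
    (0≤x+y (0≤pair-rankOne v (C j)) (0≤pair-rankOne v (S j)))

  off-sum : pair (I n) (J n ⊟ I n) + pair (J n ⊟ I n) (I n) ≈ 0ℝ
  off-sum = ≈-trans (≈-sym (trace-⊞ (I n ⊗ (J n ⊟ I n)) ((J n ⊟ I n) ⊗ I n) Y)) trace-off

  -- Constraint (iii) is a vanishing sum of two nonnegative pairings, so each of them vanishes.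
  pair-I-[J-I] : pair (I n) (J n ⊟ I n) ≈ 0ℝ
  pair-I-[J-I] = x+y≈0⇒x≈0 (0≤pair 0≤I 0≤J-I) (0≤pair 0≤J-I 0≤I) off-sum

  pair-[J-I]-I : pair (J n ⊟ I n) (I n) ≈ 0ℝ
  pair-[J-I]-I = x+y≈0⇒x≈0 (0≤pair 0≤J-I 0≤I) (0≤pair 0≤I 0≤J-I) (≈-trans (+-comm _ _) off-sum)

  -- The identity is the sum of the `E n k`, so the n constraints `trace-I⊗E` add up.
  pair-I-I : pair (I n) (I n) ≈ N
  pair-I-I = begin
    pair (I n) (I n)                     ≈⟨ pair-congʳ (I n) (λ i j → sum-I* i (λ k → I n k j)) ⟨
    pair (I n) (sumMatrix (E n))         ≈⟨ pair-sumʳ (I n) (E n) ⟩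
    (sum λ k → pair (I n) (E n k))       ≈⟨ (sum-cong λ k → trace-I⊗E k) ⟩
    (sum {n} λ _ → 1ℝ)                   ≈⟨ sum-const n 1ℝ ⟩
    N * 1ℝ                               ≈⟨ *-identityʳ N ⟩
    N ∎

  pair-J-I : pair (J n) (I n) ≈ N
  pair-J-I = ≈-trans (x-y≈0⇒x≈y (≈-trans (≈-sym (pair-⊟ˡ (J n) (I n) (I n))) pair-[J-I]-I)) pair-I-I

  pair-I-J : pair (I n) (J n) ≈ N
  pair-I-J = ≈-trans (x-y≈0⇒x≈y (≈-trans (≈-sym (pair-⊟ʳ (I n) (J n) (I n))) pair-I-[J-I])) pair-I-I

  pair-J-J : pair (J n) (J n) ≈ N * N
  pair-J-J = ≈-trans (trace-cong {A = J n ⊗ J n} {J (n ℕ.* n)} {Y} λ _ _ → *-identityˡ 1ℝ)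
      (≈-trans trace-J (fromℕ-* n n))

  -- Squeezed between 0 and the vanishing `pair (J n ⊟ I n) (I n)`: distances are at most 1 and
  -- vanish on the diagonal.
  pair-cut-I : pair cutMetric (I n) ≈ 0ℝ
  pair-cut-I = ≤-antisym
    (0≤y-x⇒x≤y (≤-respʳ-≈ (≈-trans (pair-⊟ˡ (J n ⊟ I n) cutMetric (I n)) (+-congʳ pair-[J-I]-I))
      (0≤pair (λ i j → x≤y⇒0≤y-x (cutMetric≤J-I i j)) 0≤I)))
    (0≤pair 0≤cutMetric 0≤I)

  pair-cut : ∀ B → pair cutMetric B ≈ fromℚ ½ * (pair (J n) B - pair U B)
  pair-cut B = ≈-trans (pair-scaleˡ (fromℚ ½) (J n ⊟ U) B) (*-congˡ (pair-⊟ˡ (J n) U B))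

  pair-U-I : pair U (I n) ≈ N
  pair-U-I = begin
    pair U (I n)
      ≈⟨ solve 2 (λ a b → b := a :- (con ½ :* (a :- b) :+ con ½ :* (a :- b)))
          ≈-refl (pair (J n) (I n)) (pair U (I n)) ⟩
    pair (J n) (I n) - (fromℚ ½ * (pair (J n) (I n) - pair U (I n)) + fromℚ ½ * (pair (J n) (I n) - pair U (I n)))
      ≈⟨ +-cong pair-J-I (-‿cong (+-cong (≈-trans (≈-sym (pair-cut (I n))) pair-cut-I)
          (≈-trans (≈-sym (pair-cut (I n))) pair-cut-I))) ⟩
    N - (0ℝ + 0ℝ)
      ≈⟨ solve 1 (λ m → m :- (con 0ℚ :+ con 0ℚ) := m) ≈-refl N ⟩
    N ∎

  -- `complement U` is semidefinite, so its pairing with `J n`, a rank-one square, is nonnegative.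
  -- In it the parts from the identity and from `J n` cancel, both being N², and minus the pairing
  -- of `U` remains.
  pair-U-J≤0 : pair U (J n) ≤ 0ℝ
  pair-U-J≤0 = 0≤y-x⇒x≤y (≤-respʳ-≈ (begin
    pair (complement U) (J n)
      ≈⟨ ≈-trans (pair-⊟ˡ (scale N (I n) ⊟ J n) U (J n))
          (+-congʳ (≈-trans (pair-⊟ˡ (scale N (I n)) (J n) (J n)) (+-congʳ (pair-scaleˡ N (I n) (J n))))) ⟩
    (N * pair (I n) (J n) - pair (J n) (J n)) - pair U (J n)
      ≈⟨ +-congʳ (+-cong (*-congˡ pair-I-J) (-‿cong pair-J-J)) ⟩
    (N * N - N * N) - pair U (J n)
      ≈⟨ solve 2 (λ m z → (m :* m :- m :* m) :- z := con 0ℚ :- z) ≈-refl N (pair U (J n)) ⟩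
    0ℝ - pair U (J n) ∎)
    (0≤x*y⇒0≤y 0<N (≤-respʳ-≈ (begin
      (sum λ k → pair (rankOne (λ i → complement U i k)) (J n))
        ≈⟨ pair-sumˡ (λ k → rankOne (λ i → complement U i k)) (J n) ⟨
      pair (sumMatrix λ k → rankOne (λ i → complement U i k)) (J n)
        ≈⟨ ≈-trans (pair-congˡ (J n) complement-square) (pair-scaleˡ N (complement U) (J n)) ⟩
      N * pair (complement U) (J n) ∎)
      (0≤sum λ k → ≤-respʳ-≈ (pair-congʳ (rankOne (λ i → complement U i k)) F-i₀)
          (0≤pair-F (λ i → complement U i k) i₀)))))

  -- Weights affine in the cosine are those that `∑F` and `∑cos*F` can sum; both estimates below are
  -- instances with suitable α and β.
  weighted : ∀ α β A → (sum λ j → (α + β * cos (toℕ j)) * pair A (F j)) ≈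
    α * (N * pair A (I n)) + β * (fromℚ ½ * N * pair A (C₁ n))
  weighted α β A = begin
    (sum λ j → (α + β * cos (toℕ j)) * pair A (F j))
      ≈⟨ (sum-cong λ (j : Fin n) → solve 4 (λ a b c x → (a :+ b :* c) :* x := a :* x :+ b :* (c :* x))
          ≈-refl α β (cos (toℕ j)) (pair A (F j))) ⟩
    (sum λ j → α * pair A (F j) + β * (cos (toℕ j) * pair A (F j)))
      ≈⟨ ∑-distrib-+ (λ j → α * pair A (F j)) (λ j → β * (cos (toℕ j) * pair A (F j))) ⟩
    (sum λ j → α * pair A (F j)) + (sum λ j → β * (cos (toℕ j) * pair A (F j)))
      ≈⟨ +-cong (*-distribˡ-sum α (λ j → pair A (F j))) (*-distribˡ-sum β (λ j → cos (toℕ j) * pair A (F j))) ⟨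
    α * (sum λ j → pair A (F j)) + β * (sum λ j → cos (toℕ j) * pair A (F j))
      ≈⟨ +-cong
        (*-congˡ (≈-trans (≈-sym (pair-sumʳ A F)) (≈-trans (pair-congʳ A ∑F) (pair-scaleʳ N A (I n)))))
        (*-congˡ (≈-trans (sum-cong λ (j : Fin n) → ≈-sym (pair-scaleʳ (cos (toℕ j)) A (F j)))
          (≈-trans (≈-sym (pair-sumʳ A (λ j → scale (cos (toℕ j)) (F j))))
            (≈-trans (pair-congʳ A ∑cos*F) (pair-scaleʳ (fromℚ ½ * N) A (C₁ n)))))) ⟩
    α * (N * pair A (I n)) + β * (fromℚ ½ * N * pair A (C₁ n)) ∎

  0≤1+cos : ∀ j → 0ℝ ≤ 1ℝ + cos j
  0≤1+cos j = ≤-respʳ-≈ (begin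
    fromℚ ½ * ((cos j + 1ℝ) * (cos j + 1ℝ) + sin j * sin j)
      ≈⟨ solve 2 (λ c s → con ½ :* ((c :+ con 1ℚ) :* (c :+ con 1ℚ) :+ s :* s) :=
          con ½ :* (c :* c :+ s :* s) :+ con ½ :+ c) ≈-refl (cos j) (sin j) ⟩
    fromℚ ½ * (cos j * cos j + sin j * sin j) + fromℚ ½ + cos j
      ≈⟨ +-congʳ (+-congʳ (*-congˡ (cos²+sin² j))) ⟩
    fromℚ ½ * 1ℝ + fromℚ ½ + cos j
      ≈⟨ solve 1 (λ c → con ½ :* con 1ℚ :+ con ½ :+ c := con 1ℚ :+ c) ≈-refl (cos j) ⟩
    1ℝ + cos j ∎) (0≤x*y 0≤½ (0≤x+y (0≤x*x _) (0≤x*x _)))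

  cos-i₀ : cos (toℕ i₀) ≈ 1ℝ
  cos-i₀ = ≈-trans (≡⇒≈ (cong cos toℕ-i₀)) cos-0

  J≋rankOne : rankOne (λ _ → 1ℝ) ≋ J n
  J≋rankOne _ _ = *-identityˡ 1ℝ

  -- With weights 1 + `cos` j no term is negative. The term at frequency 0 is 2 N², while the whole
  -- sum is N² plus the pairing to be bounded.
  N²≤½N*pair-J-C₁ : N * N ≤ fromℚ ½ * N * pair (J n) (C₁ n)
  N²≤½N*pair-J-C₁ = 0≤y-x⇒x≤y (≤-respʳ-≈ (begin
    (1ℝ * (N * pair (J n) (I n)) + 1ℝ * (fromℚ ½ * N * pair (J n)
        (C₁ n))) - (1ℝ + 1ℝ * cos (toℕ i₀)) * pair (J n) (F i₀)
      ≈⟨ +-cong (+-congʳ (*-congˡ (*-congˡ pair-J-I)))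
           (-‿cong (*-cong (+-congˡ (*-congˡ cos-i₀)) (≈-trans (pair-congʳ (J n) F-i₀) pair-J-J))) ⟩
    (1ℝ * (N * N) + 1ℝ * (fromℚ ½ * N * pair (J n) (C₁ n))) - (1ℝ + 1ℝ * 1ℝ) * (N * N)
      ≈⟨ solve 2 (λ m x → (con 1ℚ :* (m :* m) :+ con 1ℚ :* (con ½ :* m :* x)) :- (con 1ℚ :+ con 1ℚ :* con 1ℚ) :* (m :* m) := con ½ :* m :* x :- m :* m) ≈-refl N (pair (J n) (C₁ n)) ⟩
    fromℚ ½ * N * pair (J n) (C₁ n) - N * N ∎)
    (x≤y⇒0≤y-x (≤-respʳ-≈ (weighted 1ℝ 1ℝ (J n))
      (term≤sum i₀ (λ j → (1ℝ + 1ℝ * cos (toℕ j)) * pair (J n) (F j)) λ j _ → 0≤x*y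
        (≤-respʳ-≈ (+-congˡ (≈-sym (*-identityˡ _))) (0≤1+cos (toℕ j)))
        (≤-respʳ-≈ (pair-congˡ (F j) J≋rankOne) (0≤pair-F (λ _ → 1ℝ) j))))))

  -- The weights are `cos` 1 - `cos` j, nonnegative for j ≠ 0. At j = 0 the weight is negative, and
  -- `pair-U-J≤0` makes the product nonnegative again.
  ½N*pair-U-C₁≤N²cos : fromℚ ½ * N * pair U (C₁ n) ≤ cos 1 * (N * N)
  ½N*pair-U-C₁≤N²cos = 0≤y-x⇒x≤y (≤-respʳ-≈ (begin
    (cos 1 * (N * pair U (I n)) + - 1ℝ * (fromℚ ½ * N * pair U (C₁ n)))
      ≈⟨ +-congʳ (*-congˡ (*-congˡ pair-U-I)) ⟩
    (cos 1 * (N * N) + - 1ℝ * (fromℚ ½ * N * pair U (C₁ n)))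
      ≈⟨ solve 3 (λ c m x → c :* (m :* m) :+ (:- con 1ℚ) :* (con ½ :* m :* x) :=
          c :* (m :* m) :- con ½ :* m :* x) ≈-refl (cos 1) N (pair U (C₁ n)) ⟩
    cos 1 * (N * N) - fromℚ ½ * N * pair U (C₁ n) ∎)
    (≤-respʳ-≈ (weighted (cos 1) (- 1ℝ) U) (≤-trans 0≤i₀-term
      (term≤sum i₀ (λ j → (cos 1 + - 1ℝ * cos (toℕ j)) * pair U (F j)) λ j j≢i₀ → 0≤x*y
        (≤-respʳ-≈ (solve 2 (λ c x → c :- x := c :+ (:- con 1ℚ) :* x) ≈-refl (cos 1) (cos (toℕ j)))
          (x≤y⇒0≤y-x (cos≤cos-1 (toℕ j) (1≤j j j≢i₀) (Fin.toℕ<n j))))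
        (0≤pair-F u j)))))
    where
    1≤j : ∀ j → j ≢ i₀ → 1 ℕ.≤ toℕ j
    1≤j j j≢i₀ = ℕ.n≢0⇒n>0 λ eq → j≢i₀ (Fin.toℕ-injective (≡.trans eq (≡.sym toℕ-i₀)))
    0≤i₀-term : 0ℝ ≤ (cos 1 + - 1ℝ * cos (toℕ i₀)) * pair U (F i₀)
    0≤i₀-term = ≤-respʳ-≈ (begin
      (1ℝ - cos 1) * (0ℝ - pair U (J n))
        ≈⟨ solve 2 (λ c x → (con 1ℚ :- c) :* (con 0ℚ :- x) := (c :+ (:- con 1ℚ) :* con 1ℚ) :* x)
            ≈-refl (cos 1) (pair U (J n)) ⟩
      (cos 1 + - 1ℝ * 1ℝ) * pair U (J n)
        ≈⟨ *-cong (+-congˡ (*-congˡ cos-i₀)) (pair-congʳ U F-i₀) ⟨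
      (cos 1 + - 1ℝ * cos (toℕ i₀)) * pair U (F i₀) ∎)
      (0≤x*y (0<⇒0≤ cos-1<1) (x≤y⇒0≤y-x pair-U-J≤0))

  -- Half the sum of the slacks in the two preceding estimates is N times the slack wanted here.
  lowerBound : fromℚ ½ * N * (1ℝ - cos 1) ≤ objective₁ cutMetric Y
  lowerBound = 0≤y-x⇒x≤y (0≤x*y⇒0≤y 0<N (≤-respʳ-≈ (begin
    fromℚ ½ * ((fromℚ ½ * N * pair (J n) (C₁ n) - N * N) + (cos 1 * (N * N) - fromℚ ½ * N * pair U (C₁ n)))
      ≈⟨ solve 4 (λ m c x y → con ½ :* ((con ½ :* m :* x :- m :* m) :+ (c :* (m :* m) :- con ½ :* m :* y)) :=
           m :* (con ½ :* (con ½ :* (x :- y)) :- con ½ :* m :* (con 1ℚ :- c)))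
               ≈-refl N (cos 1) (pair (J n) (C₁ n)) (pair U (C₁ n)) ⟩
    N * (fromℚ ½ * (fromℚ ½ * (pair (J n) (C₁ n) - pair U (C₁ n))) - fromℚ ½ * N * (1ℝ - cos 1))
      ≈⟨ *-congˡ (+-congʳ (*-congˡ (pair-cut (C₁ n)))) ⟨
    N * (objective₁ cutMetric Y - fromℚ ½ * N * (1ℝ - cos 1)) ∎)
    (0≤x*y 0≤½ (0≤x+y (x≤y⇒0≤y-x N²≤½N*pair-J-C₁) (x≤y⇒0≤y-x ½N*pair-U-C₁≤N²cos)))))

-- Traces for testing the optimal matrix

I-cases : ∀ {n} (i j : Fin n) → (i ≡ j × I n i j ≈ 1ℝ) ⊎ I n i j ≈ 0ℝ
I-cases i j with i Fin.≟ j
... | yes i≡j = inj₁ (i≡j , ≈-refl)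
... | no _    = inj₂ ≈-refl

trace-C₁· : ∀ {n} .{{_ : ℕ.NonZero n}} → 3 ℕ.≤ n → (A : Matrix n) →
  trace (C₁ n · A) ≈ sum (λ p → A (next p) p) + sum (λ p → A p (next p))
trace-C₁· {n} 3≤n A = begin
  (sum λ p → sum λ q → C₁ n p q * A q p)
    ≈⟨ (sum-cong λ (p : Fin n) → sum-cong λ (q : Fin n) → ≈-trans (*-congʳ (≈-trans (C₁≈I+I 3≤n p q)
        (+-congʳ (I-sym q (next p)))))
         (solve 3 (λ a b c → (a :+ b) :* c := a :* c :+ b :* c) ≈-refl (I n (next p) q) (I n p (next q)) (A q p))) ⟩
  (sum λ p → sum λ q → I n (next p) q * A q p + I n p (next q) * A q p)
    ≈⟨ ≈-trans (sum-cong λ (p : Fin n) → ∑-distrib-+ (λ q → I n (next p) q * A q p) (λ q → I n p (next q) * A q p))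
         (∑-distrib-+ (λ (p : Fin n) → sum λ q → I n (next p) q * A q p) (λ p → sum λ q → I n p (next q) * A q p)) ⟩
  (sum λ p → sum λ q → I n (next p) q * A q p) + (sum λ p → sum λ q → I n p (next q) * A q p)
    ≈⟨ +-cong (sum-cong λ (p : Fin n) → sum-I* (next p) (λ q → A q p))
         (≈-trans (∑-comm (λ (p : Fin n) (q : Fin n) → I n p (next q) * A q p))
           (sum-cong λ (q : Fin n) → ≈-trans (sum-cong λ (p : Fin n) → *-congʳ (I-sym p (next q)))
               (sum-I* (next q) (A q)))) ⟩
  sum (λ p → A (next p) p) + sum (λ p → A p (next p)) ∎

sum-≈const : ∀ {n} {f : Fin n → ℝ} {x} → (∀ i → f i ≈ x) → sum f ≈ fromℕ n * x
sum-≈const {n} {f} {x} p = ≈-trans (sum-cong p) (sum-const n x)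

module _ {n : ℕ} where
  private N = fromℕ n

  trace-J≈ : trace (J n) ≈ N
  trace-J≈ = ≈-trans (sum-const n 1ℝ) (*-identityʳ N)

  trace-J·J : trace (J n · J n) ≈ N * N
  trace-J·J = ≈-trans (sum-≈const {n} λ i → sum-≈const {n} λ j → *-identityˡ 1ℝ) (*-congˡ (*-identityʳ N))

  trace-I·J : trace (I n · J n) ≈ N
  trace-I·J = ≈-trans (trace-I· (J n)) trace-J≈

  trace-·complement : (A X : Matrix n) →
    trace (A · complement X) ≈ N * trace A - trace (A · J n) - trace (A · X)
  trace-·complement A X = begin
    trace (A · complement X)
      ≈⟨ trace-comm A (complement X) ⟩
    trace (complement X · A)
      ≈⟨ ≈-trans (trace-⊟ (scale N (I n) ⊟ J n) X A) (+-congʳ (≈-trans (trace-⊟ (scale N (I n)) (J n) A)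
          (+-congʳ (trace-scale N (I n) A)))) ⟩
    N * trace (I n · A) - trace (J n · A) - trace (X · A)
      ≈⟨ +-cong (+-cong (*-congˡ (trace-I· A)) (-‿cong (trace-comm (J n) A))) (-‿cong (trace-comm X A)) ⟩
    N * trace A - trace (A · J n) - trace (A · X) ∎

  -- What `U` and `Γ` share. It determines how `X` and its complement pair with `I n`, `J n` and
  -- `E n k`, hence the value of every trace constraint.
  record Balanced (X : Matrix n) : Set where
    field
      diag  : ∀ i → X i i ≈ 1ℝ
      total : trace (J n · X) ≈ 0ℝ

    trace-I·X : trace (I n · X) ≈ N
    trace-I·X = ≈-trans (trace-I· X) (≈-trans (sum-≈const diag) (*-identityʳ N))

    trace-I·complement : trace (I n · complement X) ≈ N * N - N - N
    trace-I·complement = ≈-trans (trace-·complement (I n) X) (+-cong (+-cong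
      (*-congˡ (≈-trans (sum-≈const (I-diag {n})) (*-identityʳ N)))
      (-‿cong trace-I·J)) (-‿cong trace-I·X))

    trace-J·complement : trace (J n · complement X) ≈ 0ℝ
    trace-J·complement = ≈-trans (trace-·complement (J n) X) (≈-trans
      (+-cong (+-cong (*-congˡ trace-J≈) (-‿cong trace-J·J)) (-‿cong total))
      (solve 1 (λ m → m :* m :- m :* m :- con 0ℚ := con 0ℚ) ≈-refl N))

    trace-E·X : ∀ k → trace (E n k · X) ≈ 1ℝ
    trace-E·X k = ≈-trans (trace-E· k X) (diag k)

    trace-E·complement : ∀ k → trace (E n k · complement X) ≈ N - 1ℝ - 1ℝ
    trace-E·complement k = ≈-trans (trace-E· k (complement X))
      (+-cong (+-congʳ (≈-trans (*-congˡ (I-diag k)) (*-identityʳ N))) (-‿cong (diag k)))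

-- The symmetrized optimum: vertices at distance k along the tour are in the same
-- cluster with weight proportional to 1 + cos (2πk/n), in different clusters with
-- weight proportional to 1 - cos (2πk/n).
module UpperBound {n : ℕ} .{{_ : ℕ.NonZero n}} (3≤n : 3 ℕ.≤ n) (root : RootOfUnity n)
  (u : Fin n → ℝ) (u²≈1 : ∀ i → u i * u i ≈ 1ℝ) (∑u≈0 : sum u ≈ 0ℝ) where
  open RootOfUnity root
  open Fourier 3≤n root
  open Cut u u²≈1 ∑u≈0

  -- N - 2 is forced: where exactly one of the two index pairs is diagonal, the complement block has
  -- the entry -(N - 2) (1 + g), with g the off-diagonal entry of the other factor, and `M` (1 + g)
  -- must cancel it.
  M : ℝ
  M = N - 1ℝ - 1ℝ

  private
    instance
      n∸2-nonZero : ℕ.NonZero (n ℕ.∸ 2)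
      n∸2-nonZero = ℕ.>-nonZero (ℕ.m<n⇒0<n∸m 3≤n)

  M≈fromℕ : M ≈ fromℕ (n ℕ.∸ 2)
  M≈fromℕ = begin
    N - 1ℝ - 1ℝ
      ≡⟨ cong (λ m → fromℕ m - 1ℝ - 1ℝ) (ℕ.m+[n∸m]≡n (ℕ.<⇒≤ 3≤n)) ⟨
    fromℕ (2 ℕ.+ (n ℕ.∸ 2)) - 1ℝ - 1ℝ
      ≈⟨ +-congʳ (+-congʳ (≈-trans (fromℕ-suc (suc (n ℕ.∸ 2))) (+-congˡ (fromℕ-suc (n ℕ.∸ 2))))) ⟩
    1ℝ + (1ℝ + fromℕ (n ℕ.∸ 2)) - 1ℝ - 1ℝ
      ≈⟨ solve 1 (λ m → con 1ℚ :+ (con 1ℚ :+ m) :- con 1ℚ :- con 1ℚ := m) ≈-refl (fromℕ (n ℕ.∸ 2)) ⟩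
    fromℕ (n ℕ.∸ 2) ∎

  0≤M : 0ℝ ≤ M
  0≤M = ≤-respʳ-≈ (≈-sym M≈fromℕ) (0≤fromℕ (n ℕ.∸ 2))

  -- `κ` is 1 / (N² (N - 2)), fixed by the total N² of `Y`: only `J n ⊗ J n` contributes to it, with
  -- κ M N⁴.
  N⁻¹ M⁻¹ κ : ℝ
  N⁻¹ = proj₁ (reciprocal n)
  M⁻¹ = proj₁ (reciprocal (n ℕ.∸ 2))
  κ   = N⁻¹ * N⁻¹ * M⁻¹

  0≤N⁻¹ : 0ℝ ≤ N⁻¹
  0≤N⁻¹ = proj₁ (proj₂ (reciprocal n))

  N⁻¹*N≈1 : N⁻¹ * N ≈ 1ℝ
  N⁻¹*N≈1 = proj₂ (proj₂ (reciprocal n))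

  0≤κ : 0ℝ ≤ κ
  0≤κ = 0≤x*y (0≤x*y 0≤N⁻¹ 0≤N⁻¹) (proj₁ (proj₂ (reciprocal (n ℕ.∸ 2))))

  κ*N*N*M≈1 : κ * (N * N * M) ≈ 1ℝ
  κ*N*N*M≈1 = begin
    N⁻¹ * N⁻¹ * M⁻¹ * (N * N * M)
      ≈⟨ solve 4 (λ a b m l → a :* a :* b :* (m :* m :* l) := (a :* m) :* (a :* m) :* (b :* l)) ≈-refl N⁻¹ M⁻¹ N M ⟩
    (N⁻¹ * N) * (N⁻¹ * N) * (M⁻¹ * M)
      ≈⟨ *-cong (*-cong N⁻¹*N≈1 N⁻¹*N≈1) (≈-trans (*-congˡ M≈fromℕ) (proj₂ (proj₂ (reciprocal (n ℕ.∸ 2))))) ⟩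
    1ℝ * 1ℝ * 1ℝ
      ≈⟨ ≗⇒≈ (λ _ → refl) ⟩
    1ℝ ∎

  κNNM*x≈x : ∀ x → κ * (N * N * M) * x ≈ x
  κNNM*x≈x x = ≈-trans (*-congʳ κ*N*N*M≈1) (*-identityˡ x)

  -- One block per direction on the vertex side: the constant vector with index 0, `u` with index 1,
  -- the orthogonal complement of both with all other indices. Each block is semidefinite by itself.
  Y : Matrix (n ℕ.* n)
  Y = scale κ ((complement U ⊗ complement Γ) ⊞ scale M ((J n ⊗ J n) ⊞ (U ⊗ Γ)))

  U-balanced : Balanced U
  U-balanced = record { diag = u²≈1 ; total = begin
    (sum λ i → sum λ j → 1ℝ * (u j * u i))
      ≈⟨ (sum-cong λ i → sum-cong λ j → solve 2 (λ a b → con 1ℚ :* (a :* b) := b :* a) ≈-refl (u j) (u i)) ⟩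
    (sum λ i → sum λ j → u i * u j)      ≈⟨ sum-*-sum u u ⟩
    sum u * sum u                        ≈⟨ *-congʳ ∑u≈0 ⟩
    0ℝ * sum u                           ≈⟨ zeroˡ (sum u) ⟩
    0ℝ ∎ }

  Γ-balanced : Balanced Γ
  Γ-balanced = record { diag = F-diag i₁ ; total = ∑Γ }

  private
    module U = Balanced U-balanced
    module Γ = Balanced Γ-balanced

    P : Fin (n ℕ.* n) → Fin n
    P = quotient n
    R : Fin (n ℕ.* n) → Fin n
    R = remainder {n} n

  -- Once the six small traces are known, each constraint becomes a polynomial identity in N.
  trace-·Y : ∀ A B → trace ((A ⊗ B) · Y) ≈
    κ * (trace (A · complement U) * trace (B · complement Γ) +
         M * (trace (A · J n) * trace (B · J n) + trace (A · U) * trace (B · Γ)))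
  trace-·Y A B = begin
    trace ((A ⊗ B) · Y)
      ≈⟨ trace-comm (A ⊗ B) Y ⟩
    trace (Y · (A ⊗ B))
      ≈⟨ ≈-trans (trace-scale κ _ (A ⊗ B)) (*-congˡ (≈-trans (trace-⊞ (complement U ⊗ complement Γ) _ (A ⊗ B))
           (+-congˡ (≈-trans (trace-scale M _ (A ⊗ B)) (*-congˡ (trace-⊞ (J n ⊗ J n) (U ⊗ Γ) (A ⊗ B))))))) ⟩
    κ * (trace ((complement U ⊗ complement Γ) · (A ⊗ B)) + M * (trace ((J n ⊗ J n) · (A ⊗ B)) + trace ((U ⊗ Γ) · (A ⊗ B))))
      ≈⟨ *-congˡ (+-cong (swap (complement U) (complement Γ)) (*-congˡ (+-cong (swap (J n) (J n)) (swap U Γ)))) ⟩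
    κ * (trace (A · complement U) * trace (B · complement Γ) +
         M * (trace (A · J n) * trace (B · J n) + trace (A · U) * trace (B · Γ))) ∎
    where
    swap : ∀ X Z → trace ((X ⊗ Z) · (A ⊗ B)) ≈ trace (A · X) * trace (B · Z)
    swap X Z = ≈-trans (trace-comm (X ⊗ Z) (A ⊗ B)) (trace-⊗·⊗ A X B Z)

  pair-I-I : trace ((I n ⊗ I n) · Y) ≈ N
  pair-I-I = begin
    trace ((I n ⊗ I n) · Y)
      ≈⟨ trace-·Y (I n) (I n) ⟩
    _
      ≈⟨ *-congˡ (+-cong (*-cong U.trace-I·complement Γ.trace-I·complement)
           (*-congˡ (+-cong (*-cong (trace-I·J {n}) (trace-I·J {n})) (*-cong U.trace-I·X Γ.trace-I·X)))) ⟩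
    κ * ((N * N - N - N) * (N * N - N - N) + M * (N * N + N * N))
      ≈⟨ solve 2 (λ k m → k :* ((m :* m :- m :- m) :* (m :* m :- m :- m) :+ (m :- con 1ℚ :- con 1ℚ) :* (m :* m :+ m :* m)) :=
           k :* (m :* m :* (m :- con 1ℚ :- con 1ℚ)) :* m) ≈-refl κ N ⟩
    κ * (N * N * M) * N
      ≈⟨ κNNM*x≈x N ⟩
    N ∎

  pair-I-J : trace ((I n ⊗ J n) · Y) ≈ N
  pair-I-J = begin
    trace ((I n ⊗ J n) · Y)
      ≈⟨ trace-·Y (I n) (J n) ⟩
    _
      ≈⟨ *-congˡ (+-cong (*-cong U.trace-I·complement Γ.trace-J·complement)
           (*-congˡ (+-cong (*-cong (trace-I·J {n}) (trace-J·J {n})) (*-cong U.trace-I·X Γ.total)))) ⟩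
    κ * ((N * N - N - N) * 0ℝ + M * (N * (N * N) + N * 0ℝ))
      ≈⟨ solve 2 (λ k m → k :* ((m :* m :- m :- m) :* con 0ℚ :+ (m :- con 1ℚ :- con 1ℚ) :* (m :* (m :* m) :+ m :* con 0ℚ)) :=
           k :* (m :* m :* (m :- con 1ℚ :- con 1ℚ)) :* m) ≈-refl κ N ⟩
    κ * (N * N * M) * N
      ≈⟨ κNNM*x≈x N ⟩
    N ∎

  pair-J-I : trace ((J n ⊗ I n) · Y) ≈ N
  pair-J-I = begin
    trace ((J n ⊗ I n) · Y)
      ≈⟨ trace-·Y (J n) (I n) ⟩
    _
      ≈⟨ *-congˡ (+-cong (*-cong U.trace-J·complement Γ.trace-I·complement)
           (*-congˡ (+-cong (*-cong (trace-J·J {n}) (trace-I·J {n})) (*-cong U.total Γ.trace-I·X)))) ⟩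
    κ * (0ℝ * (N * N - N - N) + M * (N * N * N + 0ℝ * N))
      ≈⟨ solve 2 (λ k m → k :* (con 0ℚ :* (m :* m :- m :- m) :+ (m :- con 1ℚ :- con 1ℚ) :* (m :* m :* m :+ con 0ℚ :* m)) :=
           k :* (m :* m :* (m :- con 1ℚ :- con 1ℚ)) :* m) ≈-refl κ N ⟩
    κ * (N * N * M) * N
      ≈⟨ κNNM*x≈x N ⟩
    N ∎

  pair-J-J : trace ((J n ⊗ J n) · Y) ≈ N * N
  pair-J-J = begin
    trace ((J n ⊗ J n) · Y)
      ≈⟨ trace-·Y (J n) (J n) ⟩
    _
      ≈⟨ *-congˡ (+-cong (*-cong U.trace-J·complement Γ.trace-J·complement)
           (*-congˡ (+-cong (*-cong (trace-J·J {n}) (trace-J·J {n})) (*-cong U.total Γ.total)))) ⟩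
    κ * (0ℝ * 0ℝ + M * (N * N * (N * N) + 0ℝ * 0ℝ))
      ≈⟨ solve 3 (λ k m l → k :* (con 0ℚ :* con 0ℚ :+ l :* (m :* m :* (m :* m) :+ con 0ℚ :* con 0ℚ)) :=
           k :* (m :* m :* l) :* (m :* m)) ≈-refl κ N M ⟩
    κ * (N * N * M) * (N * N)
      ≈⟨ κNNM*x≈x (N * N) ⟩
    N * N ∎

  pair-I-E : ∀ j → trace ((I n ⊗ E n j) · Y) ≈ 1ℝ
  pair-I-E j = begin
    trace ((I n ⊗ E n j) · Y)
      ≈⟨ trace-·Y (I n) (E n j) ⟩
    _
      ≈⟨ *-congˡ (+-cong (*-cong U.trace-I·complement (Γ.trace-E·complement j))
           (*-congˡ (+-cong (*-cong (trace-I·J {n}) (trace-E· j (J n))) (*-cong U.trace-I·X (Γ.trace-E·X j))))) ⟩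
    κ * ((N * N - N - N) * (N - 1ℝ - 1ℝ) + M * (N * 1ℝ + N * 1ℝ))
      ≈⟨ solve 2 (λ k m → k :* ((m :* m :- m :- m) :* (m :- con 1ℚ :- con 1ℚ) :+ (m :- con 1ℚ :- con 1ℚ) :* (m :* con 1ℚ :+ m :* con 1ℚ)) :=
           k :* (m :* m :* (m :- con 1ℚ :- con 1ℚ))) ≈-refl κ N ⟩
    κ * (N * N * M)
      ≈⟨ κ*N*N*M≈1 ⟩
    1ℝ ∎

  pair-E-I : ∀ j → trace ((E n j ⊗ I n) · Y) ≈ 1ℝ
  pair-E-I j = begin
    trace ((E n j ⊗ I n) · Y)
      ≈⟨ trace-·Y (E n j) (I n) ⟩
    _
      ≈⟨ *-congˡ (+-cong (*-cong (U.trace-E·complement j) Γ.trace-I·complement)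
           (*-congˡ (+-cong (*-cong (trace-E· j (J n)) (trace-I·J {n})) (*-cong (U.trace-E·X j) Γ.trace-I·X)))) ⟩
    κ * ((N - 1ℝ - 1ℝ) * (N * N - N - N) + M * (1ℝ * N + 1ℝ * N))
      ≈⟨ solve 2 (λ k m → k :* ((m :- con 1ℚ :- con 1ℚ) :* (m :* m :- m :- m) :+ (m :- con 1ℚ :- con 1ℚ) :* (con 1ℚ :* m :+ con 1ℚ :* m)) :=
           k :* (m :* m :* (m :- con 1ℚ :- con 1ℚ))) ≈-refl κ N ⟩
    κ * (N * N * M)
      ≈⟨ κ*N*N*M≈1 ⟩
    1ℝ ∎

  off-diagonal : trace ((I n ⊗ (J n ⊟ I n) ⊞ (J n ⊟ I n) ⊗ I n) · Y) ≈ 0ℝ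
  off-diagonal = begin
    trace ((I n ⊗ (J n ⊟ I n) ⊞ (J n ⊟ I n) ⊗ I n) · Y)
      ≈⟨ trace-cong (λ p q → solve 4 (λ a b c d → a :* (c :- b) :+ (d :- a) :* b :=
          (a :* c :- a :* b) :+ (d :* b :- a :* b)) ≈-refl
           (I n (P p) (P q)) (I n (R p) (R q)) 1ℝ 1ℝ) ⟩
    trace (((I n ⊗ J n ⊟ I n ⊗ I n) ⊞ (J n ⊗ I n ⊟ I n ⊗ I n)) · Y)
      ≈⟨ ≈-trans (trace-⊞ (I n ⊗ J n ⊟ I n ⊗ I n) (J n ⊗ I n ⊟ I n ⊗ I n) Y)
           (+-cong (trace-⊟ (I n ⊗ J n) (I n ⊗ I n) Y) (trace-⊟ (J n ⊗ I n) (I n ⊗ I n) Y)) ⟩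
    _
      ≈⟨ +-cong (+-cong pair-I-J (-‿cong pair-I-I)) (+-cong pair-J-I (-‿cong pair-I-I)) ⟩
    (N - N) + (N - N)
      ≈⟨ solve 1 (λ m → (m :- m) :+ (m :- m) := con 0ℚ) ≈-refl N ⟩
    0ℝ ∎

  -- Half the squared length of the sum of two unit vectors in the plane; `0≤1-Γ` uses their
  -- difference.
  0≤1+Γ : ∀ p q → 0ℝ ≤ 1ℝ + Γ p q
  0≤1+Γ p q = ≤-respʳ-≈ (begin
    fromℚ ½ * ((x + y) * (x + y) + (z + w) * (z + w))
      ≈⟨ solve 4 (λ x y z w → con ½ :* ((x :+ y) :* (x :+ y) :+ (z :+ w) :* (z :+ w)) :=
           con ½ :* ((x :* x :+ z :* z) :+ (y :* y :+ w :* w)) :+ (x :* y :+ z :* w)) ≈-refl x y z w ⟩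
    fromℚ ½ * (Γ p p + Γ q q) + Γ p q
      ≈⟨ +-congʳ (*-congˡ (+-cong (F-diag i₁ p) (F-diag i₁ q))) ⟩
    fromℚ ½ * (1ℝ + 1ℝ) + Γ p q
      ≈⟨ +-congʳ (≗⇒≈ λ _ → refl) ⟩
    1ℝ + Γ p q ∎) (0≤x*y 0≤½ (0≤x+y (0≤x*x _) (0≤x*x _)))
    where
    x = C i₁ p
    y = C i₁ q
    z = S i₁ p
    w = S i₁ q

  0≤1-Γ : ∀ p q → 0ℝ ≤ 1ℝ - Γ p q
  0≤1-Γ p q = ≤-respʳ-≈ (begin
    fromℚ ½ * ((x - y) * (x - y) + (z - w) * (z - w))
      ≈⟨ solve 4 (λ x y z w → con ½ :* ((x :- y) :* (x :- y) :+ (z :- w) :* (z :- w)) :=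
           con ½ :* ((x :* x :+ z :* z) :+ (y :* y :+ w :* w)) :- (x :* y :+ z :* w)) ≈-refl x y z w ⟩
    fromℚ ½ * (Γ p p + Γ q q) - Γ p q
      ≈⟨ +-congʳ (*-congˡ (+-cong (F-diag i₁ p) (F-diag i₁ q))) ⟩
    fromℚ ½ * (1ℝ + 1ℝ) - Γ p q
      ≈⟨ +-congʳ (≗⇒≈ λ _ → refl) ⟩
    1ℝ - Γ p q ∎) (0≤x*y 0≤½ (0≤x+y (0≤x*x _) (0≤x*x _)))
    where
    x = C i₁ p
    y = C i₁ q
    z = S i₁ p
    w = S i₁ q

  -- The product of ones stands for the entry of `J n ⊗ J n`, so that `Y p q` is definitionally `κ`
  -- times an `entry`.
  entry : ℝ → ℝ → ℝ → ℝ → ℝ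
  entry a w b g = (N * a - 1ℝ - w) * (N * b - 1ℝ - g) + M * (1ℝ * 1ℝ + w * g)

  entry-cong : ∀ {a a′ w w′ b b′ g g′} → a ≈ a′ → w ≈ w′ → b ≈ b′ → g ≈ g′ → entry a w b g ≈ entry a′ w′ b′ g′
  entry-cong a w b g = +-cong
    (*-cong (+-cong (+-congʳ (*-congˡ a)) (-‿cong w)) (+-cong (+-congʳ (*-congˡ b)) (-‿cong g)))
    (*-congˡ (+-congˡ (*-cong w g)))

  -- Both pairs diagonal give M² + 2 M, exactly one gives 0 by the choice of `M`. With neither, 1 +
  -- w g is the mean of (1 + w) (1 + g) and (1 - w) (1 - g).
  0≤entry : ∀ i j p q → 0ℝ ≤ entry (I n i j) (U i j) (I n p q) (Γ p q)
  0≤entry i j p q with I-cases i j | I-cases p q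
  ... | inj₁ (refl , a) | inj₁ (refl , b) = ≤-respʳ-≈ (≈-trans
    (solve 1 (λ m → (m :- con 1ℚ :- con 1ℚ) :* (m :- con 1ℚ :- con 1ℚ) :+ (m :- con 1ℚ :- con 1ℚ) :* con (1ℚ ℚ.+ 1ℚ) :=
      (m :* con 1ℚ :- con 1ℚ :- con 1ℚ) :* (m :* con 1ℚ :- con 1ℚ :- con 1ℚ) :+ (m :- con 1ℚ :- con 1ℚ) :* (con 1ℚ :* con 1ℚ :+ con 1ℚ :* con 1ℚ)) ≈-refl N)
    (≈-sym (entry-cong a (u²≈1 i) b (F-diag i₁ p))))
    (0≤x+y (0≤x*y 0≤M 0≤M) (0≤x*y 0≤M (0≤fromℚ {1ℚ ℚ.+ 1ℚ} (ℚ.nonNegative⁻¹ _))))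
  ... | inj₁ (refl , a) | inj₂ b = ≈⇒≤ (≈-sym (≈-trans (entry-cong a (u²≈1 i) b ≈-refl)
    (solve 2 (λ m g → (m :* con 1ℚ :- con 1ℚ :- con 1ℚ) :* (m :* con 0ℚ :- con 1ℚ :- g) :+ (m :- con 1ℚ :- con 1ℚ) :* (con 1ℚ :* con 1ℚ :+ con 1ℚ :* g) :=
      con 0ℚ) ≈-refl N (Γ p q))))
  ... | inj₂ a | inj₁ (refl , b) = ≈⇒≤ (≈-sym (≈-trans (entry-cong a ≈-refl b (F-diag i₁ p))
    (solve 2 (λ m w → (m :* con 0ℚ :- con 1ℚ :- w) :* (m :* con 1ℚ :- con 1ℚ :- con 1ℚ) :+ (m :- con 1ℚ :- con 1ℚ) :* (con 1ℚ :* con 1ℚ :+ w :* con 1ℚ) :=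
      con 0ℚ) ≈-refl N (U i j))))
  ... | inj₂ a | inj₂ b = ≤-respʳ-≈ (≈-trans
    (solve 4 (λ m l w g → (con 1ℚ :+ w) :* (con 1ℚ :+ g) :+ l :* (con ½ :* ((con 1ℚ :+ w) :* (con 1ℚ :+ g) :+ (con 1ℚ :- w) :* (con 1ℚ :- g))) :=
      (m :* con 0ℚ :- con 1ℚ :- w) :* (m :* con 0ℚ :- con 1ℚ :- g) :+ l :* (con 1ℚ :* con 1ℚ :+ w :* g))
          ≈-refl N M (U i j) (Γ p q))
    (≈-sym (entry-cong a ≈-refl b ≈-refl)))
    (0≤x+y (0≤x*y (0≤1+u*u i j) (0≤1+Γ p q)) (0≤x*y 0≤M (0≤x*y 0≤½
      (0≤x+y (0≤x*y (0≤1+u*u i j) (0≤1+Γ p q)) (0≤x*y (0≤1-u*u i j) (0≤1-Γ p q))))))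

  Y-nonNegative : EntrywiseNonNegative Y
  Y-nonNegative p q = 0≤x*y 0≤κ (0≤entry (P p) (P q) (R p) (R q))

  Y-symmetric : Symmetric Y
  Y-symmetric p q = *-congˡ (entry-cong (I-sym (P p) (P q)) (*-comm (u (P p)) (u (P q)))
    (I-sym (R p) (R q)) (F-sym i₁ (R p) (R q)))

  i₀≢i₁ : i₀ ≢ i₁
  i₀≢i₁ eq with ≡.trans (≡.sym toℕ-i₀) (≡.trans (cong toℕ eq) toℕ-i₁)
  ... | ()

  weight : Fin n → ℝ
  weight j = 1ℝ - I n i₀ j - I n i₁ j

  0≤weight : ∀ j → 0ℝ ≤ weight j
  0≤weight j with I-cases i₀ j | I-cases i₁ j
  ... | inj₁ (refl , _) | inj₁ (eq , _) = contradiction (≡.sym eq) i₀≢i₁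
  ... | inj₁ (refl , a) | inj₂ b = ≈⇒≤ (≈-sym (≈-trans (+-cong (+-congˡ (-‿cong a)) (-‿cong b)) (≗⇒≈ λ _ → refl)))
  ... | inj₂ a | inj₁ (refl , b) = ≈⇒≤ (≈-sym (≈-trans (+-cong (+-congˡ (-‿cong a)) (-‿cong b)) (≗⇒≈ λ _ → refl)))
  ... | inj₂ a | inj₂ b = ≤-respʳ-≈ (≈-sym (≈-trans (+-cong (+-congˡ (-‿cong a)) (-‿cong b)) (≗⇒≈ λ _ → refl)))
    (0≤fromℚ (ℚ.nonNegative⁻¹ 1ℚ))

  -- By `∑F` all indices together give N times the identity, and `J n` and `Γ` are the terms at `i₀`
  -- and `i₁`. The square of this matrix is not n times itself, as it is for `complement U`, because
  -- index n - 1 repeats frequency 1; hence the Fourier sum.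
  complement-Γ : complement Γ ≋ sumMatrix λ j → scale (weight j) (F j)
  complement-Γ p q = ≈-sym (begin
    (sum λ j → (1ℝ - I n i₀ j - I n i₁ j) * F j p q)
      ≈⟨ (sum-cong λ (j : Fin n) → solve 3 (λ a b f → (con 1ℚ :- a :- b) :* f :=
          (f :+ (con (ℚ.- 1ℚ)) :* (a :* f)) :+ (con (ℚ.- 1ℚ)) :* (b :* f)) ≈-refl (I n i₀ j) (I n i₁ j) (F j p q)) ⟩
    (sum λ j → (F j p q + -1ℝ * (I n i₀ j * F j p q)) + -1ℝ * (I n i₁ j * F j p q))
      ≈⟨ ≈-trans (∑-distrib-+ (λ j → F j p q + -1ℝ * (I n i₀ j * F j p q)) (λ j → -1ℝ * (I n i₁ j * F j p q)))
           (+-cong (≈-trans (∑-distrib-+ (λ j → F j p q) (λ j → -1ℝ * (I n i₀ j * F j p q)))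
               (+-cong (∑F p q) (pick i₀))) (pick i₁)) ⟩
    (N * I n p q + -1ℝ * F i₀ p q) + -1ℝ * Γ p q
      ≈⟨ +-congʳ (+-congˡ (*-congˡ (F-i₀ p q))) ⟩
    (N * I n p q + -1ℝ * 1ℝ) + -1ℝ * Γ p q
      ≈⟨ solve 2 (λ a g → (a :+ con (ℚ.- 1ℚ) :* con 1ℚ) :+ con (ℚ.- 1ℚ) :* g := a :- con 1ℚ :- g)
          ≈-refl (N * I n p q) (Γ p q) ⟩
    complement Γ p q ∎)
    where
    -1ℝ = fromℚ (ℚ.- 1ℚ)
    pick : ∀ i → (sum λ j → -1ℝ * (I n i j * F j p q)) ≈ -1ℝ * F i p q
    pick i = ≈-trans (≈-sym (*-distribˡ-sum -1ℝ (λ j → I n i j * F j p q))) (*-congˡ (sum-I* i (λ j → F j p q)))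

  complement-U : complement U ≋ scale N⁻¹ (sumMatrix λ k → rankOne (λ i → complement U i k))
  complement-U i j = ≈-sym (begin
    N⁻¹ * (sum λ k → complement U i k * complement U j k)   ≈⟨ *-congˡ (complement-square i j) ⟩
    N⁻¹ * (N * complement U i j)                            ≈⟨ solve 3 (λ a b c → a :* (b :* c) :=
        (a :* b) :* c) ≈-refl N⁻¹ N (complement U i j) ⟩
    (N⁻¹ * N) * complement U i j                            ≈⟨ *-congʳ N⁻¹*N≈1 ⟩
    1ℝ * complement U i j                                   ≈⟨ *-identityˡ (complement U i j) ⟩
    complement U i j ∎)

  psd-⊗F : ∀ v j → PositiveSemidefinite (rankOne v ⊗ F j)
  psd-⊗F v j = psd-cong
    (λ p q → solve 6 (λ a b c d e f → (a :* b) :* (c :* d) :+ (a :* e) :* (c :* f) :=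
        (a :* c) :* (b :* d :+ e :* f)) ≈-refl
      (v (P p)) (C j (R p)) (v (P q)) (C j (R q)) (S j (R p)) (S j (R q)))
    (psd-⊞ (psd-rankOne (λ p → v (P p) * C j (R p))) (psd-rankOne (λ p → v (P p) * S j (R p))))

  -- The Kronecker product distributes over the two expansions and leaves a nonnegative combination
  -- of semidefinite products.
  psd-complement : PositiveSemidefinite (complement U ⊗ complement Γ)
  psd-complement = psd-cong
    (λ p q → ≈-sym (begin
      complement U (P p) (P q) * complement Γ (R p) (R q)
        ≈⟨ *-cong (complement-U (P p) (P q)) (complement-Γ (R p) (R q)) ⟩
      N⁻¹ * (sum λ k → column k (P p) (P q)) * (sum λ j → weight j * F j (R p) (R q))
        ≈⟨ ≈-trans (solve 3 (λ a b c → a :* b :* c := a :* (b :* c)) ≈-refl N⁻¹ _ _)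
             (*-congˡ (≈-sym (sum-*-sum (λ k → column k (P p) (P q)) (λ j → weight j * F j (R p) (R q))))) ⟩
      N⁻¹ * (sum λ k → sum λ j → column k (P p) (P q) * (weight j * F j (R p) (R q)))
        ≈⟨ *-congˡ (sum-cong λ (k : Fin n) → sum-cong λ (j : Fin n) → solve 3 (λ a b c → a :* (b :* c) :=
            b :* (a :* c)) ≈-refl
             (column k (P p) (P q)) (weight j) (F j (R p) (R q))) ⟩
      N⁻¹ * (sum λ k → sum λ j → weight j * (column k (P p) (P q) * F j (R p) (R q))) ∎))
    (psd-scale 0≤N⁻¹ (psd-sum λ k → psd-sum λ j → psd-scale (0≤weight j) (psd-⊗F (λ i → complement U i k) j)))
    where
    column : Fin n → Matrix n
    column k = rankOne (λ i → complement U i k)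

  Y-psd : PositiveSemidefinite Y
  Y-psd = psd-scale 0≤κ (psd-⊞ psd-complement (psd-scale 0≤M
    (psd-⊞ (psd-rankOne (λ _ → 1ℝ)) (psd-⊗F u i₁))))

  feasible : Feasible₁ n Y
  feasible = record
    { symmetric = Y-symmetric ; nonNegative = Y-nonNegative ; psd = Y-psd
    ; trace-I⊗E = pair-I-E ; trace-E⊗I = pair-E-I ; trace-off = off-diagonal
    ; trace-J = ≈-trans (trace-cong {A = J (n ℕ.* n)} {J n ⊗ J n} {Y} λ _ _ → ≈-sym (*-identityˡ 1ℝ))
        (≈-trans pair-J-J (≈-sym (fromℕ-* n n))) }

  trace-U·U : trace (U · U) ≈ N * N
  trace-U·U = ≈-trans
    (sum-≈const λ i → sum-≈const λ j → ≈-trans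
      (solve 2 (λ a b → a :* b :* (b :* a) := (a :* a) :* (b :* b)) ≈-refl (u i) (u j))
      (≈-trans (*-cong (u²≈1 i) (u²≈1 j)) (*-identityˡ 1ℝ)))
    (*-congˡ (*-identityʳ N))

  trace-cut· : ∀ {x y} A → trace (J n · A) ≈ x → trace (U · A) ≈ y → trace (cutMetric · A) ≈ fromℚ ½ * (x - y)
  trace-cut· A p q = ≈-trans (trace-scale (fromℚ ½) (J n ⊟ U) A)
    (*-congˡ (≈-trans (trace-⊟ (J n) U A) (+-cong p (-‿cong q))))

  trace-U·J : trace (U · J n) ≈ 0ℝ
  trace-U·J = ≈-trans (trace-comm U (J n)) U.total

  trace-U·complement : trace (U · complement U) ≈ 0ℝ
  trace-U·complement = ≈-trans (trace-·complement U U) (≈-trans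
    (+-cong (+-cong (*-congˡ (≈-trans (≈-sym (trace-I· U)) U.trace-I·X)) (-‿cong trace-U·J)) (-‿cong trace-U·U))
    (solve 1 (λ m → m :* m :- con 0ℚ :- m :* m := con 0ℚ) ≈-refl N))

  -- The complement block costs nothing, since the metric is a combination of `J n` and `U` and both
  -- have trace 0 against `complement U`. The other blocks see the cycle through its entries of
  -- `J n` and `Γ`, 1 and `cos` 1 per edge.
  objective-Y : objective₁ cutMetric Y ≈ fromℚ ½ * N * (1ℝ - cos 1)
  objective-Y = begin
    fromℚ ½ * trace ((cutMetric ⊗ C₁ n) · Y)
      ≈⟨ *-congˡ (trace-·Y cutMetric (C₁ n)) ⟩
    _
      ≈⟨ *-congˡ (*-congˡ (+-cong
           (*-congʳ (trace-cut· (complement U) U.trace-J·complement trace-U·complement))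
           (*-congˡ (+-cong
             (*-cong (trace-cut· (J n) (trace-J·J {n}) trace-U·J)
               (≈-trans (trace-C₁· 3≤n (J n)) (+-cong (sum-const n 1ℝ) (sum-const n 1ℝ))))
             (*-cong (trace-cut· U U.total trace-U·U)
               (≈-trans (trace-C₁· 3≤n Γ) (+-cong (sum-≈const λ p → ≈-trans (F-sym i₁ (next p) p) (Γ-next p))
                   (sum-≈const Γ-next)))))))) ⟩
    fromℚ ½ * (κ * (fromℚ ½ * (0ℝ - 0ℝ) * trace (C₁ n · complement Γ) +
      M * (fromℚ ½ * (N * N - 0ℝ) * (N * 1ℝ + N * 1ℝ) + fromℚ ½ * (0ℝ - N * N) * (N * cos 1 + N * cos 1))))
      ≈⟨ solve 5 (λ k m l c x → con ½ :* (k :* (con ½ :* (con 0ℚ :- con 0ℚ) :* x :+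
           l :* (con ½ :* (m :* m :- con 0ℚ) :* (m :* con 1ℚ :+ m :* con 1ℚ) :+ con ½ :* (con 0ℚ :- m :* m) :* (m :* c :+ m :* c)))) :=
           k :* (m :* m :* l) :* (con ½ :* m :* (con 1ℚ :- c))) ≈-refl κ N M (cos 1) (trace (C₁ n · complement Γ)) ⟩
    κ * (N * N * M) * (fromℚ ½ * N * (1ℝ - cos 1))
      ≈⟨ κNNM*x≈x _ ⟩
    fromℚ ½ * N * (1ℝ - cos 1) ∎

-- Tours of the cut metric

sum-split : ∀ k l (f : ℕ → ℝ) →
  sum {k ℕ.+ l} (λ i → f (toℕ i)) ≈ sum {k} (λ i → f (toℕ i)) + sum {l} (λ i → f (k ℕ.+ toℕ i))
sum-split k l f = ≈-trans (sum-++ k l (λ i → f (toℕ i))) (+-cong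
  (sum-cong λ (i : Fin k) → ≡⇒≈ (cong f (Fin.toℕ-↑ˡ i l)))
  (sum-cong λ (i : Fin l) → ≡⇒≈ (cong f (Fin.toℕ-↑ʳ k i))))

module _ {n : ℕ} {D : Matrix n} (metric : IsTSPInstance D) where
  open IsTSPInstance metric

  distance≤path : ∀ k (g : ℕ → Fin n) → D (g 0) (g k) ≤ sum {k} (λ i → D (g (toℕ i)) (g (suc (toℕ i))))
  distance≤path zero    g = ≈⇒≤ (zeroDiag (g 0))
  distance≤path (suc k) g = ≤-trans (triangle (g 0) (g (suc k)) (g 1))
    (+-mono-≤ (≈⇒≤ ≈-refl) (distance≤path k (λ i → g (suc i))))

  -- A closed path consists of two arcs joining `g 0` and `g k`.
  twoDistances≤closedPath : ∀ k l (g : ℕ → Fin n) → g (k ℕ.+ l) ≡ g 0 →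
    D (g 0) (g k) + D (g 0) (g k) ≤ sum {k ℕ.+ l} (λ i → D (g (toℕ i)) (g (suc (toℕ i))))
  twoDistances≤closedPath k l g closed = ≤-respʳ-≈ (≈-sym (sum-split k l (λ i → D (g i) (g (suc i)))))
    (+-mono-≤ (distance≤path k g) (≤-respˡ-≈
      (≈-trans (≡⇒≈ (cong₂ (λ i j → D (g i) j) (ℕ.+-identityʳ k) closed)) (symmetric (g k) (g 0)))
      (≤-respʳ-≈ (sum-cong λ (i : Fin l) → ≡⇒≈ (cong (λ j → D (g (k ℕ.+ toℕ i)) (g j)) (ℕ.+-suc k (toℕ i))))
        (distance≤path l (λ i → g (k ℕ.+ i))))))

  -- The tour is unrolled to a path indexed by naturals modulo n and cut at position `j`.
  twoDistances≤tourCost : .{{_ : ℕ.NonZero n}} → ∀ π (i j : Fin n) → toℕ i ≡ 0 →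
    D (π ⟨$⟩ʳ i) (π ⟨$⟩ʳ j) + D (π ⟨$⟩ʳ i) (π ⟨$⟩ʳ j) ≤ tourCost D π
  twoDistances≤tourCost π i j i≡0 = ≤-respˡ-≈
    (≡⇒≈ (cong₂ (λ a b → D (π ⟨$⟩ʳ a) (π ⟨$⟩ʳ b) + D (π ⟨$⟩ʳ a) (π ⟨$⟩ʳ b)) cyclic-0 (cyclic-toℕ j)))
    (≤-respʳ-≈ (≈-trans (≡⇒≈ (cong (λ m → sum {m} (λ i → f (toℕ i))) k+l≡n))
        (sum-cong λ (a : Fin n) → ≡⇒≈ (cong₂ (λ b c → D (π ⟨$⟩ʳ b) (π ⟨$⟩ʳ c)) (cyclic-toℕ a) (cyclic-suc a))))
      (twoDistances≤closedPath (toℕ j) (n ℕ.∸ toℕ j) (λ m → π ⟨$⟩ʳ cyclic m)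
        (cong (π ⟨$⟩ʳ_) (Fin.toℕ-injective (≡.trans (toℕ-cyclic (toℕ j ℕ.+ (n ℕ.∸ toℕ j)))
          (≡.trans (cong (_% n) k+l≡n) (≡.trans (ℕ.n%n≡0 n) (≡.sym (≡.trans (toℕ-cyclic 0) (ℕ.m*n%n≡0 0 n))))))))))
    where
    cyclic : ℕ → Fin n
    cyclic m = fromℕ< (ℕ.m%n<n m n)
    toℕ-cyclic : ∀ m → toℕ (cyclic m) ≡ m % n
    toℕ-cyclic m = Fin.toℕ-fromℕ< (ℕ.m%n<n m n)
    cyclic-toℕ : ∀ a → cyclic (toℕ a) ≡ a
    cyclic-toℕ a = Fin.toℕ-injective (≡.trans (toℕ-cyclic (toℕ a)) (ℕ.m<n⇒m%n≡m (Fin.toℕ<n a)))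
    cyclic-suc : ∀ a → cyclic (suc (toℕ a)) ≡ next a
    cyclic-suc a = Fin.toℕ-injective (≡.trans (toℕ-cyclic (suc (toℕ a))) (≡.sym (toℕ-next a)))
    cyclic-0 : cyclic 0 ≡ i
    cyclic-0 = ≡.trans (cong cyclic (≡.sym i≡0)) (cyclic-toℕ i)
    k+l≡n : toℕ j ℕ.+ (n ℕ.∸ toℕ j) ≡ n
    k+l≡n = ℕ.m+[n∸m]≡n (ℕ.<⇒≤ (Fin.toℕ<n j))
    f : ℕ → ℝ
    f m = D (π ⟨$⟩ʳ cyclic m) (π ⟨$⟩ʳ cyclic (suc m))

module _ {n : ℕ} (u : Fin n → ℝ) (u²≈1 : ∀ i → u i * u i ≈ 1ℝ) (∑u≈0 : sum u ≈ 0ℝ) where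
  open Cut u u²≈1 ∑u≈0

  cutMetric-isTSPInstance : IsTSPInstance cutMetric
  cutMetric-isTSPInstance = record
    { symmetric   = λ i j → *-congˡ (+-congˡ (-‿cong (*-comm (u i) (u j))))
    ; nonNegative = 0≤cutMetric
    ; zeroDiag    = cutMetric-diag
    -- Because (u k)² = 1, the slack is exactly ½ (1 - u i u k) (1 - u k u j).
    ; triangle    = λ i j k → 0≤y-x⇒x≤y (≤-respʳ-≈ (begin
        fromℚ ½ * ((1ℝ - u i * u k) * (1ℝ - u k * u j))
          ≈⟨ solve 3 (λ a b c → con ½ :* ((con 1ℚ :- a :* c) :* (con 1ℚ :- c :* b)) :=
               con ½ :* (con 1ℚ :- a :* c :- c :* b :+ a :* b :* (c :* c))) ≈-refl (u i) (u j) (u k) ⟩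
        fromℚ ½ * (1ℝ - u i * u k - u k * u j + u i * u j * (u k * u k))
          ≈⟨ *-congˡ (+-congˡ (*-congˡ (u²≈1 k))) ⟩
        fromℚ ½ * (1ℝ - u i * u k - u k * u j + u i * u j * 1ℝ)
          ≈⟨ solve 3 (λ a b c → con ½ :* (con 1ℚ :- a :* c :- c :* b :+ a :* b :* con 1ℚ) :=
               con ½ :* (con 1ℚ :- a :* c) :+ con ½ :* (con 1ℚ :- c :* b) :- con ½ :* (con 1ℚ :- a :* b))
                   ≈-refl (u i) (u j) (u k) ⟩
        cutMetric i k + cutMetric k j - cutMetric i j ∎)
        (0≤x*y 0≤½ (0≤x*y (0≤1-u*u i k) (0≤1-u*u k j))))
    }

-- Two clusters of h vertices and their shortest tour

2ℝ : ℝ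
2ℝ = fromℚ (1ℚ ℚ.+ 1ℚ)

sign : Bool → ℝ
sign true  = 1ℝ
sign false = - 1ℝ

sign² : ∀ b → sign b * sign b ≈ 1ℝ
sign² true  = ≗⇒≈ λ _ → refl
sign² false = ≗⇒≈ λ _ → refl

module TwoClusters (h : ℕ) (1≤h : 1 ℕ.≤ h) where
  n : ℕ
  n = h ℕ.+ h

  h<n : h ℕ.< n
  h<n = ℕ.m<m+n h 1≤h

  instance
    h-nonZero : ℕ.NonZero h
    h-nonZero = ℕ.>-nonZero 1≤h

    n-nonZero : ℕ.NonZero n
    n-nonZero = ℕ.>-nonZero (ℕ.<-trans 1≤h h<n)

  side : ℕ → Bool
  side m = does (m ℕ.<? h)

  side-true : ∀ {m} → m ℕ.< h → side m ≡ true
  side-true {m} = dec-true (m ℕ.<? h)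

  side-false : ∀ {m} → h ℕ.≤ m → side m ≡ false
  side-false {m} h≤m = dec-false (m ℕ.<? h) (ℕ.≤⇒≯ h≤m)

  u : Fin n → ℝ
  u i = sign (side (toℕ i))

  u²≈1 : ∀ i → u i * u i ≈ 1ℝ
  u²≈1 i = sign² (side (toℕ i))

  ∑u≈0 : sum u ≈ 0ℝ
  ∑u≈0 = begin
    sum u
      ≈⟨ sum-split h h (λ m → sign (side m)) ⟩
    sum {h} (λ i → sign (side (toℕ i))) + sum {h} (λ i → sign (side (h ℕ.+ toℕ i)))
      ≈⟨ +-cong (sum-≈const {h} λ i → ≡⇒≈ (cong sign (side-true (Fin.toℕ<n i))))
                (sum-≈const {h} λ i → ≡⇒≈ (cong sign (side-false (ℕ.m≤m+n h (toℕ i))))) ⟩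
    fromℕ h * 1ℝ + fromℕ h * - 1ℝ
      ≈⟨ solve 1 (λ m → m :* con 1ℚ :+ m :* (:- con 1ℚ) := con 0ℚ) ≈-refl (fromℕ h) ⟩
    0ℝ ∎

  open Cut u u²≈1 ∑u≈0 using (cutMetric) public

  isTSPInstance : IsTSPInstance cutMetric
  isTSPInstance = cutMetric-isTSPInstance u u²≈1 ∑u≈0

  distance : Bool → Bool → ℝ
  distance a b = fromℚ ½ * (1ℝ - sign a * sign b)

  opposite : ∀ b → ∃ λ i → distance b (side (toℕ {n} i)) ≈ 1ℝ
  opposite true  = fromℕ< h<n , ≈-trans
    (≡⇒≈ (cong (distance true) (≡.trans (cong side (Fin.toℕ-fromℕ< h<n)) (side-false ℕ.≤-refl)))) (≗⇒≈ λ _ → refl)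
  opposite false = fromℕ< (ℕ.<-trans 1≤h h<n) , ≈-trans
    (≡⇒≈ (cong (distance false) (≡.trans (cong side (Fin.toℕ-fromℕ< (ℕ.<-trans 1≤h h<n))) (side-true 1≤h))))
        (≗⇒≈ λ _ → refl)

  2≤tourCost : ∀ π → 2ℝ ≤ tourCost cutMetric π
  2≤tourCost π = ≤-respˡ-≈ (≈-trans (+-cong d≈1 d≈1) (≗⇒≈ λ _ → refl))
    (twoDistances≤tourCost isTSPInstance π i₀ j (Fin.toℕ-fromℕ< (ℕ.<-trans 1≤h h<n)))
    where
    i₀ = fromℕ< (ℕ.<-trans 1≤h h<n)
    v = opposite (side (toℕ (π ⟨$⟩ʳ i₀)))
    -- The time at which the tour visits a vertex of the cluster opposite to its start.
    j = π ⟨$⟩ˡ proj₁ v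
    d≈1 : cutMetric (π ⟨$⟩ʳ i₀) (π ⟨$⟩ʳ j) ≈ 1ℝ
    d≈1 = ≈-trans (≡⇒≈ (cong (cutMetric (π ⟨$⟩ʳ i₀)) (Perm.inverseʳ π))) (proj₂ v)

  -- The identity tour changes sides only from h - 1 to h and from n - 1 to 0, which are the last
  -- steps of the two halves.
  tourCost-id : tourCost cutMetric Perm.id ≈ 2ℝ
  tourCost-id = begin
    (sum λ i → cutMetric i (next i))
      ≈⟨ (sum-cong λ (i : Fin n) → ≡⇒≈ (cong (λ m → distance (side (toℕ i)) (side m)) (toℕ-next i))) ⟩
    (sum {n} λ i → step (toℕ i))
      ≈⟨ sum-split h h step ⟩
    sum {h} (λ i → step (toℕ i)) + sum {h} (λ i → step (h ℕ.+ toℕ i))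
      ≈⟨ +-cong (sum-single last (λ i → step (toℕ i)) left-inner)
          (sum-single last (λ i → step (h ℕ.+ toℕ i)) right-inner) ⟩
    step (toℕ last) + step (h ℕ.+ toℕ last)
      ≈⟨ +-cong left-last right-last ⟩
    1ℝ + 1ℝ
      ≈⟨ ≗⇒≈ (λ _ → refl) ⟩
    2ℝ ∎
    where
    step : ℕ → ℝ
    step m = distance (side m) (side (suc m % n))
    last : Fin h
    last = fromℕ< (ℕ.≤-reflexive (ℕ.suc-pred h))
    suc-last : suc (toℕ last) ≡ h
    suc-last = ≡.trans (cong suc (Fin.toℕ-fromℕ< (ℕ.≤-reflexive (ℕ.suc-pred h)))) (ℕ.suc-pred h)
    inner : ∀ (i : Fin h) → i ≢ last → suc (toℕ i) ℕ.< h
    inner i i≢last = ℕ.≤∧≢⇒< (Fin.toℕ<n i) λ eq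
        → i≢last (Fin.toℕ-injective (ℕ.suc-injective (≡.trans eq (≡.sym suc-last))))
    step≡ : ∀ {m a b} → side m ≡ a → side (suc m % n) ≡ b → step m ≈ distance a b
    step≡ refl refl = ≈-refl
    left-inner : ∀ i → i ≢ last → step (toℕ i) ≈ 0ℝ
    left-inner i i≢last = ≈-trans (step≡ (side-true (Fin.toℕ<n i))
      (≡.trans (cong side (ℕ.m<n⇒m%n≡m (ℕ.<-trans (inner i i≢last) h<n))) (side-true (inner i i≢last))))
          (≗⇒≈ λ _ → refl)
    right-inner : ∀ i → i ≢ last → step (h ℕ.+ toℕ i) ≈ 0ℝ
    right-inner i i≢last = ≈-trans (step≡ (side-false (ℕ.m≤m+n h (toℕ i)))
      (≡.trans (cong side (ℕ.m<n⇒m%n≡m (subst (ℕ._< n) (ℕ.+-suc h (toℕ i)) (ℕ.+-monoʳ-< h (inner i i≢last)))))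
        (side-false (ℕ.m≤n⇒m≤1+n (ℕ.m≤m+n h (toℕ i)))))) (≗⇒≈ λ _ → refl)
    left-last : step (toℕ last) ≈ 1ℝ
    left-last = ≈-trans (step≡ (side-true (Fin.toℕ<n last))
      (≡.trans (cong side (≡.trans (cong (_% n) suc-last) (ℕ.m<n⇒m%n≡m h<n))) (side-false ℕ.≤-refl))) (≗⇒≈ λ _ → refl)
    right-last : step (h ℕ.+ toℕ last) ≈ 1ℝ
    right-last = ≈-trans (step≡ (side-false (ℕ.m≤m+n h (toℕ last)))
      (≡.trans (cong side (≡.trans (cong (_% n) (≡.trans (≡.sym (ℕ.+-suc h (toℕ last)))
          (cong (h ℕ.+_) suc-last))) (ℕ.n%n≡0 n)))
        (side-true 1≤h))) (≗⇒≈ λ _ → refl)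

  OPT-TSP : IsOPT-TSP cutMetric 2ℝ
  OPT-TSP = (Perm.id , tt , tourCost-id) , λ π _ → 2≤tourCost π

  module _ (3≤n : 3 ℕ.≤ n) (root : RootOfUnity n) where

    OPT-SDP₁ : IsOPT-SDP₁ cutMetric (fromℚ ½ * fromℕ n * (1ℝ - RootOfUnity.cos root 1))
    OPT-SDP₁ = (Y , feasible , objective-Y) ,
      LowerBound.lowerBound 3≤n root u u²≈1 ∑u≈0
      where open UpperBound 3≤n root u u²≈1 ∑u≈0

-- The instances with 2^(m+2) vertices and the growth of their ratio

-- 2^(m+1), doubled by addition to match the index of `Bisection.halfTurn` definitionally.
halfSize : ℕ → ℕ
halfSize zero    = 2
halfSize (suc m) = halfSize m ℕ.+ halfSize m

2≤halfSize : ∀ m → 2 ℕ.≤ halfSize m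
2≤halfSize zero    = ℕ.≤-refl
2≤halfSize (suc m) = ℕ.≤-trans (2≤halfSize m) (ℕ.m≤m+n (halfSize m) (halfSize m))

halfTurn : ∀ m → HalfTurn (halfSize m)
halfTurn zero    = rightAngle
halfTurn (suc m) = Bisection.halfTurn (halfTurn m) (halve (halfTurn m))

root : ∀ m → RootOfUnity (halfSize m ℕ.+ halfSize m)
root m = rootOfUnity (halfTurn m) (halve (halfTurn m))

optSDP : ℕ → ℝ
optSDP m = fromℚ ½ * fromℕ (halfSize m ℕ.+ halfSize m) * (1ℝ - HalfTurn.c (halfTurn m))

-- By the half-angle formula, doubling n divides the SDP optimum by 1 + cos (π / n).
ratio : ℕ → ℝ
ratio zero    = 1ℝ
ratio (suc m) = ratio m + Half.c (halve (halfTurn m)) * ratio m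

-- At n = 4 the cosine is 0 and the optimum is 2, the tour cost. The step is (1 + c′) (1 - c′) = 1 -
-- c′² = ½ (1 - c).
ratio*optSDP : ∀ m → ratio m * optSDP m ≈ 2ℝ
ratio*optSDP zero    = ≗⇒≈ λ _ → refl
ratio*optSDP (suc m) = begin
  (r + c′ * r) * (fromℚ ½ * fromℕ (n ℕ.+ n) * (1ℝ - c′))
    ≈⟨ *-congˡ (*-congʳ (*-congˡ (fromℕ-+ n n))) ⟩
  (r + c′ * r) * (fromℚ ½ * (fromℕ n + fromℕ n) * (1ℝ - c′))
    ≈⟨ solve 3 (λ r c m → (r :+ c :* r) :* (con ½ :* (m :+ m) :* (con 1ℚ :- c)) :=
        r :* (m :* (con 1ℚ :- c :* c))) ≈-refl r c′ (fromℕ n) ⟩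
  r * (fromℕ n * (1ℝ - c′ * c′))
    ≈⟨ *-congˡ (*-congˡ (+-congˡ (-‿cong (Half.c²≈ (halve (halfTurn m)))))) ⟩
  r * (fromℕ n * (1ℝ - fromℚ ½ * (1ℝ + c)))
    ≈⟨ solve 3 (λ r c m → r :* (m :* (con 1ℚ :- con ½ :* (con 1ℚ :+ c))) := r :* (con ½ :* m :* (con 1ℚ :- c)))
        ≈-refl r c (fromℕ n) ⟩
  r * optSDP m
    ≈⟨ ratio*optSDP m ⟩
  2ℝ ∎
  where
  n = halfSize m ℕ.+ halfSize m
  r = ratio m
  c = HalfTurn.c (halfTurn m)
  c′ = Half.c (halve (halfTurn m))

-- Every factor 1 + c is at least 3/2, so the growth is even exponential. The linear bound only
-- needs that each step adds c r ≥ ½.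
1+½m≤ratio : ∀ m k → 1ℚ ℚ.+ ½ ℚ.* (+ m ℚ./ 1) ℚ.≤ seq (ratio m) k
1+½m≤ratio zero    k = ℚ.≤-refl
1+½m≤ratio (suc m) k = ℚ.≤-trans
  (ℚ.≤-reflexive (≡.trans (cong (λ q → 1ℚ ℚ.+ ½ ℚ.* q) (ℕ/1-suc m))
    (ℚ-solve 1 (λ q → con′ 1ℚ +′ con′ ½ *′ (con′ 1ℚ +′ q) =′ (con′ 1ℚ +′ con′ ½ *′ q) +′ con′ ½) refl (+ m ℚ./ 1))))
  (ℚ.+-mono-≤ (1+½m≤ratio m k) (ℚ.≤-trans (ℚ.≤-reflexive (≡.sym (ℚ.*-identityʳ ½)))
    (ℚ.≤-trans (ℚ.*-monoˡ-≤-nonNeg ½ 1≤r) (ℚ.*-monoʳ-≤-nonNeg r {{ℚ.nonNegative (ℚ.≤-trans (ℚ.nonNegative⁻¹ 1ℚ) 1≤r)}}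
      (proj₁ (Half.½≤c≤1 (halve (halfTurn m)) k))))))
  where
  open ℚ-Solver.+-*-Solver renaming (solve to ℚ-solve; con to con′; _:+_ to _+′_; _:*_ to _*′_; _:=_ to _=′_)
  r = seq (ratio m) k
  1≤r : 1ℚ ℚ.≤ r
  1≤r = ℚ.≤-trans (subst (ℚ._≤ 1ℚ ℚ.+ ½ ℚ.* (+ m ℚ./ 1)) (ℚ.+-identityʳ 1ℚ)
    (ℚ.+-monoʳ-≤ 1ℚ (ℚ-0≤p*q 0≤½ℚ (ℚ.nonNegative⁻¹ (+ m ℚ./ 1) {{ℚ.normalize-nonNeg m 1}})))) (1+½m≤ratio m k)

ratio-unbounded : ∀ x → ∃ λ m → x < ratio m
ratio-unbounded x = m , mk< ½ (ℚ.positive⁻¹ ½) (mapEventually (λ k ∣x∣≤B → ℚ.<-≤-trans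
    (ℚ.+-mono-≤-< (ℚ.≤-trans (p≤∣p∣ (seq x k)) (ℚ.≤-trans ∣x∣≤B B≤½m)) ½<1)
    (ℚ.≤-trans (ℚ.≤-reflexive (ℚ.+-comm (½ ℚ.* (+ m ℚ./ 1)) 1ℚ)) (1+½m≤ratio m k)))
  (proj₂ (proj₂ (bounded x))))
  where
  B = proj₁ (bounded x)
  -- The guaranteed growth is ½ per step: m ≥ 2 B gives a ratio of at least 1 + B, and the 1 leaves
  -- room for the gap ½.
  m = proj₁ (archimedean (B ℚ.+ B))
  ½<1 : ½ ℚ.< 1ℚ
  ½<1 = subst (ℚ._< 1ℚ) (ℚ.+-identityʳ ½) (ℚ.+-monoʳ-< ½ {0ℚ} {½} (ℚ.positive⁻¹ ½))
  B≤½m : B ℚ.≤ ½ ℚ.* (+ m ℚ./ 1)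
  B≤½m = ℚ.≤-trans (ℚ.≤-reflexive (≡.sym (≡.trans (ℚ.*-distribˡ-+ ½ B B)
      (≡.trans (≡.sym (ℚ.*-distribʳ-+ B ½ ½)) (ℚ.*-identityˡ B)))))
    (ℚ.*-monoˡ-≤-nonNeg ½ (proj₂ (archimedean (B ℚ.+ B))))

corollary3p9 : SupIs+∞ (λ r →
    ∃[ n ] Σ[ D ∈ Matrix n ] ∃[ t ] ∃[ s ]
    3 ℕ.≤ n × IsTSPInstance D ×
    IsOPT-TSP D t × IsOPT-SDP₁ D s ×
    0ℝ < t × IsRatio t s r)
corollary3p9 x = let m , x<ratio = ratio-unbounded x in
  fin (ratio m) , instanceAt m , x<ratio
  where
  instanceAt : ∀ m → ∃[ n ] Σ[ D ∈ Matrix n ] ∃[ t ] ∃[ s ]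
    3 ℕ.≤ n × IsTSPInstance D × IsOPT-TSP D t × IsOPT-SDP₁ D s × 0ℝ < t × IsRatio t s (fin (ratio m))
  instanceAt m = n , cutMetric , 2ℝ , s , 3≤n , isTSPInstance , OPT-TSP , OPT-SDP₁ 3≤n (root m) ,
    0<fromℚ (ℚ.positive⁻¹ _) ,
    0<x*y (0<x*y (0<fromℚ (ℚ.positive⁻¹ ½)) (0<fromℕ n)) (RootOfUnity.cos-1<1 (root m)) ,
    -- `OPT-SDP₁` is phrased with `cos` 1, the recursion of `optSDP` with the base cosine; `cos-1`
    -- identifies the two.
    ≈-trans (*-congˡ (*-congˡ (+-congˡ (-‿cong (HalfTurn.cos-1 (halfTurn m)))))) (ratio*optSDP m)
    where
    1≤h : 1 ℕ.≤ halfSize m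
    1≤h = ℕ.<⇒≤ (2≤halfSize m)
    open TwoClusters (halfSize m) 1≤h
    3≤n : 3 ℕ.≤ n
    3≤n = ℕ.≤-trans (ℕ.m≤m+n 3 1) (ℕ.+-mono-≤ (2≤halfSize m) (2≤halfSize m))
    s : ℝ
    s = fromℚ ½ * fromℕ n * (1ℝ - RootOfUnity.cos (root m) 1)
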